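{- Let $\Phi=(G,\varphi)$ be a complex unit gain graph of order $n$ with $r(\Phi)=r(G)-2\theta(G)$. Then (a) the cycles (if any) of $G$ are pairwise vertex-disjoint; (b) each cycle $C_p^{\varphi}$ (if any) of $\Phi$ is of Type A with order $p\equiv 2\pmod 4$; (c) $r(G)=r(T_G)+\sum_{O\in\mathcal{C}(G)}|V(O)|$ and $r(T_G)=r(\Gamma_G)$.
   Context: A complex unit gain graph $\Phi=(G,\varphi)$ consists of a finite simple graph $G$ with vertex set $\{v_1,\dots,v_n\}$ and a gain function $\varphi$ assigning to each oriented edge $e_{ij}$ ($v_iv_j\in E(G)$) a complex number of modulus $1$ with $\varphi(e_{ji})=\overline{\varphi(e_{ij})}$. $A(\Phi)$ is the Hermitian matrix with $(i,j)$ entry $\varphi(e_{ij})$ if $v_iv_j\in E(G)$ and $0$ otherwise; $r(\Phi)$ is its rank; $r(\cdot)$ of a simple graph is the rank of its $0$-$1$ adjacency matrix. $\theta(G)=|E(G)|-|V(G)|+\omega(G)$, $\omega(G)$ the number of components. For a gain cycle with vertices $v_1,\dots,v_p$ in cyclic order, $\varphi(C_p)=\varphi(e_{12})\cdots\varphi(e_{p1})$; for $p$ even it is of Type A if $\varphi(C_p)=(-1)^{p/2}$. For a graph $G$ whose cycles are pairwise vertex-disjoint, $\mathcal{C}(G)$ is its set of cycles, and $T_G$ is the acyclic graph obtained by contracting each cycle $O$ to a vertex $t_O$: its vertex set is $U\cup C_G$, where $U$ is the set of vertices of $G$ on no cycle and $C_G=\{t_O:O\in\mathcal{C}(G)\}$;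 $u_1,u_2\in U$ are adjacent iff $u_1u_2\in E(G)$; $u\in U$ is adjacent to $t_O$ iff $u$ is adjacent in $G$ to some vertex of $O$; $t_{O_1},t_{O_2}$ are adjacent iff some edge of $G$ joins a vertex of $O_1$ to a vertex of $O_2$. $\Gamma_G$ is obtained from $T_G$ by deleting the vertices of $C_G$ and their incident edges. -}

module Defs where

open import Level using (0ℓ)
open import Algebra.Bundles.Raw using (RawRing)
import Algebra.Definitions.RawMonoid as RawMonoidDefs
import Algebra.Definitions.RawSemiring as RawSemiringDefs
open import Data.Bool.Base using (if_then_else_)
open import Data.Nat.Base as ℕ using (ℕ; zero; suc)
import Data.Nat.Properties as ℕ
open import Data.Nat.Divisibility using (_∣_)
open import Data.Nat.DivMod using (_mod_) renaming (_/_ to _/ℕ_)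
open import Data.Integer.Base as ℤ using (ℤ)
open import Data.Rational.Base as ℚ
  using (ℚ; 0ℚ; 1ℚ; Positive; positive; nonNegative; 1/_)
import Data.Rational.Properties as ℚ
open import Data.Rational.Solver using (module +-*-Solver)
open import Data.Fin.Base as Fin using (Fin; toℕ)
import Data.Fin.Properties as Fin
open import Data.Vec.Base as Vec using (Vec; []; _∷_)
import Data.Vec.Properties as Vec
open import Data.List.Base as List
  using (List; []; _∷_; length; filter; allFin; cartesianProduct; deduplicate)
open import Data.List.Membership.Propositional using () renaming (_∈_ to _∈ˡ_)
import Data.List.Membership.Propositional.Properties as ∈ˡ
import Data.List.Membership.Setoid.Properties as ∈ˢ
open import Data.List.Relation.Unary.Any as Any using (Any; here)
import Data.List.Relation.Unary.Any.Properties as Any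
open import Data.List.Relation.Unary.All as All using ()
open import Data.List.Relation.Unary.AllPairs using (AllPairs; _∷_)
import Data.List.Relation.Unary.Unique.DecSetoid.Properties as Unique
open import Data.Product.Base using (∃; ∃-syntax; _×_; _,_; proj₁; proj₂)
open import Data.Sum.Base using (_⊎_; inj₁; inj₂)
open import Function.Base using (_∘_)
open import Function.Bundles using (_⇔_; mk⇔; Equivalence)
open import Function.Definitions using (Injective)
open import Relation.Nullary using (¬_; Dec; yes; no; does; contradiction)
open import Relation.Nullary.Decidable using (map′; ¬?; _×-dec_; _⊎-dec_; _→-dec_)
open import Relation.Binary.Core using (Rel)
open import Relation.Binary.Definitions using (Decidable; Symmetric)
open import Relation.Binary.Structures using (IsDecEquivalence)
open import Relation.Binary.Bundles using (DecSetoid)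
open import Relation.Binary.PropositionalEquality
  using (_≡_; _≢_; refl; sym; trans; cong; cong₂; subst; subst₂)
open import Relation.Binary.Construct.Closure.ReflexiveTransitive as Star
  using (Star; ε; _◅_; _◅◅_)

------------------------------------------------------------------------
-- Real numbers: Cauchy sequences of rationals.  The modulus of
-- convergence is part of the data; equality is _≃_, not _≡_.

IsCauchy : (ℕ → ℚ) → Set
IsCauchy x = ∀ δ → 0ℚ ℚ.< δ →
  ∃[ N ] ∀ m n → N ℕ.≤ m → N ℕ.≤ n → ℚ.∣ x m ℚ.- x n ∣ ℚ.≤ δ

record ℝ : Set where
  constructor mkℝ
  field
    seq    : ℕ → ℚ
    cauchy : IsCauchy seq

open ℝ

infix 4 _≃_
record _≃_ (x y : ℝ) : Set where
  constructor mk≃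
  field
    close : ∀ δ → 0ℚ ℚ.< δ →
      ∃[ N ] ∀ n → N ℕ.≤ n → ℚ.∣ seq x n ℚ.- seq y n ∣ ℚ.≤ δ

private
  open +-*-Solver

  regroup-+ : ∀ a b c d → (a ℚ.- b) ℚ.+ (c ℚ.- d) ≡ (a ℚ.+ c) ℚ.- (b ℚ.+ d)
  regroup-+ = solve 4 (λ a b c d → (a :- b) :+ (c :- d) := (a :+ c) :- (b :+ d)) refl

  regroup-* : ∀ a b c d →
    a ℚ.* (c ℚ.- d) ℚ.+ d ℚ.* (a ℚ.- b) ≡ a ℚ.* c ℚ.- b ℚ.* d
  regroup-* = solve 4 (λ a b c d →
    a :* (c :- d) :+ d :* (a :- b) := a :* c :- b :* d) refl

  cancel : ∀ a b → (a ℚ.- b) ℚ.+ b ≡ a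
  cancel = solve 2 (λ a b → (a :- b) :+ b := a) refl

  split-≤ : ∀ {c} a b {B C D} → a ℚ.+ b ≡ c → B ℚ.+ C ≡ D →
    ℚ.∣ a ∣ ℚ.≤ B → ℚ.∣ b ∣ ℚ.≤ C → ℚ.∣ c ∣ ℚ.≤ D
  split-≤ a b refl refl p q = ℚ.≤-trans (ℚ.∣p+q∣≤∣p∣+∣q∣ a b) (ℚ.+-mono-≤ p q)

  product-≤ : ∀ a c {B D} → 0ℚ ℚ.≤ B → ℚ.∣ a ∣ ℚ.≤ B → ℚ.∣ c ∣ ℚ.≤ D →
    ℚ.∣ a ℚ.* c ∣ ℚ.≤ B ℚ.* D
  product-≤ a c {B} {D} 0≤B p q = subst (ℚ._≤ B ℚ.* D) (sym (ℚ.∣p*q∣≡∣p∣*∣q∣ a c))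
    (ℚ.≤-trans
      (ℚ.*-monoʳ-≤-nonNeg ℚ.∣ c ∣ {{nonNegative (ℚ.0≤∣p∣ c)}} p)
      (ℚ.*-monoˡ-≤-nonNeg B {{nonNegative 0≤B}} q))

  divide : ∀ {δ} B → 0ℚ ℚ.< B → 0ℚ ℚ.< δ → ∃[ η ] (0ℚ ℚ.< η × B ℚ.* η ≡ δ)
  divide {δ} B 0<B 0<δ = B⁻¹ ℚ.* δ
    , subst (ℚ._< B⁻¹ ℚ.* δ) (ℚ.*-zeroʳ B⁻¹) (ℚ.*-monoʳ-<-pos B⁻¹ {{B⁻¹>0}} 0<δ)
    , trans (sym (ℚ.*-assoc B B⁻¹ δ))
        (trans (cong (ℚ._* δ) (ℚ.*-inverseʳ B {{nz}})) (ℚ.*-identityˡ δ))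
    where
    instance
      B>0 : Positive B
      B>0 = positive 0<B
    nz = ℚ.pos⇒nonZero B
    B⁻¹ = (1/ B) {{nz}}
    B⁻¹>0 : Positive B⁻¹
    B⁻¹>0 = ℚ.1/pos⇒pos B

  0<1 : 0ℚ ℚ.< 1ℚ
  0<1 = ℚ.positive⁻¹ 1ℚ

  half : ∀ {δ} → 0ℚ ℚ.< δ → ∃[ η ] (0ℚ ℚ.< η × η ℚ.+ η ≡ δ)
  half {δ} 0<δ with divide (1ℚ ℚ.+ 1ℚ) (ℚ.+-mono-< 0<1 0<1) 0<δ
  ... | η , 0<η , 2η≡δ = η , 0<η ,
    trans (sym (trans (ℚ.*-distribʳ-+ η 1ℚ 1ℚ) (cong₂ ℚ._+_ (ℚ.*-identityˡ η) (ℚ.*-identityˡ η)))) 2η≡δ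

  bounded : ∀ x → IsCauchy x →
    ∃[ B ] ∃[ N ] (0ℚ ℚ.< B × (∀ n → N ℕ.≤ n → ℚ.∣ x n ∣ ℚ.≤ B))
  bounded x cx with cx 1ℚ 0<1
  ... | N , hN = 1ℚ ℚ.+ ℚ.∣ x N ∣ , N , ℚ.+-mono-<-≤ 0<1 (ℚ.0≤∣p∣ (x N))
    , λ n p → split-≤ (x n ℚ.- x N) (x N) (cancel (x n) (x N)) refl
        (hN n N p ℕ.≤-refl) ℚ.≤-refl

  *-difference-≤ : ∀ a b c d {B C η ζ γ δ} → 0ℚ ℚ.< B → 0ℚ ℚ.< C →
    B ℚ.* η ≡ γ → C ℚ.* ζ ≡ γ → γ ℚ.+ γ ≡ δ →
    ℚ.∣ a ∣ ℚ.≤ B → ℚ.∣ d ∣ ℚ.≤ C → ℚ.∣ c ℚ.- d ∣ ℚ.≤ η → ℚ.∣ a ℚ.- b ∣ ℚ.≤ ζ →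
    ℚ.∣ a ℚ.* c ℚ.- b ℚ.* d ∣ ℚ.≤ δ
  *-difference-≤ a b c d 0<B 0<C Bη≡γ Cζ≡γ 2γ≡δ a≤B d≤C c-d≤η a-b≤ζ =
    split-≤ (a ℚ.* (c ℚ.- d)) (d ℚ.* (a ℚ.- b)) (regroup-* a b c d)
      (trans (cong₂ ℚ._+_ Bη≡γ Cζ≡γ) 2γ≡δ)
      (product-≤ a (c ℚ.- d) (ℚ.<⇒≤ 0<B) a≤B c-d≤η)
      (product-≤ d (a ℚ.- b) (ℚ.<⇒≤ 0<C) d≤C a-b≤ζ)

  -- Abstract because normalising these proofs is very slow.
  abstract
    const-cauchy : ∀ q → IsCauchy (λ _ → q)
    const-cauchy q δ 0<δ = 0 , λ _ _ _ _ →
      subst (ℚ._≤ δ) (cong ℚ.∣_∣ (sym (ℚ.+-inverseʳ q))) (ℚ.<⇒≤ 0<δ)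

    +-cauchy : ∀ x y → IsCauchy x → IsCauchy y → IsCauchy (λ n → x n ℚ.+ y n)
    +-cauchy x y cx cy δ 0<δ with half 0<δ
    ... | η , 0<η , 2η≡δ with cx η 0<η | cy η 0<η
    ... | M , hM | N , hN = M ℕ.⊔ N , λ m n p q →
      split-≤ (x m ℚ.- x n) (y m ℚ.- y n) (regroup-+ (x m) (x n) (y m) (y n)) 2η≡δ
        (hM m n (ℕ.m⊔n≤o⇒m≤o M N p) (ℕ.m⊔n≤o⇒m≤o M N q))
        (hN m n (ℕ.m⊔n≤o⇒n≤o M N p) (ℕ.m⊔n≤o⇒n≤o M N q))

    neg-cauchy : ∀ x → IsCauchy x → IsCauchy (λ n → ℚ.- x n)
    neg-cauchy x cx δ 0<δ with cx δ 0<δ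
    ... | N , hN = N , λ m n p q → subst (ℚ._≤ δ)
      (trans (sym (ℚ.∣-p∣≡∣p∣ (x m ℚ.- x n)))
        (cong ℚ.∣_∣ (ℚ.neg-distrib-+ (x m) (ℚ.- x n))))
      (hN m n p q)

    *-cauchy : ∀ x y → IsCauchy x → IsCauchy y → IsCauchy (λ n → x n ℚ.* y n)
    *-cauchy x y cx cy δ 0<δ =
      let B , M , 0<B , ∣x∣≤B = bounded x cx
          C , N , 0<C , ∣y∣≤C = bounded y cy
          γ , 0<γ , 2γ≡δ = half 0<δ
          η , 0<η , Bη≡γ = divide B 0<B 0<γ
          ζ , 0<ζ , Cζ≡γ = divide C 0<C 0<γ
          K , hK = cx ζ 0<ζ
          L , hL = cy η 0<η
      in (M ℕ.⊔ N) ℕ.⊔ (K ℕ.⊔ L) , λ m n p q →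
      let p₁ = ℕ.m⊔n≤o⇒m≤o (M ℕ.⊔ N) (K ℕ.⊔ L) p
          p₂ = ℕ.m⊔n≤o⇒n≤o (M ℕ.⊔ N) (K ℕ.⊔ L) p
          q₁ = ℕ.m⊔n≤o⇒m≤o (M ℕ.⊔ N) (K ℕ.⊔ L) q
          q₂ = ℕ.m⊔n≤o⇒n≤o (M ℕ.⊔ N) (K ℕ.⊔ L) q
      in *-difference-≤ (x m) (x n) (y m) (y n) 0<B 0<C Bη≡γ Cζ≡γ 2γ≡δ
           (∣x∣≤B m (ℕ.m⊔n≤o⇒m≤o M N p₁))
           (∣y∣≤C n (ℕ.m⊔n≤o⇒n≤o M N q₁))
           (hL m n (ℕ.m⊔n≤o⇒n≤o K L p₂) (ℕ.m⊔n≤o⇒n≤o K L q₂))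
           (hK m n (ℕ.m⊔n≤o⇒m≤o K L p₂) (ℕ.m⊔n≤o⇒m≤o K L q₂))

infixl 6 _+ᴿ_ _-ᴿ_
infixl 7 _*ᴿ_
infix  8 -ᴿ_

fromℚ : ℚ → ℝ
fromℚ q = mkℝ (λ _ → q) (const-cauchy q)

_+ᴿ_ _*ᴿ_ : ℝ → ℝ → ℝ
x +ᴿ y = mkℝ (λ n → seq x n ℚ.+ seq y n) (+-cauchy (seq x) (seq y) (cauchy x) (cauchy y))
x *ᴿ y = mkℝ (λ n → seq x n ℚ.* seq y n) (*-cauchy (seq x) (seq y) (cauchy x) (cauchy y))

-ᴿ_ : ℝ → ℝ
-ᴿ x = mkℝ (λ n → ℚ.- seq x n) (neg-cauchy (seq x) (cauchy x))

_-ᴿ_ : ℝ → ℝ → ℝ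
x -ᴿ y = x +ᴿ (-ᴿ y)

------------------------------------------------------------------------
-- Complex numbers

record ℂ : Set where
  constructor _+i_
  field
    re im : ℝ

open ℂ public

infix 4 _≈_
_≈_ : Rel ℂ 0ℓ
z ≈ w = re z ≃ re w × im z ≃ im w

ℂ-rawRing : RawRing 0ℓ 0ℓ
ℂ-rawRing = record
  { Carrier = ℂ
  ; _≈_     = _≈_
  ; _+_     = λ z w → (re z +ᴿ re w) +i (im z +ᴿ im w)
  ; _*_     = λ z w → (re z *ᴿ re w -ᴿ im z *ᴿ im w) +i (re z *ᴿ im w +ᴿ im z *ᴿ re w)
  ; -_      = λ z → (-ᴿ re z) +i (-ᴿ im z)
  ; 0#      = fromℚ 0ℚ +i fromℚ 0ℚ
  ; 1#      = fromℚ 1ℚ +i fromℚ 0ℚ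
  }

open RawRing ℂ-rawRing public using (0#; 1#)
  renaming (_+_ to _+ᶜ_; _*_ to _*ᶜ_; -_ to -ᶜ_)
open RawMonoidDefs (RawRing.+-rawMonoid ℂ-rawRing) public using () renaming (sum to Σᶜ)
open RawMonoidDefs (RawRing.*-rawMonoid ℂ-rawRing) public using () renaming (sum to Πᶜ)
open RawSemiringDefs (RawRing.rawSemiring ℂ-rawRing) public using () renaming (_^_ to _^ᶜ_)

conj : ℂ → ℂ
conj z = re z +i (-ᴿ im z)

-- The modulus is the square root of re² + im², so it is 1 iff re² + im² is.
HasModulusOne : ℂ → Set
HasModulusOne z = re z *ᴿ re z +ᴿ im z *ᴿ im z ≃ fromℚ 1ℚ

------------------------------------------------------------------------
-- Rank

Matrix : Set → Set → Set
Matrix I J = I → J → ℂ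

LinearlyIndependent : {J : Set} {s : ℕ} → (Fin s → J → ℂ) → Set
LinearlyIndependent {s = s} v =
  ∀ (c : Fin s → ℂ) → (∀ j → Σᶜ (λ k → c k *ᶜ v k j) ≈ 0#) → ∀ k → c k ≈ 0#

-- The rank is the largest size of a linearly independent family of rows;
-- such a family necessarily selects distinct rows.  It is a relation because
-- equality of complex numbers is undecidable, so no function can compute it.
IsRank : {I J : Set} → Matrix I J → ℕ → Set
IsRank {I} A r =
    (∃ λ (f : Fin r → I) → LinearlyIndependent (A ∘ f))
  × (∀ {s} (f : Fin s → I) → LinearlyIndependent (A ∘ f) → s ℕ.≤ r)

------------------------------------------------------------------------
-- Systems of representatives of an equivalence relation with finitely many
-- classes

record Transversal {A : Set} (_∼_ : Rel A 0ℓ) : Set where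
  field
    size     : ℕ
    rep      : Fin size → A
    covers   : ∀ a → ∃[ i ] (a ∼ rep i)
    distinct : ∀ {i j} → rep i ∼ rep j → i ≡ j

private
  module _ {A : Set} {_∼_ : Rel A 0ℓ} (isDE : IsDecEquivalence _∼_) where
    open IsDecEquivalence isDE renaming (_≟_ to _∼?_; refl to ∼-refl; sym to ∼-sym; trans to ∼-trans)

    DS : DecSetoid 0ℓ 0ℓ
    DS = record { isDecEquivalence = isDE }

    lookup-distinct : ∀ {xs} → AllPairs (λ x y → ¬ (x ∼ y)) xs →
      ∀ i j → List.lookup xs i ∼ List.lookup xs j → i ≡ j
    lookup-distinct (px ∷ _) Fin.zero Fin.zero _ = refl
    lookup-distinct (px ∷ _) Fin.zero (Fin.suc j) e =
      contradiction e (All.lookup px (∈ˡ.∈-lookup j))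
    lookup-distinct (px ∷ _) (Fin.suc i) Fin.zero e =
      contradiction (∼-sym e) (All.lookup px (∈ˡ.∈-lookup i))
    lookup-distinct (_ ∷ pxs) (Fin.suc i) (Fin.suc j) e =
      cong Fin.suc (lookup-distinct pxs i j e)

    transversal : (xs : List A) → (∀ a → Any (a ∼_) xs) → Transversal _∼_
    transversal xs complete = record
      { size     = length ys
      ; rep      = List.lookup ys
      ; covers   = λ a → Any.index (ys∋ a) , Any.lookup-index (ys∋ a)
      ; distinct = lookup-distinct (Unique.deduplicate-! DS xs) _ _
      }
      where
      ys = deduplicate _∼?_ xs
      ys∋ : ∀ a → Any (a ∼_) ys
      ys∋ a = ∈ˢ.∈-deduplicate⁺ (DecSetoid.setoid DS) _∼?_
        (λ y∼x z∼x → ∼-trans z∼x (∼-sym y∼x)) (complete a)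

------------------------------------------------------------------------
-- Simple graphs

record Graph (V : Set) : Set₁ where
  infix 4 _~_ _~?_
  field
    _~_    : Rel V 0ℓ
    _~?_   : Decidable _~_
    symm   : Symmetric _~_
    irrefl : ∀ {v} → ¬ (v ~ v)

adjacencyMatrix : ∀ {V} → Graph V → Matrix V V
adjacencyMatrix G u v = if does (u ~? v) then 1# else 0#
  where open Graph G

-- The subgraph induced on W, when f is an inclusion W ↪ V.
induced : ∀ {V W} → Graph V → (W → V) → Graph W
induced G f = record
  { _~_    = λ u v → f u ~ f v
  ; _~?_   = λ u v → f u ~? f v
  ; symm   = symm
  ; irrefl = irrefl
  }
  where open Graph G

edgeCount : ∀ {n} → Graph (Fin n) → ℕ
edgeCount {n} G =
  length (filter (λ e → (proj₁ e Fin.<? proj₂ e) ×-dec (proj₁ e ~? proj₂ e))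
                 (cartesianProduct (allFin n) (allFin n)))
  where open Graph G

Connected : ∀ {V} → Graph V → Rel V 0ℓ
Connected G = Star (Graph._~_ G)

private
  module _ {n : ℕ} (G : Graph (Fin n)) where
    open Graph G

    -- There is a walk from u to v all of whose inner vertices are below k.
    Via : ℕ → Rel (Fin n) 0ℓ
    Via zero    u v = (u ≡ v) ⊎ (u ~ v)
    Via (suc k) u v = Via k u v ⊎ (∃[ w ] (toℕ w ≡ k × Via k u w × Via k w v))

    via? : ∀ k → Decidable (Via k)
    via? zero    u v = (u Fin.≟ v) ⊎-dec (u ~? v)
    via? (suc k) u v = via? k u v ⊎-dec
      Fin.any? (λ w → (toℕ w ℕ.≟ k) ×-dec via? k u w ×-dec via? k w v)

    sound : ∀ k {u v} → Via k u v → Connected G u v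
    sound zero    (inj₁ refl)              = ε
    sound zero    (inj₂ e)                 = e ◅ ε
    sound (suc k) (inj₁ p)                 = sound k p
    sound (suc k) (inj₂ (_ , _ , p , q))   = sound k p ◅◅ sound k q

    through : ∀ k {u i v} → toℕ i ℕ.< k → Via k u i → Via k i v → Via k u v
    through (suc k) {i = i} i<1+k p q with ℕ.m<1+n⇒m<n∨m≡n i<1+k
    through (suc k) _ (inj₁ p) (inj₁ q) | inj₁ i<k = inj₁ (through k i<k p q)
    through (suc k) _ (inj₂ (w , e , p , p′)) (inj₁ q) | inj₁ i<k =
      inj₂ (w , e , p , through k i<k p′ q)
    through (suc k) _ (inj₁ p) (inj₂ (w , e , q , q′)) | inj₁ i<k =
      inj₂ (w , e , through k i<k p q , q′)
    through (suc k) _ (inj₁ p) (inj₁ q) | inj₂ i≡k = inj₂ (_ , i≡k , p , q)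
    through (suc k) _ (inj₂ (w , e , p , _)) (inj₁ q) | inj₂ i≡k
      with refl ← Fin.toℕ-injective (trans i≡k (sym e)) = inj₂ (w , e , p , q)
    through (suc k) _ (inj₁ p) (inj₂ (w , e , _ , q)) | inj₂ i≡k
      with refl ← Fin.toℕ-injective (trans i≡k (sym e)) = inj₂ (w , e , p , q)
    through (suc k) _ (inj₂ (w , e , p , _)) (inj₂ (w′ , e′ , _ , q)) | _
      with refl ← Fin.toℕ-injective (trans e (sym e′)) = inj₂ (w , e , p , q)

    via-edge : ∀ k {u v} → Via 0 u v → Via k u v
    via-edge zero    p = p
    via-edge (suc k) p = inj₁ (via-edge k p)

    complete : ∀ {u v} → Connected G u v → Via n u v
    complete ε       = via-edge n (inj₁ refl)
    complete (e ◅ s) = through n (Fin.toℕ<n _) (via-edge n (inj₂ e)) (complete s)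

    connected-isDE : IsDecEquivalence (Connected G)
    connected-isDE = record
      { isEquivalence = record { refl = ε ; sym = Star.reverse symm ; trans = _◅◅_ }
      ; _≟_ = λ u v → map′ (sound n) complete (via? n u v)
      }

components : ∀ {n} (G : Graph (Fin n)) → Transversal (Connected G)
components {n} G = transversal (connected-isDE G) (allFin n)
  (λ a → Any.map (λ { refl → ε }) (∈ˡ.∈-allFin a))

componentCount : ∀ {n} → Graph (Fin n) → ℕ
componentCount G = Transversal.size (components G)

θ : ∀ {n} → Graph (Fin n) → ℤ
θ {n} G = ℤ.+ edgeCount G ℤ.- ℤ.+ n ℤ.+ ℤ.+ componentCount G

------------------------------------------------------------------------
-- Cycles

-- i ↦ i + 1 modulo p
next : ∀ {p} → Fin p → Fin p
next {suc p} i = suc (toℕ i) mod suc p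

-- A cycle together with a starting vertex and a direction.
record Cycle {V : Set} (G : Graph V) : Set where
  open Graph G
  field
    order     : ℕ
    order≥3   : 3 ℕ.≤ order
    at        : Fin order → V
    injective : Injective _≡_ _≡_ at
    adjacent  : ∀ i → at i ~ at (next i)

open Cycle public using (order; at)

module _ {V : Set} {G : Graph V} where
  infix 4 _∈_

  _∈_ : V → Cycle G → Set
  v ∈ O = ∃[ i ] (at O i ≡ v)

  EdgeOf : Cycle G → Rel V 0ℓ
  EdgeOf O u v = ∃[ i ] ((at O i ≡ u × at O (next i) ≡ v) ⊎ (at O i ≡ v × at O (next i) ≡ u))

  -- Equality of cycles as subgraphs: a cycle is determined by its edges.
  SameCycle : Rel (Cycle G) 0ℓ
  SameCycle O O′ = ∀ u v → EdgeOf O u v ⇔ EdgeOf O′ u v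

  Disjoint : Rel (Cycle G) 0ℓ
  Disjoint O O′ = ∀ v → ¬ (v ∈ O × v ∈ O′)

private
  module _ {n : ℕ} (G : Graph (Fin n)) where
    open Graph G

    edgeOf? : (O : Cycle G) → Decidable (EdgeOf O)
    edgeOf? O u v = Fin.any? λ i →
      ((at O i Fin.≟ u) ×-dec (at O (next i) Fin.≟ v)) ⊎-dec
      ((at O i Fin.≟ v) ×-dec (at O (next i) Fin.≟ u))

    sameCycle? : Decidable (SameCycle {G = G})
    sameCycle? O O′ = Fin.all? λ u → Fin.all? λ v →
      map′ (λ { (f , g) → mk⇔ f g }) (λ e → Equivalence.to e , Equivalence.from e)
        ((edgeOf? O u v →-dec edgeOf? O′ u v) ×-dec (edgeOf? O′ u v →-dec edgeOf? O u v))

    sameCycle-isDE : IsDecEquivalence (SameCycle {G = G})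
    sameCycle-isDE = record
      { isEquivalence = record
        { refl  = λ _ _ → mk⇔ (λ e → e) (λ e → e)
        ; sym   = λ h u v → mk⇔ (Equivalence.from (h u v)) (Equivalence.to (h u v))
        ; trans = λ h k u v → mk⇔ (Equivalence.to (k u v) ∘ Equivalence.to (h u v))
                                  (Equivalence.from (h u v) ∘ Equivalence.from (k u v))
        }
      ; _≟_ = sameCycle?
      }

    IsCycle : ∀ p → (Fin p → Fin n) → Set
    IsCycle p f = 3 ℕ.≤ p × (∀ i j → f i ≡ f j → i ≡ j) × (∀ i → f i ~ f (next i))

    isCycle? : ∀ p f → Dec (IsCycle p f)
    isCycle? p f = (3 ℕ.≤? p)
      ×-dec Fin.all? (λ i → Fin.all? λ j → (f i Fin.≟ f j) →-dec (i Fin.≟ j))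
      ×-dec Fin.all? (λ i → f i ~? f (next i))

    cycleOn : ∀ p (f : Fin p → Fin n) → List (Cycle G)
    cycleOn p f with isCycle? p f
    ... | no _ = []
    ... | yes (p≥3 , inj , adj) = record
      { order = p ; order≥3 = p≥3 ; at = f ; injective = inj _ _ ; adjacent = adj } ∷ []

    vectors : ∀ p → List (Vec (Fin n) p)
    vectors zero    = [] ∷ []
    vectors (suc p) = List.cartesianProductWith _∷_ (allFin n) (vectors p)

    ∈-vectors : ∀ {p} (v : Vec (Fin n) p) → v ∈ˡ vectors p
    ∈-vectors []      = here refl
    ∈-vectors (x ∷ v) = ∈ˡ.∈-cartesianProductWith⁺ _∷_ (∈ˡ.∈-allFin x) (∈-vectors v)

    cyclesOfOrder : ℕ → List (Cycle G)
    cyclesOfOrder p = List.concatMap (cycleOn p ∘ Vec.lookup) (vectors p)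

    allCycles : List (Cycle G)
    allCycles = List.concatMap cyclesOfOrder (List.upTo (suc n))

    ∈-cycleOn : ∀ (O : Cycle G) f → (∀ i → f i ≡ at O i) →
      Any (SameCycle O) (cycleOn (order O) f)
    ∈-cycleOn O f f≗ with isCycle? (order O) f
    ... | no ¬c = contradiction
      ( Cycle.order≥3 O
      , (λ i j e → Cycle.injective O (trans (sym (f≗ i)) (trans e (f≗ j))))
      , (λ i → subst₂ _~_ (sym (f≗ i)) (sym (f≗ (next i))) (Cycle.adjacent O i)) ) ¬c
    ... | yes _ = here λ u v → mk⇔
      (λ { (i , inj₁ (a , b)) → i , inj₁ (trans (f≗ i) a , trans (f≗ (next i)) b)
         ; (i , inj₂ (a , b)) → i , inj₂ (trans (f≗ i) a , trans (f≗ (next i)) b) })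
      (λ { (i , inj₁ (a , b)) → i , inj₁ (trans (sym (f≗ i)) a , trans (sym (f≗ (next i))) b)
         ; (i , inj₂ (a , b)) → i , inj₂ (trans (sym (f≗ i)) a , trans (sym (f≗ (next i))) b) })

    ∈-allCycles : ∀ O → Any (SameCycle O) allCycles
    ∈-allCycles O =
      Any.concatMap⁺ cyclesOfOrder (Any.map
        (λ { refl → Any.concatMap⁺ (cycleOn (order O) ∘ Vec.lookup) (Any.map
          (λ { refl → ∈-cycleOn O _ (Vec.lookup∘tabulate (at O)) })
          (∈-vectors (Vec.tabulate (at O)))) })
        (∈ˡ.∈-upTo⁺ (ℕ.s≤s (Fin.injective⇒≤ (Cycle.injective O)))))

cycles : ∀ {n} (G : Graph (Fin n)) → Transversal (SameCycle {G = G})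
cycles G = transversal (sameCycle-isDE G) (allCycles G) (∈-allCycles G)

module _ {n : ℕ} (G : Graph (Fin n)) where
  cycleCount : ℕ
  cycleCount = Transversal.size (cycles G)

  cycle : Fin cycleCount → Cycle G
  cycle = Transversal.rep (cycles G)

open RawMonoidDefs ℕ.+-0-rawMonoid using () renaming (sum to Σℕ)

sumOfCycleOrders : ∀ {n} → Graph (Fin n) → ℕ
sumOfCycleOrders G = Σℕ (λ k → order (cycle G k))

------------------------------------------------------------------------
-- The contraction T_G and its subgraph Γ_G (acyclicPart).  Both are defined
-- for every G, but only meaningful when the cycles of G are pairwise disjoint.

-- The irrelevant field makes elements with the same vertex equal.
record AcyclicVertex {n : ℕ} (G : Graph (Fin n)) : Set where
  constructor ⟨_⟩
  field
    vertex      : Fin n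
    .onNoCycle  : ∀ (O : Cycle G) → ¬ (vertex ∈ O)

open AcyclicVertex public using (vertex)

contraction : ∀ {n} (G : Graph (Fin n)) → Graph (AcyclicVertex G ⊎ Fin (cycleCount G))
contraction {n} G = record
  { _~_ = _~ᵀ_ ; _~?_ = _~ᵀ?_ ; symm = λ {x} {y} → symmᵀ x y ; irrefl = λ {x} → irreflᵀ x }
  where
  open Graph G
  TV = AcyclicVertex G ⊎ Fin (cycleCount G)

  infix 4 _~ᵀ_ _~ᵀ?_
  _~ᵀ_ : Rel TV 0ℓ
  inj₁ u ~ᵀ inj₁ v = vertex u ~ vertex v
  inj₁ u ~ᵀ inj₂ k = ∃[ i ] (vertex u ~ at (cycle G k) i)
  inj₂ k ~ᵀ inj₁ u = ∃[ i ] (vertex u ~ at (cycle G k) i)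
  inj₂ k ~ᵀ inj₂ l = k ≢ l × (∃[ i ] ∃[ j ] (at (cycle G k) i ~ at (cycle G l) j))

  _~ᵀ?_ : Decidable _~ᵀ_
  inj₁ u ~ᵀ? inj₁ v = vertex u ~? vertex v
  inj₁ u ~ᵀ? inj₂ k = Fin.any? λ i → vertex u ~? at (cycle G k) i
  inj₂ k ~ᵀ? inj₁ u = Fin.any? λ i → vertex u ~? at (cycle G k) i
  inj₂ k ~ᵀ? inj₂ l = ¬? (k Fin.≟ l) ×-dec
    Fin.any? λ i → Fin.any? λ j → at (cycle G k) i ~? at (cycle G l) j

  symmᵀ : ∀ x y → x ~ᵀ y → y ~ᵀ x
  symmᵀ (inj₁ _) (inj₁ _) e                 = symm e
  symmᵀ (inj₁ _) (inj₂ _) e                 = e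
  symmᵀ (inj₂ _) (inj₁ _) e                 = e
  symmᵀ (inj₂ _) (inj₂ _) (k≢l , i , j , e) = k≢l ∘ sym , j , i , symm e

  irreflᵀ : ∀ x → ¬ (x ~ᵀ x)
  irreflᵀ (inj₁ _) e         = irrefl e
  irreflᵀ (inj₂ _) (k≢k , _) = k≢k refl

acyclicPart : ∀ {n} (G : Graph (Fin n)) → Graph (AcyclicVertex G)
acyclicPart G = induced (contraction G) inj₁

------------------------------------------------------------------------
-- Complex unit gain graphs

-- Only the values of gain on adjacent pairs matter.
record GainGraph (n : ℕ) : Set₁ where
  field
    graph : Graph (Fin n)
  open Graph graph public
  field
    gain      : Fin n → Fin n → ℂ
    gain-unit : ∀ {i j} → i ~ j → HasModulusOne (gain i j)
    gain-conj : ∀ {i j} → i ~ j → gain j i ≈ conj (gain i j)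

open GainGraph public using (graph; gain)

gainMatrix : ∀ {n} → GainGraph n → Matrix (Fin n) (Fin n)
gainMatrix Φ i j = if does (i ~? j) then gain Φ i j else 0#
  where open GainGraph Φ using (_~?_)

cycleGain : ∀ {n} (Φ : GainGraph n) → Cycle (graph Φ) → ℂ
cycleGain Φ O = Πᶜ (λ i → gain Φ (at O i) (at O (next i)))

IsTypeA : ∀ {n} (Φ : GainGraph n) → Cycle (graph Φ) → Set
IsTypeA Φ O = 2 ∣ order O × cycleGain Φ O ≈ (-ᶜ 1#) ^ᶜ (order O /ℕ 2)

{-# OPTIONS --safe #-}
module Submission where

-- Equality of complex numbers and of naturals is ¬¬-stable, so the whole proof is classical
-- reasoning in the double negation monad.
--
-- Deleting a vertex lowers r(G) by at most 2 and does not raise r(Φ), and forests have the same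
-- rank for all gains.  Hence r(G) − r(Φ) ≤ 2|X| for every set X of vertices meeting all cycles.
-- A spanning forest leaves θ(G) edges, one end of each of which gives such a set, so the
-- hypothesis says that no smaller set meets all cycles.  If two edges at a vertex u could be
-- deleted together without changing connectivity, then u and ends of the θ(G) − 2 remaining
-- superfluous edges would do; so G is "tight", which makes its cycles chordless and disjoint and
-- its contraction a forest.
--
-- Call a vertex set S extremal if its rank gap is 2d and d vertices meet all cycles in S.  This is
-- inherited when a pendant vertex is deleted with its neighbour, and when a vertex of a cycle is
-- deleted, in which case r(G) drops by 2 and r(Φ) is unchanged.  For (b), such deletions isolate
-- a given cycle O.  There r(G) = |O| excludes odd orders and multiples of 4 (which have the null
-- vector 1, 0, −1, 0, …), and r(Φ) being unchanged gives a null vector of Φ, nonzero at a chosen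
-- vertex, whose two-step recursion around O yields the gain.
--
-- For (c), induct on S, taking a leaf of the contraction.  A leaf vertex is deleted with its
-- neighbour, which lies on no cycle.  If the leaf is a cycle O, let K = S ∖ O; eliminating the path
-- O − v shows that K is extremal and r(G) drops by |O|.  If O has an exit to z, deleting instead a
-- neighbour of v on O shows that z lies on no cycle and r(K) = r(K − z) + 2; the induction
-- hypothesis for K and K − z then shows that adding t_O, pendant at z, does not raise r(T).

open import Defs
open import Level using (0ℓ)
open import Algebra.Bundles using (CommutativeRing)
import Algebra.Definitions.RawMonoid
import Algebra.Properties.Ring
import Algebra.Properties.Semiring.Sum
open import Data.Bool.Base using (if_then_else_)
open import Data.Empty using (⊥; ⊥-elim-irr)
open import Data.Fin.Base as Fin using (Fin; toℕ; punchIn; punchOut)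
open import Data.Fin.Permutation using (Permutation′; permutation)
import Data.Fin.Properties as Fin
open import Data.Fin.Subset using (Subset; ⁅_⁆; ⊤; inside; outside)
  renaming (_∈_ to _∈ˢ_; _-_ to _−_; ∣_∣ to size)
import Data.Fin.Subset.Properties as Subset
import Data.Integer.Base as ℤ
import Data.Integer.Properties as ℤ
open import Data.Integer.Solver using () renaming (module +-*-Solver to ℤ-Solver)
open import Data.List.Base as List
  using (List; []; _∷_; length; lookup; filter; allFin; cartesianProduct)
open import Data.List.Membership.Propositional using () renaming (_∈_ to _∈ˡ_; _∉_ to _∉ˡ_)
import Data.List.Membership.Propositional.Properties as ∈ˡ
import Data.List.Properties as List
open import Data.List.Relation.Unary.All as All using (All; []; _∷_)
import Data.List.Relation.Unary.All.Properties as All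
open import Data.List.Relation.Unary.AllPairs using (AllPairs; []; _∷_)
open import Data.List.Relation.Unary.Any as Any using (Any; here; there)
open import Data.List.Relation.Unary.Linked using (Linked; []; [-]; _∷_)
open import Data.Nat.Base as ℕ using (ℕ; zero; suc; _+_; _≤_; _<_; z≤n; s≤s)
open import Data.Nat.DivMod using (_%_; _/_; m%n<n; m<n⇒m%n≡m; n%n≡0; [m+n]%n≡m%n; [m+kn]%n≡m%n;
  m≡m%n+[m/n]*n; m≤n⇒[n∸m]%m≡n%m; m*n/n≡m)
open import Data.Nat.Divisibility using (_∣_; divides; _∣?_)
import Data.Nat.Properties as ℕ
open import Data.Product.Base using (∃; ∃-syntax; _×_; _,_; proj₁; proj₂)
open import Data.Rational.Base as ℚ using (ℚ; 0ℚ; 1ℚ; Positive; positive; nonNegative; 1/_)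
import Data.Rational.Properties as ℚ
open import Data.Rational.Solver using (module +-*-Solver)
open import Data.Sum.Base using (_⊎_; inj₁; inj₂; [_,_]′; swap)
open import Data.Unit.Base using (tt) renaming (⊤ to Unit)
open import Data.Vec.Base as Vec using ([]; _∷_)
open import Data.Vec.Functional using (insertAt)
open import Data.Vec.Functional.Properties using (insertAt-lookup; insertAt-punchIn)
open import Function.Base using (_∘_; case_of_; id)
open import Function.Bundles using (mk⇔; Equivalence)
open import Relation.Binary.Construct.Closure.ReflexiveTransitive as Star using (Star; ε; _◅_; _◅◅_)
open import Relation.Binary.Core using (Rel)
open import Relation.Binary.Definitions using (Symmetric; tri<; tri≈; tri>)
open import Relation.Binary.PropositionalEquality
  using (_≡_; _≢_; refl; sym; trans; cong; cong₂; subst; subst₂; module ≡-Reasoning)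
import Relation.Binary.Reasoning.Setoid
open import Relation.Binary.Structures using (IsEquivalence)
open import Relation.Nullary using (¬_; Dec; yes; no; does; contradiction)
open import Relation.Nullary.Decidable
  using (_×-dec_; _⊎-dec_; ¬?; decidable-stable; dec-true; dec-false; ¬¬-excluded-middle)

-- Null sequences

open ℝ

-- A gap of 2d against d hitting vertices leaves no slack: every inequality that bounds it must be
-- an equality. This is why a deleted cycle vertex has an exact effect on both ranks. The rank of Φ
-- staying put means that the deleted row depends on the others, and this dependency carries the
-- gain. For (c) the delicate case is an even cycle O with one exit from v to z. Deleting v leaves
-- an odd path: its vertices pair off except for one isolated vertex, and K remains. Deleting a
-- neighbour of v leaves an odd path ending in v: now v survives the pairing, pendant at z, and
-- takes z along, so K - z remains. Both deletions have the same effect on the rank, whence r(K) =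
-- r(K - z) + 2. The obstacle throughout is that nonzero numbers cannot be recognised, nor ranks
-- computed. Elimination therefore avoids division, and ranks are relations whose existence is only
-- doubly negated. Vertices of T_G and Γ_G are labelled by vertices of G, so that one vertex set S
-- cuts out submatrices of all four matrices.

Null : (ℕ → ℚ) → Set
Null z = ∀ δ → 0ℚ ℚ.< δ → ∃[ N ] ∀ n → N ℕ.≤ n → ℚ.∣ z n ∣ ℚ.≤ δ

private
  module _ where
    open +-*-Solver

    telescope : ∀ a b c → (a ℚ.- b) ℚ.+ (b ℚ.- c) ≡ a ℚ.- c
    telescope = solve 3 (λ a b c → (a :- b) :+ (b :- c) := a :- c) refl

    cancel : ∀ a b → (a ℚ.- b) ℚ.+ b ≡ a
    cancel = solve 2 (λ a b → (a :- b) :+ b := a) refl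

    cancelʳ : ∀ a b → b ℚ.+ (a ℚ.- b) ≡ a
    cancelʳ = solve 2 (λ a b → b :+ (a :- b) := a) refl

    regroup-+ : ∀ a b c d → (a ℚ.- b) ℚ.+ (c ℚ.- d) ≡ (a ℚ.+ c) ℚ.- (b ℚ.+ d)
    regroup-+ = solve 4 (λ a b c d → (a :- b) :+ (c :- d) := (a :+ c) :- (b :+ d)) refl

    regroup-* : ∀ a b c d → a ℚ.* (c ℚ.- d) ℚ.+ d ℚ.* (a ℚ.- b) ≡ a ℚ.* c ℚ.- b ℚ.* d
    regroup-* = solve 4 (λ a b c d → a :* (c :- d) :+ d :* (a :- b) := a :* c :- b :* d) refl

    regroup-neg : ∀ a b → ℚ.- (a ℚ.- b) ≡ (ℚ.- a) ℚ.- (ℚ.- b)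
    regroup-neg = solve 2 (λ a b → :- (a :- b) := (:- a) :- (:- b)) refl

    minus-0 : ∀ a → a ℚ.- 0ℚ ≡ a
    minus-0 = solve 1 (λ a → a :- con 0ℚ := a) refl

  0<1 : 0ℚ ℚ.< 1ℚ
  0<1 = ℚ.positive⁻¹ 1ℚ

  divide : ∀ {δ} B → 0ℚ ℚ.< B → 0ℚ ℚ.< δ → ∃[ η ] (0ℚ ℚ.< η × B ℚ.* η ≡ δ)
  divide {δ} B 0<B 0<δ = B⁻¹ ℚ.* δ
    , subst (ℚ._< B⁻¹ ℚ.* δ) (ℚ.*-zeroʳ B⁻¹) (ℚ.*-monoʳ-<-pos B⁻¹ {{B⁻¹>0}} 0<δ)
    , trans (sym (ℚ.*-assoc B B⁻¹ δ))
        (trans (cong (ℚ._* δ) (ℚ.*-inverseʳ B {{nz}})) (ℚ.*-identityˡ δ))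
    where
    instance
      B>0 : Positive B
      B>0 = positive 0<B
    nz = ℚ.pos⇒nonZero B
    B⁻¹ = (1/ B) {{nz}}
    B⁻¹>0 : Positive B⁻¹
    B⁻¹>0 = ℚ.1/pos⇒pos B

  abstract
    half : ∀ {δ} → 0ℚ ℚ.< δ → ∃[ η ] (0ℚ ℚ.< η × η ℚ.+ η ≡ δ)
    half {δ} 0<δ with divide (1ℚ ℚ.+ 1ℚ) (ℚ.+-mono-< 0<1 0<1) 0<δ
    ... | η , 0<η , 2η≡δ = η , 0<η ,
      trans (sym (trans (ℚ.*-distribʳ-+ η 1ℚ 1ℚ) (cong₂ ℚ._+_ (ℚ.*-identityˡ η) (ℚ.*-identityˡ η)))) 2η≡δ

  product-≤ : ∀ a c {B D} → 0ℚ ℚ.≤ B → ℚ.∣ a ∣ ℚ.≤ B → ℚ.∣ c ∣ ℚ.≤ D →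
    ℚ.∣ a ℚ.* c ∣ ℚ.≤ B ℚ.* D
  product-≤ a c {B} {D} 0≤B p q = subst (ℚ._≤ B ℚ.* D) (sym (ℚ.∣p*q∣≡∣p∣*∣q∣ a c))
    (ℚ.≤-trans
      (ℚ.*-monoʳ-≤-nonNeg ℚ.∣ c ∣ {{nonNegative (ℚ.0≤∣p∣ c)}} p)
      (ℚ.*-monoˡ-≤-nonNeg B {{nonNegative 0≤B}} q))

  <⇒≱ᵠ : ∀ {a b} → a ℚ.< b → ¬ (b ℚ.≤ a)
  <⇒≱ᵠ a<b b≤a = ℚ.<-irrefl refl (ℚ.<-≤-trans a<b b≤a)

  0<* : ∀ {a b} → 0ℚ ℚ.< a → 0ℚ ℚ.< b → 0ℚ ℚ.< a ℚ.* b
  0<* {a} {b} 0<a 0<b = subst (ℚ._< a ℚ.* b) (ℚ.*-zeroʳ a) (ℚ.*-monoʳ-<-pos a {{positive 0<a}} 0<b)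

null-resp : ∀ {x y} → (∀ n → x n ≡ y n) → Null x → Null y
null-resp e h δ 0<δ with h δ 0<δ
... | N , f = N , λ n p → subst (λ q → ℚ.∣ q ∣ ℚ.≤ δ) (e n) (f n p)

null-0 : Null (λ _ → 0ℚ)
null-0 δ 0<δ = 0 , λ _ _ → ℚ.<⇒≤ 0<δ

null-+ : ∀ {x y} → Null x → Null y → Null (λ n → x n ℚ.+ y n)
null-+ {x} {y} hx hy δ 0<δ =
  let η , 0<η , 2η≡δ = half 0<δ
      M , f = hx η 0<η
      N , g = hy η 0<η
  in M ℕ.⊔ N , λ n p → subst (ℚ.∣ x n ℚ.+ y n ∣ ℚ.≤_) 2η≡δ
       (ℚ.≤-trans (ℚ.∣p+q∣≤∣p∣+∣q∣ (x n) (y n))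
         (ℚ.+-mono-≤ (f n (ℕ.m⊔n≤o⇒m≤o M N p)) (g n (ℕ.m⊔n≤o⇒n≤o M N p))))

null-neg : ∀ {x} → Null x → Null (λ n → ℚ.- x n)
null-neg {x} h δ 0<δ with h δ 0<δ
... | N , f = N , λ n p → subst (ℚ._≤ δ) (sym (ℚ.∣-p∣≡∣p∣ (x n))) (f n p)

bounded : ∀ x → IsCauchy x → ∃[ B ] ∃[ N ] (0ℚ ℚ.< B × (∀ n → N ℕ.≤ n → ℚ.∣ x n ∣ ℚ.≤ B))
bounded x cx with cx 1ℚ 0<1
... | N , hN = 1ℚ ℚ.+ ℚ.∣ x N ∣ , N , ℚ.+-mono-<-≤ 0<1 (ℚ.0≤∣p∣ (x N))
  , λ n p → subst (λ q → ℚ.∣ q ∣ ℚ.≤ 1ℚ ℚ.+ ℚ.∣ x N ∣) (cancel (x n) (x N))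
      (ℚ.≤-trans (ℚ.∣p+q∣≤∣p∣+∣q∣ (x n ℚ.- x N) (x N)) (ℚ.+-monoˡ-≤ ℚ.∣ x N ∣ (hN n N p ℕ.≤-refl)))

null-* : ∀ x {y} → IsCauchy x → Null y → Null (λ n → x n ℚ.* y n)
null-* x {y} cx hy δ 0<δ =
  let B , M , 0<B , f = bounded x cx
      η , 0<η , Bη≡δ = divide B 0<B 0<δ
      N , g = hy η 0<η
  in M ℕ.⊔ N , λ n p → subst (ℚ.∣ x n ℚ.* y n ∣ ℚ.≤_) Bη≡δ
       (product-≤ (x n) (y n) (ℚ.<⇒≤ 0<B) (f n (ℕ.m⊔n≤o⇒m≤o M N p)) (g n (ℕ.m⊔n≤o⇒n≤o M N p)))

abstract
  -- A single approximation decides between the two alternatives.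
  small-or-apart : ∀ z → IsCauchy z → ∀ δ → 0ℚ ℚ.< δ →
    (∃[ N ] ∀ n → N ℕ.≤ n → ℚ.∣ z n ∣ ℚ.≤ δ) ⊎
    (∃[ η ] ∃[ N ] (0ℚ ℚ.< η × (∀ n → N ℕ.≤ n → η ℚ.≤ ℚ.∣ z n ∣)))
  small-or-apart z cz δ 0<δ with half 0<δ
  ... | η , 0<η , 2η≡δ with half 0<η
  ... | ζ , 0<ζ , 2ζ≡η with cz ζ 0<ζ
  ... | N , hN with ℚ.∣ z N ∣ ℚ.≤? η
  ... | yes z≤η = inj₁ (N , λ n p → subst₂ (λ a b → ℚ.∣ a ∣ ℚ.≤ b) (cancel (z n) (z N)) 2η≡δ
          (ℚ.≤-trans (ℚ.∣p+q∣≤∣p∣+∣q∣ (z n ℚ.- z N) (z N))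
            (ℚ.+-mono-≤ (ℚ.≤-trans (hN n N p ℕ.≤-refl) ζ≤η) z≤η)))
    where
    ζ≤η : ζ ℚ.≤ η
    ζ≤η = subst₂ ℚ._≤_ (ℚ.+-identityˡ ζ) 2ζ≡η (ℚ.+-monoˡ-≤ ζ (ℚ.<⇒≤ 0<ζ))
  ... | no z≰η = inj₂ (ζ , N , 0<ζ , λ n p → ℚ.≮⇒≥ λ zn<ζ →
          contradiction (subst₂ (λ a b → ℚ.∣ a ∣ ℚ.≤ b) (cancelʳ (z N) (z n)) 2ζ≡η
            (ℚ.≤-trans (ℚ.∣p+q∣≤∣p∣+∣q∣ (z n) (z N ℚ.- z n))
              (ℚ.+-mono-≤ (ℚ.<⇒≤ zn<ζ) (hN N n ℕ.≤-refl p)))) z≰η)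

-- At each δ the sequence is either eventually below δ, as wanted, or eventually bounded away from
-- 0, which refutes nullity.
null-stable : ∀ z → IsCauchy z → ¬ ¬ Null z → Null z
null-stable z cz ¬¬h δ 0<δ with small-or-apart z cz δ 0<δ
... | inj₁ p = p
... | inj₂ (η , N , 0<η , far) = contradiction ¬null ¬¬h
  where
  ¬null : ¬ Null z
  ¬null h with half 0<η
  ... | ζ , 0<ζ , 2ζ≡η with h ζ 0<ζ
  ... | M , f = <⇒≱ᵠ (subst₂ ℚ._<_ (ℚ.+-identityˡ ζ) 2ζ≡η (ℚ.+-monoˡ-< ζ 0<ζ))
    (ℚ.≤-trans (far (N ℕ.⊔ M) (ℕ.m≤m⊔n N M)) (f (N ℕ.⊔ M) (ℕ.m≤n⊔m N M)))

-- If `y` is bounded away from 0 by some η instead of small, then |x| η ≤ |x y| eventually, which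
-- would make `x` null.
null-domain : ∀ x y → IsCauchy y → Null (λ n → x n ℚ.* y n) → ¬ Null x → Null y
null-domain x y cy hxy ¬hx δ 0<δ with small-or-apart y cy δ 0<δ
... | inj₁ p = p
... | inj₂ (η , N , 0<η , far) = contradiction hx ¬hx
  where
  hx : Null x
  hx ζ 0<ζ with hxy (ζ ℚ.* η) (0<* 0<ζ 0<η)
  ... | M , f = N ℕ.⊔ M , λ n p → ℚ.≮⇒≥ λ ζ<x →
    <⇒≱ᵠ (ℚ.<-≤-trans (ℚ.*-monoˡ-<-pos η {{positive 0<η}} ζ<x)
            (ℚ.*-monoˡ-≤-nonNeg ℚ.∣ x n ∣ {{nonNegative (ℚ.0≤∣p∣ (x n))}}
              (far n (ℕ.m⊔n≤o⇒m≤o N M p))))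
      (subst (ℚ._≤ ζ ℚ.* η) (ℚ.∣p*q∣≡∣p∣*∣q∣ (x n) (y n)) (f n (ℕ.m⊔n≤o⇒n≤o N M p)))

null-square : ∀ x → Null (λ n → x n ℚ.* x n) → Null x
null-square x h δ 0<δ with h (δ ℚ.* δ) (0<* 0<δ 0<δ)
... | N , f = N , λ n p → ℚ.≮⇒≥ λ δ<x →
  <⇒≱ᵠ (ℚ.<-≤-trans (ℚ.*-monoˡ-<-pos δ {{positive 0<δ}} δ<x)
          (ℚ.*-monoˡ-≤-nonNeg ℚ.∣ x n ∣ {{nonNegative (ℚ.0≤∣p∣ (x n))}} (ℚ.<⇒≤ δ<x)))
    (subst (ℚ._≤ δ ℚ.* δ) (ℚ.∣p*q∣≡∣p∣*∣q∣ (x n) (x n)) (f n p))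

0≤square : ∀ p → 0ℚ ℚ.≤ p ℚ.* p
0≤square p with ℚ.∣p∣≡p∨∣p∣≡-p p
... | inj₁ e = subst (0ℚ ℚ.≤_) (trans (ℚ.∣p*q∣≡∣p∣*∣q∣ p p) (cong₂ ℚ._*_ e e)) (ℚ.0≤∣p∣ (p ℚ.* p))
... | inj₂ e = subst (0ℚ ℚ.≤_) (trans (ℚ.∣p*q∣≡∣p∣*∣q∣ p p) (trans (cong₂ ℚ._*_ e e) neg*neg)) (ℚ.0≤∣p∣ (p ℚ.* p))
  where
  open +-*-Solver
  neg*neg : (ℚ.- p) ℚ.* (ℚ.- p) ≡ p ℚ.* p
  neg*neg = solve 1 (λ p → (:- p) :* (:- p) := p :* p) refl p

null-sum-of-squares : ∀ (x y : ℕ → ℚ) → Null (λ n → x n ℚ.* x n ℚ.+ y n ℚ.* y n) → Null x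
null-sum-of-squares x y h = null-square x λ δ 0<δ → let N , f = h δ 0<δ in N , λ n p →
  ℚ.≤-trans (subst₂ ℚ._≤_
      (trans (ℚ.+-identityʳ (x n ℚ.* x n)) (sym (ℚ.0≤p⇒∣p∣≡p (0≤square (x n)))))
      (sym (ℚ.0≤p⇒∣p∣≡p (ℚ.+-mono-≤ {0ℚ} {x n ℚ.* x n} {0ℚ} {y n ℚ.* y n} (0≤square (x n)) (0≤square (y n)))))
      (ℚ.+-monoʳ-≤ (x n ℚ.* x n) (0≤square (y n))))
    (f n p)

≃⇒null : ∀ {x y} → x ≃ y → Null (λ n → seq x n ℚ.- seq y n)
≃⇒null = _≃_.close

pointwise : ∀ {x y} → (∀ n → seq x n ≡ seq y n) → x ≃ y
pointwise {x} {y} e = mk≃ (null-resp (λ n → sym (trans (cong (ℚ._- seq y n) (e n)) (ℚ.+-inverseʳ (seq y n)))) null-0)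

≃-refl : ∀ {x} → x ≃ x
≃-refl = pointwise (λ _ → refl)

≃-sym : ∀ {x y} → x ≃ y → y ≃ x
≃-sym {x} {y} h = mk≃ (null-resp (λ n → flip (seq x n) (seq y n)) (null-neg (≃⇒null h)))
  where
  open +-*-Solver
  flip : ∀ a b → ℚ.- (a ℚ.- b) ≡ b ℚ.- a
  flip = solve 2 (λ a b → :- (a :- b) := b :- a) refl

≃-trans : ∀ {x y z} → x ≃ y → y ≃ z → x ≃ z
≃-trans {x} {y} {z} h k = mk≃ (null-resp (λ n → telescope (seq x n) (seq y n) (seq z n))
  (null-+ (≃⇒null h) (≃⇒null k)))

+ᴿ-cong : ∀ {x y u v} → x ≃ y → u ≃ v → x +ᴿ u ≃ y +ᴿ v
+ᴿ-cong {x} {y} {u} {v} h k = mk≃ (null-resp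
  (λ n → regroup-+ (seq x n) (seq y n) (seq u n) (seq v n)) (null-+ (≃⇒null h) (≃⇒null k)))

*ᴿ-cong : ∀ {x y u v} → x ≃ y → u ≃ v → x *ᴿ u ≃ y *ᴿ v
*ᴿ-cong {x} {y} {u} {v} h k = mk≃ (null-resp
  (λ n → regroup-* (seq x n) (seq y n) (seq u n) (seq v n))
  (null-+ {λ n → seq x n ℚ.* (seq u n ℚ.- seq v n)} {λ n → seq v n ℚ.* (seq x n ℚ.- seq y n)}
    (null-* (seq x) (cauchy x) (≃⇒null k)) (null-* (seq v) (cauchy v) (≃⇒null h))))

-ᴿ-cong : ∀ {x y} → x ≃ y → -ᴿ x ≃ -ᴿ y
-ᴿ-cong {x} {y} h = mk≃ (null-resp (λ n → regroup-neg (seq x n) (seq y n)) (null-neg (≃⇒null h)))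

≃0⇒null : ∀ {x} → x ≃ fromℚ 0ℚ → Null (seq x)
≃0⇒null h = null-resp (λ n → minus-0 _) (≃⇒null h)

null⇒≃0 : ∀ {x} → Null (seq x) → x ≃ fromℚ 0ℚ
null⇒≃0 h = mk≃ (null-resp (λ n → sym (minus-0 _)) h)

≃-stable : ∀ {x y} → ¬ ¬ (x ≃ y) → x ≃ y
≃-stable {x} {y} h = mk≃ (null-stable (λ n → seq x n ℚ.- seq y n) (cauchy (x -ᴿ y)) (λ ¬p → h (λ e → ¬p (≃⇒null e))))

abstract
  ≈-stable : ∀ {z w} → ¬ ¬ (z ≈ w) → z ≈ w
  ≈-stable h = ≃-stable (λ ¬p → h (¬p ∘ proj₁)) , ≃-stable (λ ¬p → h (¬p ∘ proj₂))

-- The complex numbers as an integral domain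

private
  module _ where
    open +-*-Solver

    *-assoc-re : ∀ a b c d e f →
      (a ℚ.* c ℚ.- b ℚ.* d) ℚ.* e ℚ.- (a ℚ.* d ℚ.+ b ℚ.* c) ℚ.* f
      ≡ a ℚ.* (c ℚ.* e ℚ.- d ℚ.* f) ℚ.- b ℚ.* (c ℚ.* f ℚ.+ d ℚ.* e)
    *-assoc-re = solve 6 (λ a b c d e f →
      (a :* c :- b :* d) :* e :- (a :* d :+ b :* c) :* f
      := a :* (c :* e :- d :* f) :- b :* (c :* f :+ d :* e)) refl

    *-assoc-im : ∀ a b c d e f →
      (a ℚ.* c ℚ.- b ℚ.* d) ℚ.* f ℚ.+ (a ℚ.* d ℚ.+ b ℚ.* c) ℚ.* e
      ≡ a ℚ.* (c ℚ.* f ℚ.+ d ℚ.* e) ℚ.+ b ℚ.* (c ℚ.* e ℚ.- d ℚ.* f)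
    *-assoc-im = solve 6 (λ a b c d e f →
      (a :* c :- b :* d) :* f :+ (a :* d :+ b :* c) :* e
      := a :* (c :* f :+ d :* e) :+ b :* (c :* e :- d :* f)) refl

    *-comm-re : ∀ a b c d → a ℚ.* c ℚ.- b ℚ.* d ≡ c ℚ.* a ℚ.- d ℚ.* b
    *-comm-re = solve 4 (λ a b c d → a :* c :- b :* d := c :* a :- d :* b) refl

    *-comm-im : ∀ a b c d → a ℚ.* d ℚ.+ b ℚ.* c ≡ c ℚ.* b ℚ.+ d ℚ.* a
    *-comm-im = solve 4 (λ a b c d → a :* d :+ b :* c := c :* b :+ d :* a) refl

    distribˡ-re : ∀ a b c d e f → a ℚ.* (c ℚ.+ e) ℚ.- b ℚ.* (d ℚ.+ f)
      ≡ (a ℚ.* c ℚ.- b ℚ.* d) ℚ.+ (a ℚ.* e ℚ.- b ℚ.* f)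
    distribˡ-re = solve 6 (λ a b c d e f → a :* (c :+ e) :- b :* (d :+ f)
      := (a :* c :- b :* d) :+ (a :* e :- b :* f)) refl

    distribˡ-im : ∀ a b c d e f → a ℚ.* (d ℚ.+ f) ℚ.+ b ℚ.* (c ℚ.+ e)
      ≡ (a ℚ.* d ℚ.+ b ℚ.* c) ℚ.+ (a ℚ.* f ℚ.+ b ℚ.* e)
    distribˡ-im = solve 6 (λ a b c d e f → a :* (d :+ f) :+ b :* (c :+ e)
      := (a :* d :+ b :* c) :+ (a :* f :+ b :* e)) refl

    *-identityˡ-re : ∀ a b → 1ℚ ℚ.* a ℚ.- 0ℚ ℚ.* b ≡ a
    *-identityˡ-re = solve 2 (λ a b → con 1ℚ :* a :- con 0ℚ :* b := a) refl

    *-identityˡ-im : ∀ a b → 1ℚ ℚ.* b ℚ.+ 0ℚ ℚ.* a ≡ b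
    *-identityˡ-im = solve 2 (λ a b → con 1ℚ :* b :+ con 0ℚ :* a := b) refl

    conj-re : ∀ a b → a ℚ.* a ℚ.- b ℚ.* (ℚ.- b) ≡ a ℚ.* a ℚ.+ b ℚ.* b
    conj-re = solve 2 (λ a b → a :* a :- b :* (:- b) := a :* a :+ b :* b) refl

    conj-im : ∀ a b → a ℚ.* (ℚ.- b) ℚ.+ b ℚ.* a ≡ 0ℚ
    conj-im = solve 2 (λ a b → a :* (:- b) :+ b :* a := con 0ℚ) refl

    -- conj z * (z * w), whose real and imaginary parts are those of w scaled by |z|²
    norm-re : ∀ a b c d →
      (a ℚ.* a ℚ.+ b ℚ.* b) ℚ.* c ≡ a ℚ.* (a ℚ.* c ℚ.- b ℚ.* d) ℚ.+ b ℚ.* (a ℚ.* d ℚ.+ b ℚ.* c)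
    norm-re = solve 4 (λ a b c d →
      (a :* a :+ b :* b) :* c := a :* (a :* c :- b :* d) :+ b :* (a :* d :+ b :* c)) refl

    norm-im : ∀ a b c d →
      (a ℚ.* a ℚ.+ b ℚ.* b) ℚ.* d ≡ a ℚ.* (a ℚ.* d ℚ.+ b ℚ.* c) ℚ.+ (ℚ.- b) ℚ.* (a ℚ.* c ℚ.- b ℚ.* d)
    norm-im = solve 4 (λ a b c d →
      (a :* a :+ b :* b) :* d := a :* (a :* d :+ b :* c) :+ (:- b) :* (a :* c :- b :* d)) refl

≈-pointwise : ∀ {z w} → (∀ n → seq (re z) n ≡ seq (re w) n) → (∀ n → seq (im z) n ≡ seq (im w) n) → z ≈ w
≈-pointwise e f = pointwise e , pointwise f

abstract
  +ᶜ-cong : ∀ {x y u v} → x ≈ y → u ≈ v → x +ᶜ u ≈ y +ᶜ v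
  +ᶜ-cong (a , b) (c , d) = +ᴿ-cong a c , +ᴿ-cong b d

  *ᶜ-cong : ∀ {x y u v} → x ≈ y → u ≈ v → x *ᶜ u ≈ y *ᶜ v
  *ᶜ-cong (a , b) (c , d) =
      +ᴿ-cong (*ᴿ-cong a c) (-ᴿ-cong (*ᴿ-cong b d))
    , +ᴿ-cong (*ᴿ-cong a d) (*ᴿ-cong b c)

  -ᶜ-cong : ∀ {x y} → x ≈ y → -ᶜ x ≈ -ᶜ y
  -ᶜ-cong (a , b) = -ᴿ-cong a , -ᴿ-cong b

  +ᶜ-assoc : ∀ x y z → (x +ᶜ y) +ᶜ z ≈ x +ᶜ (y +ᶜ z)
  +ᶜ-assoc x y z = ≈-pointwise (λ n → ℚ.+-assoc (seq (re x) n) _ _) (λ n → ℚ.+-assoc (seq (im x) n) _ _)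

  +ᶜ-comm : ∀ x y → x +ᶜ y ≈ y +ᶜ x
  +ᶜ-comm x y = ≈-pointwise (λ n → ℚ.+-comm (seq (re x) n) _) (λ n → ℚ.+-comm (seq (im x) n) _)

  +ᶜ-identityˡ : ∀ x → 0# +ᶜ x ≈ x
  +ᶜ-identityˡ x = ≈-pointwise (λ n → ℚ.+-identityˡ _) (λ n → ℚ.+-identityˡ _)

  -ᶜ-inverseˡ : ∀ x → (-ᶜ x) +ᶜ x ≈ 0#
  -ᶜ-inverseˡ x = ≈-pointwise (λ n → ℚ.+-inverseˡ (seq (re x) n)) (λ n → ℚ.+-inverseˡ (seq (im x) n))

  *ᶜ-assoc : ∀ x y z → (x *ᶜ y) *ᶜ z ≈ x *ᶜ (y *ᶜ z)
  *ᶜ-assoc x y z = ≈-pointwise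
    (λ n → *-assoc-re (seq (re x) n) (seq (im x) n) (seq (re y) n) (seq (im y) n) (seq (re z) n) (seq (im z) n))
    (λ n → *-assoc-im (seq (re x) n) (seq (im x) n) (seq (re y) n) (seq (im y) n) (seq (re z) n) (seq (im z) n))

  *ᶜ-comm : ∀ x y → x *ᶜ y ≈ y *ᶜ x
  *ᶜ-comm x y = ≈-pointwise
    (λ n → *-comm-re (seq (re x) n) (seq (im x) n) (seq (re y) n) (seq (im y) n))
    (λ n → *-comm-im (seq (re x) n) (seq (im x) n) (seq (re y) n) (seq (im y) n))

  *ᶜ-identityˡ : ∀ x → 1# *ᶜ x ≈ x
  *ᶜ-identityˡ x = ≈-pointwise
    (λ n → *-identityˡ-re (seq (re x) n) (seq (im x) n))
    (λ n → *-identityˡ-im (seq (re x) n) (seq (im x) n))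

  *ᶜ-distribˡ : ∀ x y z → x *ᶜ (y +ᶜ z) ≈ (x *ᶜ y) +ᶜ (x *ᶜ z)
  *ᶜ-distribˡ x y z = ≈-pointwise
    (λ n → distribˡ-re (seq (re x) n) (seq (im x) n) (seq (re y) n) (seq (im y) n) (seq (re z) n) (seq (im z) n))
    (λ n → distribˡ-im (seq (re x) n) (seq (im x) n) (seq (re y) n) (seq (im y) n) (seq (re z) n) (seq (im z) n))

  ≈-isEquivalence : IsEquivalence _≈_
  ≈-isEquivalence = record
    { refl = ≃-refl , ≃-refl
    ; sym = λ (a , b) → ≃-sym a , ≃-sym b
    ; trans = λ (a , b) (c , d) → ≃-trans a c , ≃-trans b d
    }

ℂ-commutativeRing : CommutativeRing 0ℓ 0ℓ
ℂ-commutativeRing = record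
  { Carrier = ℂ
  ; _≈_ = _≈_
  ; _+_ = _+ᶜ_
  ; _*_ = _*ᶜ_
  ; -_ = -ᶜ_
  ; 0# = 0#
  ; 1# = 1#
  ; isCommutativeRing = record
    { isRing = record
      { +-isAbelianGroup = record
        { isGroup = record
          { isMonoid = record
            { isSemigroup = record
              { isMagma = record { isEquivalence = ≈-isEquivalence ; ∙-cong = +ᶜ-cong }
              ; assoc = +ᶜ-assoc }
            ; identity = +ᶜ-identityˡ , λ x → ≈-trans (+ᶜ-comm x 0#) (+ᶜ-identityˡ x) }
          ; inverse = -ᶜ-inverseˡ , λ x → ≈-trans (+ᶜ-comm x (-ᶜ x)) (-ᶜ-inverseˡ x)
          ; ⁻¹-cong = -ᶜ-cong }
        ; comm = +ᶜ-comm }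
      ; *-cong = *ᶜ-cong
      ; *-assoc = *ᶜ-assoc
      ; *-identity = *ᶜ-identityˡ , λ x → ≈-trans (*ᶜ-comm x 1#) (*ᶜ-identityˡ x)
      ; distrib = *ᶜ-distribˡ , λ x y z →
          ≈-trans (*ᶜ-comm (y +ᶜ z) x) (≈-trans (*ᶜ-distribˡ x y z) (+ᶜ-cong (*ᶜ-comm x y) (*ᶜ-comm x z)))
      }
    ; *-comm = *ᶜ-comm
    }
  }
  where open IsEquivalence ≈-isEquivalence using () renaming (trans to ≈-trans)

module ℂᵣ = CommutativeRing ℂ-commutativeRing

abstract
  -- Multiplying `z *ᶜ w` by the conjugate of `z` gives |z|² times `w`, so each part reduces to a
  -- statement on real sequences.
  ℂ-domain : ∀ z w → z *ᶜ w ≈ 0# → ¬ (z ≈ 0#) → w ≈ 0#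
  ℂ-domain z w (p , q) ¬z = null⇒≃0 (null-domain norm (seq (re w)) (cauchy (re w)) scaled-re ¬norm)
                          , null⇒≃0 (null-domain norm (seq (im w)) (cauchy (im w)) scaled-im ¬norm)
    where
    norm : ℕ → ℚ
    norm n = seq (re z) n ℚ.* seq (re z) n ℚ.+ seq (im z) n ℚ.* seq (im z) n
    scaled-re : Null (λ n → norm n ℚ.* seq (re w) n)
    scaled-re = null-resp
      (λ n → sym (norm-re (seq (re z) n) (seq (im z) n) (seq (re w) n) (seq (im w) n)))
      (null-+ {λ n → seq (re z) n ℚ.* seq (re (z *ᶜ w)) n} {λ n → seq (im z) n ℚ.* seq (im (z *ᶜ w)) n}
        (null-* (seq (re z)) (cauchy (re z)) (≃0⇒null p)) (null-* (seq (im z)) (cauchy (im z)) (≃0⇒null q)))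
    scaled-im : Null (λ n → norm n ℚ.* seq (im w) n)
    scaled-im = null-resp
      (λ n → sym (norm-im (seq (re z) n) (seq (im z) n) (seq (re w) n) (seq (im w) n)))
      (null-+ {λ n → seq (re z) n ℚ.* seq (im (z *ᶜ w)) n} {λ n → (ℚ.- seq (im z) n) ℚ.* seq (re (z *ᶜ w)) n}
        (null-* (seq (re z)) (cauchy (re z)) (≃0⇒null q)) (null-* (seq (-ᴿ im z)) (cauchy (-ᴿ im z)) (≃0⇒null p)))
    ¬norm : ¬ Null norm
    ¬norm h = ¬z (null⇒≃0 (null-sum-of-squares (seq (re z)) (seq (im z)) h)
      , null⇒≃0 (null-sum-of-squares (seq (im z)) (seq (re z)) (null-resp (λ n → ℚ.+-comm (seq (re z) n ℚ.* seq (re z) n) _) h)))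

  1≉0 : ¬ (1# ≈ 0#)
  1≉0 (p , _) with ≃0⇒null p ℚ.½ (ℚ.positive⁻¹ ℚ.½)
  ... | N , f with f N ℕ.≤-refl
  ... | ℚ.*≤* (ℤ.+≤+ (ℕ.s≤s ()))

unit*conj : ∀ {z} → HasModulusOne z → z *ᶜ conj z ≈ 1#
unit*conj {z} u =
    ≃-trans (pointwise (λ n → conj-re (seq (re z) n) (seq (im z) n))) u
  , pointwise (λ n → conj-im (seq (re z) n) (seq (im z) n))

-- Ranks of principal submatrices

infixl 1 _>>=_
_>>=_ : {A B : Set} → ¬ ¬ A → (A → ¬ ¬ B) → ¬ ¬ B
(m >>= f) k = m (λ x → f x k)

pure : {A : Set} → A → ¬ ¬ A
pure x k = k x

em : (A : Set) → ¬ ¬ Dec A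
em A = ¬¬-excluded-middle

≤-stable : ∀ {m n} → ¬ ¬ (m ≤ n) → m ≤ n
≤-stable = decidable-stable (_ ℕ.≤? _)

≡-stable : ∀ {m n : ℕ} → ¬ ¬ (m ≡ n) → m ≡ n
≡-stable = decidable-stable (_ ℕ.≟ _)

-- `P` is arbitrary, so the search descends from the bound: either `P` holds there or the bound can
-- be lowered.
maximum : ∀ (P : ℕ → Set) N → P 0 → (∀ s → P s → s ≤ N) →
  ¬ ¬ (∃ λ r → P r × (∀ s → P s → s ≤ r))
maximum P zero    p₀ bound = pure (0 , p₀ , bound)
maximum P (suc N) p₀ bound = do
  no ¬p ← em (P (suc N))
    where yes p → pure (suc N , p , bound)
  maximum P N p₀ (λ s p → ℕ.≤-pred (ℕ.≤∧≢⇒< (bound s p) λ { refl → ¬p p }))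

injective⇒surjective : ∀ {m} (h : Fin m → Fin m) → (∀ {x y} → h x ≡ h y → x ≡ y) → ∀ y → ∃ λ x → h x ≡ y
injective⇒surjective {suc m} h inj y with Fin.any? (λ x → h x Fin.≟ y)
... | yes p = p
... | no ∄ = contradiction
  (Fin.injective⇒≤ {f = λ x → punchOut (avoids x)} (λ e → inj (Fin.punchOut-injective (avoids _) (avoids _) e)))
  ℕ.1+n≰n
  where
  avoids : ∀ x → y ≢ h x
  avoids x e = ∄ (x , sym e)

injective⇒permutation : ∀ {m} (h : Fin m → Fin m) → (∀ {x y} → h x ≡ h y → x ≡ y) → Permutation′ m
injective⇒permutation h inj = permutation h h⁻¹ (proj₂ ∘ injective⇒surjective h inj)
  (λ x → inj (proj₂ (injective⇒surjective h inj (h x))))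
  where
  h⁻¹ : Fin _ → Fin _
  h⁻¹ = proj₁ ∘ injective⇒surjective h inj

∈−⇒∈ : ∀ {n} {S : Subset n} {x v} → x ∈ˢ (S − v) → x ∈ˢ S
∈−⇒∈ {S = S} {v = v} = Subset.p─q⊆p S ⁅ v ⁆

-- Deleting `x` a second time changes nothing, whereas deleting a member lowers the size.
∈−⇒≢ : ∀ {n} {S : Subset n} {x v} → x ∈ˢ (S − v) → x ≢ v
∈−⇒≢ {S = S} {x} p refl =
  ℕ.<-irrefl (cong size (Subset.p─q─q≡p─q S ⁅ x ⁆)) (Subset.x∈p⇒∣p-x∣<∣p∣ p)

∈− : ∀ {n} {S : Subset n} {x v} → x ∈ˢ S → x ≢ v → x ∈ˢ (S − v)
∈− = Subset.x∈p∧x≢y⇒x∈p-y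

module _ (K : CommutativeRing 0ℓ 0ℓ) where
  open CommutativeRing K using () renaming (_≈_ to _≈ᴷ_; 0# to 0ᴷ; 1# to 1ᴷ; _*_ to _⊛_)

  Stable Domain Nontrivial : Set
  Stable     = ∀ {x y} → ¬ ¬ (x ≈ᴷ y) → x ≈ᴷ y
  Domain     = ∀ x y → x ⊛ y ≈ᴷ 0ᴷ → ¬ (x ≈ᴷ 0ᴷ) → y ≈ᴷ 0ᴷ
  Nontrivial = ¬ (1ᴷ ≈ᴷ 0ᴷ)

-- Linear algebra without division over a domain with stable equality

module LinearAlgebra (K : CommutativeRing 0ℓ 0ℓ) (stable : Stable K) (domain : Domain K) (1≉0 : Nontrivial K) where

  open CommutativeRing K using () renaming (Carrier to F; _≈_ to _≈ᴷ_; 0# to 0ᴷ; 1# to 1ᴷ; _*_ to _⊛_)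
  open CommutativeRing K using () renaming (_+_ to _⊕_; -_ to ⊖_)
  private module K = CommutativeRing K
  open Algebra.Properties.Semiring.Sum K.semiring
    using (sum; sum-cong-≋; sum-replicate-zero; sum-remove; ∑-distrib-+; sum-permute; *-distribˡ-sum; *-distribʳ-sum)
  open Algebra.Properties.Ring K.ring using (-‿distribˡ-*; -‿distribʳ-*; -0#≈0#)
  open Relation.Binary.Reasoning.Setoid K.setoid

  sum-zero : ∀ {m} {g : Fin m → F} → (∀ k → g k ≈ᴷ 0ᴷ) → sum g ≈ᴷ 0ᴷ
  sum-zero {m} h = K.trans (sum-cong-≋ h) (sum-replicate-zero m)

  sum-single : ∀ {m} (g : Fin m → F) k → (∀ l → l ≢ k → g l ≈ᴷ 0ᴷ) → sum g ≈ᴷ g k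
  sum-single {suc m} g k h = begin
    sum g                          ≈⟨ sum-remove {i = k} g ⟩
    g k ⊕ sum (g ∘ punchIn k)      ≈⟨ K.+-congˡ (sum-zero (λ l → h (punchIn k l) (Fin.punchInᵢ≢i k l))) ⟩
    g k ⊕ 0ᴷ                       ≈⟨ K.+-identityʳ _ ⟩
    g k                            ∎

  sum-pair : ∀ {m} (g : Fin m → F) k l → k ≢ l → (∀ i → i ≢ k → i ≢ l → g i ≈ᴷ 0ᴷ) →
    sum g ≈ᴷ g k ⊕ g l
  sum-pair {suc m} g k l k≢l h = begin
    sum g                          ≈⟨ sum-remove {i = k} g ⟩
    g k ⊕ sum (g ∘ punchIn k)      ≈⟨ K.+-congˡ (sum-single (g ∘ punchIn k) (punchOut k≢l) others) ⟩
    g k ⊕ g (punchIn k (punchOut k≢l)) ≡⟨ cong (λ i → g k ⊕ g i) (Fin.punchIn-punchOut k≢l) ⟩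
    g k ⊕ g l                      ∎
    where
    others : ∀ i → i ≢ punchOut k≢l → g (punchIn k i) ≈ᴷ 0ᴷ
    others i i≢ = h _ (Fin.punchInᵢ≢i k i) λ e →
      i≢ (Fin.punchIn-injective k _ _ (trans e (sym (Fin.punchIn-punchOut k≢l))))

  module _ {J : Set} where

    combination : ∀ {s} → (Fin s → F) → (Fin s → J → F) → J → F
    combination c v j = sum (λ k → c k ⊛ v k j)

    Independent : (J → Set) → ∀ {s} → (Fin s → J → F) → Set
    Independent C v = ∀ c → (∀ j → C j → combination c v j ≈ᴷ 0ᴷ) → ∀ k → c k ≈ᴷ 0ᴷ

    combination-insert : ∀ {s} (v : Fin (suc s) → J → F) k₀ d j →
      combination (insertAt d k₀ 0ᴷ) v j ≈ᴷ combination d (v ∘ punchIn k₀) j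
    combination-insert v k₀ d j = begin
      sum (λ k → insertAt d k₀ 0ᴷ k ⊛ v k j)
        ≈⟨ sum-remove {i = k₀} (λ k → insertAt d k₀ 0ᴷ k ⊛ v k j) ⟩
      insertAt d k₀ 0ᴷ k₀ ⊛ v k₀ j ⊕ sum (λ k → insertAt d k₀ 0ᴷ (punchIn k₀ k) ⊛ v (punchIn k₀ k) j)
        ≈⟨ K.+-cong (K.*-congʳ (K.reflexive (insertAt-lookup d k₀ 0ᴷ)))
             (sum-cong-≋ (λ k → K.*-congʳ (K.reflexive (insertAt-punchIn d k₀ 0ᴷ k)))) ⟩
      0ᴷ ⊛ v k₀ j ⊕ combination d (v ∘ punchIn k₀) j
        ≈⟨ K.+-congʳ (K.zeroˡ _) ⟩
      0ᴷ ⊕ combination d (v ∘ punchIn k₀) j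
        ≈⟨ K.+-identityˡ _ ⟩
      combination d (v ∘ punchIn k₀) j ∎

    independent-remove : ∀ {C s} (v : Fin (suc s) → J → F) k₀ →
      Independent C v → Independent C (v ∘ punchIn k₀)
    independent-remove v k₀ ind d h k = K.trans
      (K.reflexive (sym (insertAt-punchIn d k₀ 0ᴷ k)))
      (ind (insertAt d k₀ 0ᴷ) (λ j cj → K.trans (combination-insert v k₀ d j) (h j cj)) (punchIn k₀ k))

    combination-linear : ∀ {s} (v : Fin s → J → F) γ α c d j →
      combination (λ k → γ ⊛ d k ⊕ ⊖ (α ⊛ c k)) v j
      ≈ᴷ γ ⊛ combination d v j ⊕ ⊖ α ⊛ combination c v j
    combination-linear v γ α c d j = begin
      sum (λ k → (γ ⊛ d k ⊕ ⊖ (α ⊛ c k)) ⊛ v k j)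
        ≈⟨ sum-cong-≋ (λ k → K.trans (K.distribʳ (v k j) _ _)
             (K.+-cong (K.*-assoc γ (d k) (v k j))
               (K.trans (K.*-congʳ (-‿distribˡ-* α (c k))) (K.*-assoc (⊖ α) (c k) (v k j))))) ⟩
      sum (λ k → γ ⊛ (d k ⊛ v k j) ⊕ ⊖ α ⊛ (c k ⊛ v k j))
        ≈⟨ ∑-distrib-+ (λ k → γ ⊛ (d k ⊛ v k j)) (λ k → ⊖ α ⊛ (c k ⊛ v k j)) ⟩
      sum (λ k → γ ⊛ (d k ⊛ v k j)) ⊕ sum (λ k → ⊖ α ⊛ (c k ⊛ v k j))
        ≈⟨ K.+-cong (K.sym (*-distribˡ-sum γ (λ k → d k ⊛ v k j)))
                    (K.sym (*-distribˡ-sum (⊖ α) (λ k → c k ⊛ v k j))) ⟩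
      γ ⊛ combination d v j ⊕ ⊖ α ⊛ combination c v j ∎

    -- If c is a dependency of the truncated family with c k₀ ≠ 0, the member k₀ can be
    -- dropped: a dependency d of the others is combined with c so that the coordinate j₀
    -- vanishes as well.
    independent-truncate : ∀ {C C′ : J → Set} {s} (v : Fin (suc s) → J → F) j₀ →
      (∀ j → C j → j ≡ j₀ ⊎ C′ j) → Independent C v →
      ¬ ¬ (∃ λ k₀ → Independent C′ (v ∘ punchIn k₀))
    independent-truncate {C} {C′} v j₀ split ind = do
      yes (c , dep , k₀ , c≉0) ← em (∃ λ c → (∀ j → C′ j → combination c v j ≈ᴷ 0ᴷ) × ∃ λ k → ¬ (c k ≈ᴷ 0ᴷ))
        where no none → pure (Fin.zero , independent-remove v Fin.zero
                (λ c dep k → stable (λ c≉0 → none (c , dep , k , c≉0))))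
      pure (k₀ , λ d h → drop c dep k₀ c≉0 d h)
      where
      drop : ∀ c → (∀ j → C′ j → combination c v j ≈ᴷ 0ᴷ) → ∀ k₀ → ¬ (c k₀ ≈ᴷ 0ᴷ) →
        Independent C′ (v ∘ punchIn k₀)
      drop c dep k₀ c≉0 d h = λ k → K.trans (K.reflexive (sym (insertAt-punchIn d k₀ 0ᴷ k))) (d̂≈0 (punchIn k₀ k))
        where
        d̂ : Fin _ → F
        d̂ = insertAt d k₀ 0ᴷ
        α γ : F
        α = combination d̂ v j₀
        γ = combination c v j₀
        e : Fin _ → F
        e k = γ ⊛ d̂ k ⊕ ⊖ (α ⊛ c k)
        d̂-dep : ∀ j → C′ j → combination d̂ v j ≈ᴷ 0ᴷ
        d̂-dep j cj = K.trans (combination-insert v k₀ d j) (h j cj)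
        e-dep : ∀ j → C j → combination e v j ≈ᴷ 0ᴷ
        e-dep j cj = K.trans (combination-linear v γ α c d̂ j) (vanish (split j cj))
          where
          vanish : j ≡ j₀ ⊎ C′ j → γ ⊛ combination d̂ v j ⊕ ⊖ α ⊛ combination c v j ≈ᴷ 0ᴷ
          vanish (inj₁ refl) = begin
            γ ⊛ α ⊕ ⊖ α ⊛ γ    ≈⟨ K.+-cong (K.*-comm γ α) (K.sym (-‿distribˡ-* α γ)) ⟩
            α ⊛ γ ⊕ ⊖ (α ⊛ γ)  ≈⟨ K.-‿inverseʳ _ ⟩
            0ᴷ                 ∎
          vanish (inj₂ cj′) = begin
            γ ⊛ combination d̂ v j ⊕ ⊖ α ⊛ combination c v j
              ≈⟨ K.+-cong (K.trans (K.*-congˡ (d̂-dep j cj′)) (K.zeroʳ γ))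
                          (K.trans (K.*-congˡ (dep j cj′)) (K.zeroʳ (⊖ α))) ⟩
            0ᴷ ⊕ 0ᴷ ≈⟨ K.+-identityˡ 0ᴷ ⟩
            0ᴷ ∎
        -- `e` is a dependency on all of `C`, hence zero. At `k₀` the coefficient of `d̂` is the
        -- inserted 0, so only α c k₀ is left; cancelling c k₀ shows that `d̂` vanishes at `j₀` as
        -- well.
        α*c≈0 : α ⊛ c k₀ ≈ᴷ 0ᴷ
        α*c≈0 = begin
          α ⊛ c k₀                              ≈⟨ K.+-identityˡ _ ⟨
          0ᴷ ⊕ α ⊛ c k₀                         ≈⟨ K.+-congʳ (ind e e-dep k₀) ⟨
          (γ ⊛ d̂ k₀ ⊕ ⊖ (α ⊛ c k₀)) ⊕ α ⊛ c k₀  ≈⟨ K.+-assoc _ _ _ ⟩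
          γ ⊛ d̂ k₀ ⊕ (⊖ (α ⊛ c k₀) ⊕ α ⊛ c k₀)  ≈⟨ K.+-congˡ (K.-‿inverseˡ _) ⟩
          γ ⊛ d̂ k₀ ⊕ 0ᴷ                         ≈⟨ K.+-identityʳ _ ⟩
          γ ⊛ d̂ k₀                              ≈⟨ K.*-congˡ (K.reflexive (insertAt-lookup d k₀ 0ᴷ)) ⟩
          γ ⊛ 0ᴷ                                ≈⟨ K.zeroʳ γ ⟩
          0ᴷ                                    ∎
        α≈0 : α ≈ᴷ 0ᴷ
        α≈0 = domain (c k₀) α (K.trans (K.*-comm _ _) α*c≈0) c≉0
        d̂≈0 : ∀ k → d̂ k ≈ᴷ 0ᴷ
        d̂≈0 = ind d̂ (λ j cj → case split j cj of λ { (inj₁ refl) → α≈0 ; (inj₂ cj′) → d̂-dep j cj′ })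

  -- Principal submatrices are given by sets S of labels; ι labels the rows and columns.
  module _ {n : ℕ} {I : Set} (ι : I → Fin n) (M : I → I → F) where

    IndependentRows : Subset n → ∀ {s} → (Fin s → I) → Set
    IndependentRows S f = (∀ k → ι (f k) ∈ˢ S) × Independent (λ j → ι j ∈ˢ S) (M ∘ f)

    record HasRank (S : Subset n) (r : ℕ) : Set where
      constructor mkRank
      field
        basis   : ∃ λ (f : Fin r → I) → IndependentRows S f
        maximal : ∀ {s} (f : Fin s → I) → IndependentRows S f → s ≤ r

    rank-unique : ∀ {S r r′} → HasRank S r → HasRank S r′ → r ≡ r′
    rank-unique (mkRank (f , hf) max) (mkRank (g , hg) max′) = ℕ.≤-antisym (max′ f hf) (max g hg)

    rows-mono : ∀ {S S′ s} {f : Fin s → I} → (∀ {i} → ι i ∈ˢ S′ → ι i ∈ˢ S) →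
      IndependentRows S′ f → IndependentRows S f
    rows-mono sub (mem , ind) = (λ k → sub (mem k)) , λ c h → ind c (λ j p → h j (sub p))

    rank-resp : ∀ {S S′ r} → (∀ {i} → ι i ∈ˢ S → ι i ∈ˢ S′) → (∀ {i} → ι i ∈ˢ S′ → ι i ∈ˢ S) →
      HasRank S r → HasRank S′ r
    rank-resp to from (mkRank (f , hf) max) = mkRank (f , rows-mono to hf) λ g hg → max g (rows-mono from hg)

    rank-mono : ∀ {S S′ r r′} → (∀ {i} → ι i ∈ˢ S′ → ι i ∈ˢ S) → HasRank S r → HasRank S′ r′ → r′ ≤ r
    rank-mono sub (mkRank _ max) (mkRank (f , hf) _) = max f (rows-mono sub hf)

    rows-injective : ∀ {S s} {f : Fin s → I} → IndependentRows S f → ∀ k l → f k ≡ f l → k ≡ l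
    rows-injective {f = f} (_ , ind) k l e with k Fin.≟ l
    ... | yes k≡l = k≡l
    ... | no  k≢l = contradiction (K.trans (K.reflexive (sym c-k)) (ind c dep k)) 1≉0
      where
      c : Fin _ → F
      c i with i Fin.≟ k | i Fin.≟ l
      ... | yes _ | _     = 1ᴷ
      ... | no _  | yes _ = ⊖ 1ᴷ
      ... | no _  | no _  = 0ᴷ
      c-k : c k ≡ 1ᴷ
      c-k with k Fin.≟ k | k Fin.≟ l
      ... | yes _ | _ = refl
      ... | no k≢k | _ = contradiction refl k≢k
      c-l : c l ≡ ⊖ 1ᴷ
      c-l with l Fin.≟ k | l Fin.≟ l
      ... | yes l≡k | _ = contradiction (sym l≡k) k≢l
      ... | no _ | yes _ = refl
      ... | no _ | no l≢l = contradiction refl l≢l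
      c-else : ∀ i → i ≢ k → i ≢ l → c i ≡ 0ᴷ
      c-else i i≢k i≢l with i Fin.≟ k | i Fin.≟ l
      ... | yes i≡k | _ = contradiction i≡k i≢k
      ... | no _ | yes i≡l = contradiction i≡l i≢l
      ... | no _ | no _ = refl
      dep : ∀ j → _ → combination c (M ∘ f) j ≈ᴷ 0ᴷ
      dep j _ = begin
        combination c (M ∘ f) j
          ≈⟨ sum-pair (λ i → c i ⊛ M (f i) j) k l k≢l
               (λ i p q → K.trans (K.*-congʳ (K.reflexive (c-else i p q))) (K.zeroˡ _)) ⟩
        c k ⊛ M (f k) j ⊕ c l ⊛ M (f l) j
          ≡⟨ cong₂ _⊕_ (cong₂ _⊛_ c-k (cong (λ i → M i j) e)) (cong (_⊛ M (f l) j) c-l) ⟩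
        1ᴷ ⊛ M (f l) j ⊕ ⊖ 1ᴷ ⊛ M (f l) j
          ≈⟨ K.distribʳ (M (f l) j) 1ᴷ (⊖ 1ᴷ) ⟨
        (1ᴷ ⊕ ⊖ 1ᴷ) ⊛ M (f l) j
          ≈⟨ K.trans (K.*-congʳ (K.-‿inverseʳ 1ᴷ)) (K.zeroˡ _) ⟩
        0ᴷ ∎

    module _ (ι-injective : ∀ {i j} → ι i ≡ ι j → i ≡ j) where

      rank-exists : ∀ S → ¬ ¬ ∃ (HasRank S)
      rank-exists S = do
        (r , f , max) ← maximum (λ s → ∃ λ (f : Fin s → I) → IndependentRows S f) n
          ((λ ()) , (λ ()) , λ _ _ ())
          (λ s (f , hf) → Fin.injective⇒≤ {f = ι ∘ f} (λ e → rows-injective hf _ _ (ι-injective e)))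
        pure (r , mkRank f λ {s} g hg → max s (g , hg))

      -- Deleting the column v costs one row, deleting the row v another.
      rank-delete : ∀ {S v a b} → HasRank S a → HasRank (S − v) b → a ≤ 2 ℕ.+ b
      rank-delete {a = zero} _ _ = z≤n
      rank-delete {a = suc zero} _ _ = s≤s z≤n
      rank-delete {S} {v} {suc (suc a)} {b} (mkRank (f , mem , ind) _) (mkRank _ max) = s≤s (s≤s (≤-stable do
        yes (j₀ , ιj₀≡v) ← em (∃ λ j → ι j ≡ v)
          where no ∄ → pure (ℕ.≤-trans (ℕ.n≤1+n a) (ℕ.≤-trans (ℕ.n≤1+n _)
                  (max f ( (λ k → keep (λ e → ∄ (f k , e)) (mem k))
                         , λ c h → ind c (λ j p → h j (keep (λ e → ∄ (j , e)) p))))))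
        (k₀ , ind′) ← independent-truncate {C = λ j → ι j ∈ˢ S} {C′ = λ j → ι j ∈ˢ (S − v)} (M ∘ f) j₀
          (λ j p → case ι j Fin.≟ v of λ
            { (yes e) → inj₁ (ι-injective (trans e (sym ιj₀≡v))) ; (no ne) → inj₂ (keep ne p) }) ind
        pure (rows k₀ ind′)))
        where
        keep : ∀ {x} → x ≢ v → x ∈ˢ S → x ∈ˢ (S − v)
        keep ne p = ∈− p ne
        rows : ∀ k₀ → Independent (λ j → ι j ∈ˢ (S − v)) (M ∘ f ∘ punchIn k₀) → a ≤ b
        rows k₀ ind′ with Fin.any? (λ k → ι (f (punchIn k₀ k)) Fin.≟ v)
        ... | yes (k₁ , e) = max (f ∘ punchIn k₀ ∘ punchIn k₁)
              ((λ k → keep (λ e′ → Fin.punchInᵢ≢i k₁ k (Fin.punchIn-injective k₀ _ _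
                  (rows-injective (mem , ind) _ _ (ι-injective (trans e′ (sym e)))))) (mem _))
              , independent-remove (M ∘ f ∘ punchIn k₀) k₁ ind′)
        ... | no ∄ = ℕ.≤-trans (ℕ.n≤1+n a)
              (max (f ∘ punchIn k₀) ((λ k → keep (λ e → ∄ (k , e)) (mem _)) , ind′))

    Regular : F → Set
    Regular x = ∀ b → b ⊛ x ≈ᴷ 0ᴷ → b ≈ᴷ 0ᴷ

    -- A zero row belongs to no independent family, so a basis for `S` avoids `w`; the column `w` is
    -- zero too, and its loss creates no dependency.
    rank-delete-isolated : ∀ {S w a b} →
      (∀ {i j} → ι i ∈ˢ S → ι j ∈ˢ S → ι i ≡ w → M i j ≈ᴷ 0ᴷ × M j i ≈ᴷ 0ᴷ) →
      HasRank S a → HasRank (S − w) b → a ≡ b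
    rank-delete-isolated {S} {w} {a} {b} isolated rS@(mkRank (f , mem , ind) _) rS′@(mkRank _ max) =
      ℕ.≤-antisym (max f (keep-rows , keep-ind)) (rank-mono ∈−⇒∈ rS rS′)
      where
      nonzero : ∀ k → ι (f k) ≢ w
      nonzero k e = 1≉0 (K.trans (K.reflexive (sym δ-k)) (ind δ dep k))
        where
        δ : Fin a → F
        δ i with i Fin.≟ k
        ... | yes _ = 1ᴷ
        ... | no _  = 0ᴷ
        δ-k : δ k ≡ 1ᴷ
        δ-k with k Fin.≟ k
        ... | yes _ = refl
        ... | no k≢k = contradiction refl k≢k
        δ-else : ∀ i → i ≢ k → δ i ≡ 0ᴷ
        δ-else i ne with i Fin.≟ k
        ... | yes i≡k = contradiction i≡k ne
        ... | no _ = refl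
        dep : ∀ j → ι j ∈ˢ S → combination δ (M ∘ f) j ≈ᴷ 0ᴷ
        dep j p = K.trans
          (sum-single (λ i → δ i ⊛ M (f i) j) k
            (λ i ne → K.trans (K.*-congʳ (K.reflexive (δ-else i ne))) (K.zeroˡ _)))
          (K.trans (K.*-congˡ (proj₁ (isolated (mem k) p e))) (K.zeroʳ _))
      keep-rows : ∀ k → ι (f k) ∈ˢ (S − w)
      keep-rows k = ∈− (mem k) (nonzero k)
      keep-ind : Independent (λ j → ι j ∈ˢ (S − w)) (M ∘ f)
      keep-ind c h = ind c λ j p → case ι j Fin.≟ w of λ
        { (yes e) → sum-zero (λ k → K.trans (K.*-congˡ (proj₂ (isolated p (mem k) e))) (K.zeroʳ _))
        ; (no ne) → h j (∈− p ne) }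

    module _ (ι-injective : ∀ {i j} → ι i ≡ ι j → i ≡ j) where

      -- Upper bound: without `y` the vertex `w` is isolated, so only the deletion of `y` costs
      -- rank. Lower bound: a basis for the rest, extended by the rows `y` and `w`, stays
      -- independent, since column `w` isolates the coefficient of `y`, the columns of the rest then
      -- those of the basis, and column `y` finally that of `w`.
      rank-delete-pendant : ∀ {S a b} w y → ι w ∈ˢ S → ι y ∈ˢ S → w ≢ y →
        (∀ {j} → ι j ∈ˢ S → j ≢ y → M w j ≈ᴷ 0ᴷ × M j w ≈ᴷ 0ᴷ) →
        Regular (M w y) → Regular (M y w) →
        HasRank S a → HasRank (S − ι y − ι w) b → a ≡ 2 ℕ.+ b
      rank-delete-pendant {S} {a} {b} w y w∈S y∈S w≢y pendant reg-wy reg-yw rS rS″@(mkRank (f , mem , ind) _) =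
        ℕ.≤-antisym upper (HasRank.maximal rS g (g∈S , g-ind))
        where
        in-S : ∀ {x} → x ∈ˢ (S − ι y − ι w) → x ∈ˢ S
        in-S = ∈−⇒∈ ∘ ∈−⇒∈
        upper : a ≤ 2 ℕ.+ b
        upper = ≤-stable do
          (c , rS′) ← rank-exists ι-injective (S − ι y)
          pure (subst (λ c → a ≤ 2 ℕ.+ c)
            (rank-delete-isolated (λ {i} {j} _ j∈ e → isolated (ι-injective e) j∈) rS′ rS″)
            (rank-delete ι-injective rS rS′))
          where
          isolated : ∀ {i j} → i ≡ w → ι j ∈ˢ (S − ι y) → M i j ≈ᴷ 0ᴷ × M j i ≈ᴷ 0ᴷ
          isolated refl j∈ = pendant (∈−⇒∈ j∈) λ { refl → ∈−⇒≢ j∈ refl }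
        g : Fin (suc (suc b)) → I
        g Fin.zero = y
        g (Fin.suc Fin.zero) = w
        g (Fin.suc (Fin.suc k)) = f k
        g∈S : ∀ k → ι (g k) ∈ˢ S
        g∈S Fin.zero = y∈S
        g∈S (Fin.suc Fin.zero) = w∈S
        g∈S (Fin.suc (Fin.suc k)) = in-S (mem k)
        f≢y : ∀ k → f k ≢ y
        f≢y k e = ∈−⇒≢ (∈−⇒∈ (mem k)) (cong ι e)
        g-ind : Independent (λ j → ι j ∈ˢ S) (M ∘ g)
        g-ind c h = all
          where
          0* : ∀ {x z} → z ≈ᴷ 0ᴷ → x ⊛ z ≈ᴷ 0ᴷ
          0* e = K.trans (K.*-congˡ e) (K.zeroʳ _)
          *0 : ∀ {x z} → x ≈ᴷ 0ᴷ → x ⊛ z ≈ᴷ 0ᴷ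
          *0 e = K.trans (K.*-congʳ e) (K.zeroˡ _)
          only : ∀ j → combination c (M ∘ g) j ≈ᴷ 0ᴷ → ∀ k → (∀ l → l ≢ k → c l ⊛ M (g l) j ≈ᴷ 0ᴷ) →
            c k ⊛ M (g k) j ≈ᴷ 0ᴷ
          only j e k others = K.trans (K.sym (sum-single (λ l → c l ⊛ M (g l) j) k others)) e
          c-y : c Fin.zero ≈ᴷ 0ᴷ
          c-y = reg-yw _ (only w (h w w∈S) Fin.zero λ
            { Fin.zero ne → contradiction refl ne
            ; (Fin.suc Fin.zero) _ → 0* (proj₁ (pendant w∈S w≢y))
            ; (Fin.suc (Fin.suc k)) _ → 0* (proj₂ (pendant (in-S (mem k)) (f≢y k))) })
          c-f : ∀ k → c (Fin.suc (Fin.suc k)) ≈ᴷ 0ᴷ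
          c-f = ind (λ k → c (Fin.suc (Fin.suc k))) λ j p → begin
            combination (λ k → c (Fin.suc (Fin.suc k))) (M ∘ f) j
              ≈⟨ K.trans (K.+-congˡ (K.+-identityˡ _)) (K.+-identityˡ _) ⟨
            0ᴷ ⊕ (0ᴷ ⊕ combination (λ k → c (Fin.suc (Fin.suc k))) (M ∘ f) j)
              ≈⟨ K.+-cong (*0 c-y) (K.+-congʳ (0* (proj₁ (pendant (in-S p)
                   λ { refl → ∈−⇒≢ (∈−⇒∈ p) refl })))) ⟨
            combination c (M ∘ g) j
              ≈⟨ h j (in-S p) ⟩
            0ᴷ ∎
          c-w : c (Fin.suc Fin.zero) ≈ᴷ 0ᴷ
          c-w = reg-wy _ (only y (h y y∈S) (Fin.suc Fin.zero) λ
            { Fin.zero _ → *0 c-y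
            ; (Fin.suc Fin.zero) ne → contradiction refl ne
            ; (Fin.suc (Fin.suc k)) _ → *0 (c-f k) })
          all : ∀ k → c k ≈ᴷ 0ᴷ
          all Fin.zero = c-y
          all (Fin.suc Fin.zero) = c-w
          all (Fin.suc (Fin.suc k)) = c-f k

    -- Only columns with at most two nonzero entries are recorded: on a cycle these are all.
    rank-drop-0⇒null-vector : ∀ {S a} v → ι v ∈ˢ S → HasRank S a → HasRank (S − ι v) a →
      ¬ ¬ (∃ λ (φ : Fin n → F) → ¬ (φ (ι v) ≈ᴷ 0ᴷ) ×
        (∀ j i₁ i₂ → ι j ∈ˢ S → ι i₁ ≢ ι i₂ → (∀ i → ι i ∈ˢ S → ι i ≢ ι i₁ → ι i ≢ ι i₂ → M i j ≈ᴷ 0ᴷ) →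
          (∀ {i} → ι i ≡ ι i₁ → i ≡ i₁) → (∀ {i} → ι i ≡ ι i₂ → i ≡ i₂) →
          φ (ι i₁) ⊛ M i₁ j ⊕ φ (ι i₂) ⊛ M i₂ j ≈ᴷ 0ᴷ))
    rank-drop-0⇒null-vector {S} {a} v v∈S (mkRank _ max) (mkRank (f , mem , ind) _) = do
      -- `g` adds the row `v` to a basis for `S − ι v`: that is one row too many to be independent.
      yes (c , dep , k₀ , c≉0) ← em (∃ λ c → (∀ j → ι j ∈ˢ S → combination c (M ∘ g) j ≈ᴷ 0ᴷ) × ∃ λ k → ¬ (c k ≈ᴷ 0ᴷ))
        where no none → contradiction
                (max g (g∈S , λ c dep k → stable (λ c≉0 → none (c , dep , k , c≉0)))) ℕ.1+n≰n
      pure (φ c , φ-v c dep k₀ c≉0 , φ-null c dep)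
      where
      g : Fin (suc a) → I
      g Fin.zero = v
      g (Fin.suc k) = f k
      g∈S : ∀ k → ι (g k) ∈ˢ S
      g∈S Fin.zero = v∈S
      g∈S (Fin.suc k) = ∈−⇒∈ (mem k)
      -- Coefficients of row positions become a function on vertices by summing, at `x`, over the
      -- rows labelled `x`.
      weight : (Fin (suc a) → F) → Fin n → Fin (suc a) → F
      weight c x k with ι (g k) Fin.≟ x
      ... | yes _ = c k
      ... | no _  = 0ᴷ
      weight-≡ : ∀ c x k → ι (g k) ≡ x → weight c x k ≡ c k
      weight-≡ c x k e with ι (g k) Fin.≟ x
      ... | yes _ = refl
      ... | no ne = contradiction e ne
      weight-≢ : ∀ c x k → ι (g k) ≢ x → weight c x k ≡ 0ᴷ
      weight-≢ c x k ne with ι (g k) Fin.≟ x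
      ... | yes e = contradiction e ne
      ... | no _ = refl
      φ : (Fin (suc a) → F) → Fin n → F
      φ c x = sum (weight c x)
      -- Only position 0 carries the label of `v`. If its coefficient vanished, the others would be
      -- a dependency of the basis `f`, and all of `c` would be zero.
      φ-v : ∀ c → (∀ j → ι j ∈ˢ S → combination c (M ∘ g) j ≈ᴷ 0ᴷ) → ∀ k₀ → ¬ (c k₀ ≈ᴷ 0ᴷ) → ¬ (φ c (ι v) ≈ᴷ 0ᴷ)
      φ-v c dep k₀ c≉0 φ≈0 = c≉0 (c≈0 k₀)
        where
        c-v : c Fin.zero ≈ᴷ 0ᴷ
        c-v = K.trans (K.reflexive (sym (weight-≡ c (ι v) Fin.zero refl)))
          (K.trans (K.sym (sum-single (weight c (ι v)) Fin.zero λ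
            { Fin.zero ne → contradiction refl ne
            ; (Fin.suc k) _ → K.reflexive (weight-≢ c (ι v) (Fin.suc k)
                (∈−⇒≢ (mem k))) })) φ≈0)
        c≈0 : ∀ k → c k ≈ᴷ 0ᴷ
        c≈0 Fin.zero = c-v
        c≈0 (Fin.suc k) = ind (c ∘ Fin.suc) (λ j p → K.trans
          (K.sym (K.trans (K.+-congʳ (K.trans (K.*-congʳ c-v) (K.zeroˡ _))) (K.+-identityˡ _)))
          (dep j (∈−⇒∈ p))) k
      φ-null : ∀ c → (∀ j → ι j ∈ˢ S → combination c (M ∘ g) j ≈ᴷ 0ᴷ) →
        ∀ j i₁ i₂ → ι j ∈ˢ S → ι i₁ ≢ ι i₂ → (∀ i → ι i ∈ˢ S → ι i ≢ ι i₁ → ι i ≢ ι i₂ → M i j ≈ᴷ 0ᴷ) →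
        (∀ {i} → ι i ≡ ι i₁ → i ≡ i₁) → (∀ {i} → ι i ≡ ι i₂ → i ≡ i₂) →
        φ c (ι i₁) ⊛ M i₁ j ⊕ φ c (ι i₂) ⊛ M i₂ j ≈ᴷ 0ᴷ
      φ-null c dep j i₁ i₂ j∈S i₁≢i₂ zero-else eq₁ eq₂ = begin
        φ c (ι i₁) ⊛ M i₁ j ⊕ φ c (ι i₂) ⊛ M i₂ j
          ≈⟨ K.+-cong (*-distribʳ-sum (M i₁ j) (weight c (ι i₁))) (*-distribʳ-sum (M i₂ j) (weight c (ι i₂))) ⟩
        sum (λ k → weight c (ι i₁) k ⊛ M i₁ j) ⊕ sum (λ k → weight c (ι i₂) k ⊛ M i₂ j)
          ≈⟨ ∑-distrib-+ (λ k → weight c (ι i₁) k ⊛ M i₁ j) (λ k → weight c (ι i₂) k ⊛ M i₂ j) ⟨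
        sum (λ k → weight c (ι i₁) k ⊛ M i₁ j ⊕ weight c (ι i₂) k ⊛ M i₂ j)
          ≈⟨ sum-cong-≋ term ⟩
        combination c (M ∘ g) j
          ≈⟨ dep j j∈S ⟩
        0ᴷ ∎
        where
        *0 : ∀ {x z} → x ≡ 0ᴷ → x ⊛ z ≈ᴷ 0ᴷ
        *0 e = K.trans (K.*-congʳ (K.reflexive e)) (K.zeroˡ _)
        term : ∀ k → weight c (ι i₁) k ⊛ M i₁ j ⊕ weight c (ι i₂) k ⊛ M i₂ j ≈ᴷ c k ⊛ M (g k) j
        term k with ι (g k) Fin.≟ ι i₁ | ι (g k) Fin.≟ ι i₂
        ... | yes e | yes e′ = contradiction (trans (sym e) e′) i₁≢i₂
        ... | yes e | no _ = K.trans (K.+-congˡ (K.zeroˡ _))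
                (K.trans (K.+-identityʳ _) (K.*-congˡ (K.reflexive (cong (λ i → M i j) (sym (eq₁ e))))))
        ... | no _ | yes e = K.trans (K.+-congʳ (K.zeroˡ _))
                (K.trans (K.+-identityˡ _) (K.*-congˡ (K.reflexive (cong (λ i → M i j) (sym (eq₂ e))))))
        ... | no ne | no ne′ = K.trans (K.+-cong (K.zeroˡ _) (K.zeroˡ _)) (K.trans (K.+-identityˡ _)
                (K.sym (K.trans (K.*-congˡ (zero-else (g k) (g∈S k) ne ne′)) (K.zeroʳ _))))

    -- A basis consists of rows `e k` and has as many members, so it is `e` up to a permutation.
    full-rank⇒independent : ∀ {S p} (e : Fin p → I) → (∀ {i} → ι i ∈ˢ S → ∃ λ k → e k ≡ i) →
      HasRank S p → Independent (λ j → ι j ∈ˢ S) (M ∘ e)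
    full-rank⇒independent {S} {p} e onto (mkRank (f , mem , ind) _) c dep k =
      K.trans (K.reflexive (cong c (sym (proj₂ (injective⇒surjective h h-injective k)))))
        (ind (c ∘ h) dep′ (proj₁ (injective⇒surjective h h-injective k)))
      where
      h : Fin p → Fin p
      h k = proj₁ (onto (mem k))
      e∘h : ∀ k → e (h k) ≡ f k
      e∘h k = proj₂ (onto (mem k))
      h-injective : ∀ {x y} → h x ≡ h y → x ≡ y
      h-injective {x} {y} eq = rows-injective (mem , ind) x y (trans (sym (e∘h x)) (trans (cong e eq) (e∘h y)))
      dep′ : ∀ j → ι j ∈ˢ S → combination (c ∘ h) (M ∘ f) j ≈ᴷ 0ᴷ
      dep′ j j∈S = begin
        sum (λ k → c (h k) ⊛ M (f k) j)
          ≈⟨ sum-cong-≋ (λ k → K.*-congˡ (K.reflexive (cong (λ i → M i j) (sym (e∘h k))))) ⟩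
        sum (λ k → c (h k) ⊛ M (e (h k)) j)
          ≈⟨ sum-permute (λ k → c k ⊛ M (e k) j) (injective⇒permutation h h-injective) ⟨
        combination c (M ∘ e) j
          ≈⟨ dep j j∈S ⟩
        0ᴷ ∎

-- Cycles

toℕ-next : ∀ {p} (i : Fin (suc p)) → toℕ (next i) ≡ suc (toℕ i) % suc p
toℕ-next {p} i = Fin.toℕ-fromℕ< (m%n<n (suc (toℕ i)) (suc p))

next-< : ∀ {p} (i : Fin (suc p)) → toℕ i < p → toℕ (next i) ≡ suc (toℕ i)
next-< i i<p = trans (toℕ-next i) (m<n⇒m%n≡m (s≤s i<p))

next-last : ∀ {p} (i : Fin (suc p)) → toℕ i ≡ p → toℕ (next i) ≡ 0
next-last {p} i e = trans (toℕ-next i) (trans (cong (λ k → suc k % suc p) e) (n%n≡0 (suc p)))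

next-injective : ∀ {p} {i j : Fin p} → next i ≡ next j → i ≡ j
next-injective {suc p} {i} {j} e
  with ℕ.m<1+n⇒m<n∨m≡n (Fin.toℕ<n i) | ℕ.m<1+n⇒m<n∨m≡n (Fin.toℕ<n j)
... | inj₁ i<p | inj₁ j<p = Fin.toℕ-injective (ℕ.suc-injective
        (trans (sym (next-< i i<p)) (trans (cong toℕ e) (next-< j j<p))))
... | inj₁ i<p | inj₂ j≡p = contradiction (trans (sym (next-< i i<p)) (trans (cong toℕ e) (next-last j j≡p))) λ ()
... | inj₂ i≡p | inj₁ j<p = contradiction (trans (sym (next-last i i≡p)) (trans (cong toℕ e) (next-< j j<p))) λ ()
... | inj₂ i≡p | inj₂ j≡p = Fin.toℕ-injective (trans i≡p (sym j≡p))

shift : ∀ {p} → Fin p → ℕ → Fin p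
shift i zero    = i
shift i (suc k) = next (shift i k)

shift-+ : ∀ {p} (i : Fin p) k l → shift (shift i k) l ≡ shift i (l + k)
shift-+ i k zero    = refl
shift-+ i k (suc l) = cong next (shift-+ i k l)

shift-injectiveʳ : ∀ {p} {i j : Fin p} k → shift i k ≡ shift j k → i ≡ j
shift-injectiveʳ zero    e = e
shift-injectiveʳ (suc k) e = shift-injectiveʳ k (next-injective e)

suc-% : ∀ m p → suc (m % suc p) % suc p ≡ suc m % suc p
suc-% m p = trans (sym ([m+kn]%n≡m%n (suc (m % suc p)) (m / suc p) (suc p)))
  (cong (λ k → suc k % suc p) (sym (m≡m%n+[m/n]*n m (suc p))))

toℕ-shift : ∀ {p} (i : Fin (suc p)) k → toℕ (shift i k) ≡ (toℕ i + k) % suc p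
toℕ-shift {p} i zero = sym (trans (cong (_% suc p) (ℕ.+-identityʳ (toℕ i))) (m<n⇒m%n≡m (Fin.toℕ<n i)))
toℕ-shift {p} i (suc k) = trans (toℕ-next (shift i k)) (trans
  (cong (λ m → suc m % suc p) (toℕ-shift i k))
  (trans (suc-% (toℕ i + k) p) (cong (_% suc p) (sym (ℕ.+-suc (toℕ i) k)))))

shift-period : ∀ {p} (i : Fin p) → shift i p ≡ i
shift-period {suc p} i = Fin.toℕ-injective (trans (toℕ-shift i (suc p))
  (trans ([m+n]%n≡m%n (toℕ i) (suc p)) (m<n⇒m%n≡m (Fin.toℕ<n i))))

shift-aperiodic : ∀ {p} (i : Fin p) k → 0 < k → k < p → shift i k ≢ i
shift-aperiodic {suc p} i k 0<k k<p e with toℕ i + k ℕ.<? suc p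
... | yes small = ℕ.<-irrefl (sym (ℕ.+-cancelˡ-≡ (toℕ i) k 0
        (trans (sym (m<n⇒m%n≡m small)) (trans (trans (sym (toℕ-shift i k)) (cong toℕ e)) (sym (ℕ.+-identityʳ _)))))) 0<k
... | no large = ℕ.<-irrefl (ℕ.+-cancelˡ-≡ (toℕ i) k (suc p)
        (trans (sym (ℕ.m∸n+n≡m (ℕ.≮⇒≥ large))) (cong (_+ suc p) reduced))) k<p
  where
  reduced : toℕ i + k ℕ.∸ suc p ≡ toℕ i
  reduced = trans (sym (m<n⇒m%n≡m (ℕ.+-cancelʳ-< (suc p) _ (suc p)
      (subst (_< suc p + suc p) (sym (ℕ.m∸n+n≡m (ℕ.≮⇒≥ large))) (ℕ.+-mono-< (Fin.toℕ<n i) k<p)))))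
    (trans (m≤n⇒[n∸m]%m≡n%m (ℕ.≮⇒≥ large)) (trans (sym (toℕ-shift i k)) (cong toℕ e)))

shift-injective : ∀ {p} (i : Fin p) {k l} → k < p → l < p → shift i k ≡ shift i l → k ≡ l
shift-injective i {k} {l} k<p l<p e with ℕ.<-cmp k l
... | tri≈ _ k≡l _ = k≡l
... | tri< k<l _ _ = contradiction (shift-injectiveʳ k
        (trans (shift-+ i (l ℕ.∸ k) k) (trans (cong (shift i) (ℕ.m+[n∸m]≡n (ℕ.<⇒≤ k<l))) (sym e))))
      (shift-aperiodic i (l ℕ.∸ k) (ℕ.m<n⇒0<n∸m k<l) (ℕ.≤-<-trans (ℕ.m∸n≤m l k) l<p))
... | tri> _ _ l<k = contradiction (shift-injectiveʳ l
        (trans (shift-+ i (k ℕ.∸ l) l) (trans (cong (shift i) (ℕ.m+[n∸m]≡n (ℕ.<⇒≤ l<k))) e)))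
      (shift-aperiodic i (k ℕ.∸ l) (ℕ.m<n⇒0<n∸m l<k) (ℕ.≤-<-trans (ℕ.m∸n≤m k l) k<p))

shift-surjective : ∀ {p} (i j : Fin p) → ∃ λ k → k < p × shift i k ≡ j
shift-surjective {p} i j =
  let k , e = injective⇒surjective {p} (λ k → shift i (toℕ k))
                (λ e → Fin.toℕ-injective (shift-injective i (Fin.toℕ<n _) (Fin.toℕ<n _) e)) j
  in toℕ k , Fin.toℕ<n k , e

previous : ∀ {p} (i : Fin p) → ∃ λ j → next j ≡ i
previous {suc p} i = shift i p , shift-period i

SameEdge : ∀ {V : Set} → V → V → V → V → Set
SameEdge u v x y = (u ≡ x × v ≡ y) ⊎ (u ≡ y × v ≡ x)

module _ {V : Set} {G : Graph V} where
  open Graph G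

  edge-sym : ∀ (O : Cycle G) {u v} → EdgeOf O u v → EdgeOf O v u
  edge-sym O (i , inj₁ p) = i , inj₂ p
  edge-sym O (i , inj₂ p) = i , inj₁ p

  edge-transport : ∀ (O : Cycle G) {x y u v} → SameEdge x y u v → EdgeOf O x y → EdgeOf O u v
  edge-transport O (inj₁ (refl , refl)) e = e
  edge-transport O (inj₂ (refl , refl)) e = edge-sym O e

  edge⇒∈ˡ : ∀ (O : Cycle G) {u v} → EdgeOf O u v → u ∈ O
  edge⇒∈ˡ O (i , inj₁ (p , _)) = i , p
  edge⇒∈ˡ O (i , inj₂ (_ , p)) = next i , p

  edge⇒∈ʳ : ∀ (O : Cycle G) {u v} → EdgeOf O u v → v ∈ O
  edge⇒∈ʳ O = edge⇒∈ˡ O ∘ edge-sym O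

  edge⇒adjacent : ∀ (O : Cycle G) {u v} → EdgeOf O u v → u ~ v
  edge⇒adjacent O (i , inj₁ (refl , refl)) = Cycle.adjacent O i
  edge⇒adjacent O (i , inj₂ (refl , refl)) = symm (Cycle.adjacent O i)

  neighbour : ∀ (O : Cycle G) i {j v} → next j ≡ i → EdgeOf O (at O i) v → v ≡ at O (next i) ⊎ v ≡ at O j
  neighbour O i e (k , inj₁ (p , q)) rewrite Cycle.injective O p = inj₁ (sym q)
  neighbour O i {j} e (k , inj₂ (p , q)) = inj₂ (trans (sym p)
    (cong (at O) (next-injective (trans (Cycle.injective O q) (sym e)))))

  -- If the two readings were opposite, two steps of `next` would fix `j`, which an order of at
  -- least 3 forbids.
  edge-index-unique : ∀ (O : Cycle G) i j → SameEdge (at O i) (at O (next i)) (at O j) (at O (next j)) → i ≡ j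
  edge-index-unique O i j (inj₁ (p , _)) = Cycle.injective O p
  edge-index-unique O i j (inj₂ (p , q)) = contradiction
    (trans (cong next (sym (Cycle.injective O p))) (Cycle.injective O q))
    (shift-aperiodic j 2 (s≤s z≤n) (Cycle.order≥3 O))

  next≢previous : ∀ (O : Cycle G) {i j} → next j ≡ i → at O (next i) ≢ at O j
  next≢previous O {j = j} refl e = shift-aperiodic j 2 (s≤s z≤n) (Cycle.order≥3 O) (Cycle.injective O e)

  -- A cycle without one edge is a path through all its vertices: starting behind that edge, `next`
  -- reaches each of them before the edge recurs. `R` is left open to serve both for cut graphs and
  -- for lists of edges.
  bypass : ∀ (O : Cycle G) {u v} {R : Rel V 0ℓ} → EdgeOf O u v → Symmetric R →
    (∀ {x y} → EdgeOf O x y → ¬ SameEdge x y u v → R x y) →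
    ∀ {x y} → x ∈ O → y ∈ O → Star R x y
  bypass O {u} {v} {R} uv R-sym h (i , refl) (j , refl) = Star.reverse R-sym (to i) ◅◅ to j
    where
    e : Fin (order O)
    e = proj₁ uv
    along : ∀ k → suc k ≤ order O → Star R (at O (next e)) (at O (shift (next e) k))
    along zero _ = ε
    along (suc k) k<p = along k (ℕ.<⇒≤ k<p) ◅◅ h (shift (next e) k , inj₁ (refl , refl)) differs ◅ ε
      where
      -- The index `e` would recur only after a full turn, and `k + 1` steps are fewer.
      differs : ¬ SameEdge (at O (shift (next e) k)) (at O (shift (next e) (suc k))) u v
      differs s = contradiction
        (trans (sym (shift-+ e 1 k)) (trans (edge-index-unique O (shift (next e) k) e (reorient (proj₂ uv) s)) refl))
        (shift-aperiodic e (k + 1) (ℕ.≤-trans (s≤s z≤n) (ℕ.m≤n+m 1 k)) (subst (_< order O) (ℕ.+-comm 1 k) k<p))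
        where
        reorient : ∀ {x y} → (at O e ≡ u × at O (next e) ≡ v) ⊎ (at O e ≡ v × at O (next e) ≡ u) →
          SameEdge x y u v → SameEdge x y (at O e) (at O (next e))
        reorient (inj₁ (p , q)) (inj₁ (p′ , q′)) = inj₁ (trans p′ (sym p) , trans q′ (sym q))
        reorient (inj₁ (p , q)) (inj₂ (p′ , q′)) = inj₂ (trans p′ (sym q) , trans q′ (sym p))
        reorient (inj₂ (p , q)) (inj₁ (p′ , q′)) = inj₂ (trans p′ (sym q) , trans q′ (sym p))
        reorient (inj₂ (p , q)) (inj₂ (p′ , q′)) = inj₁ (trans p′ (sym p) , trans q′ (sym q))
    to : ∀ j → Star R (at O (next e)) (at O j)
    to j with shift-surjective (next e) j
    ... | k , k<p , refl = along k k<p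

swap-edge : ∀ {V : Set} {x y u v : V} → SameEdge y x u v → SameEdge x y u v
swap-edge (inj₁ (p , q)) = inj₂ (q , p)
swap-edge (inj₂ (p , q)) = inj₁ (q , p)

-- Tight graphs: chords, common vertices and detours of cycles

module _ {V : Set} (G : Graph V) where
  open Graph G

  Cut : V → V → V → Rel V 0ℓ
  Cut u b c x y = x ~ y × ¬ SameEdge x y u b × ¬ SameEdge x y u c

  Cut-sym : ∀ {u b c} → Symmetric (Cut u b c)
  Cut-sym (e , p , q) = symm e , p ∘ swap-edge , q ∘ swap-edge

  Tight : Set
  Tight = ∀ {u b c} → u ~ b → u ~ c → b ≢ c → Star (Cut u b c) u b → Star (Cut u b c) u c → ⊥

module _ {n : ℕ} {G : Graph (Fin n)} where
  open Graph G

  edgeOf? : ∀ (O : Cycle G) u v → Dec (EdgeOf O u v)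
  edgeOf? O u v = Fin.any? λ i →
    ((at O i Fin.≟ u) ×-dec (at O (next i) Fin.≟ v)) ⊎-dec
    ((at O i Fin.≟ v) ×-dec (at O (next i) Fin.≟ u))

  _∈?_ : ∀ u (O : Cycle G) → Dec (u ∈ O)
  u ∈? O = Fin.any? λ i → at O i Fin.≟ u

  module _ (tight : Tight G) where

    -- A chord `xy` and a cycle edge at `x` could be deleted together: the rest of `O` is a path
    -- that still links `x` to both other ends.
    no-chord : ∀ (O : Cycle G) {x y} → x ∈ O → y ∈ O → x ~ y → EdgeOf O x y
    no-chord O {x} {y} (i , refl) y∈O x~y with edgeOf? O x y
    ... | yes e = e
    ... | no ¬e = contradiction (tight x~y (Cycle.adjacent O i) (λ { refl → ¬e xc }) (path y∈O) (path (next i , refl))) λ ()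
      where
      xc : EdgeOf O x (at O (next i))
      xc = i , inj₁ (refl , refl)
      path : ∀ {z} → z ∈ O → Star (Cut G x y (at O (next i))) x z
      path = bypass O xc (Cut-sym G) (λ e ne → edge⇒adjacent O e
        , (λ s → ¬e (edge-transport O s e)) , ne) (i , refl)

    -- If `O′` lacks `ub`, one of its two edges at `u`, say `uc`, is not in `O`, because `O` has
    -- only two edges at `u` and one of them is `ub`. Then `ub` is bypassed along `O` and `uc` along
    -- `O′`, neither path using the other edge.
    common-edge : ∀ (O O′ : Cycle G) {u b} → u ∈ O′ → EdgeOf O u b → EdgeOf O′ u b
    common-edge O O′ {u} {b} (j , refl) ub with edgeOf? O′ u b
    ... | yes e = e
    ... | no ¬e = contradiction (cut third) λ ()
      where
      k : Fin (order O′)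
      k = proj₁ (previous j)
      next-edge : EdgeOf O′ u (at O′ (next j))
      next-edge = j , inj₁ (refl , refl)
      prev-edge : EdgeOf O′ u (at O′ k)
      prev-edge = k , inj₂ (refl , cong (at O′) (proj₂ (previous j)))
      third : ∃ λ c → EdgeOf O′ u c × ¬ EdgeOf O u c
      third with edgeOf? O u (at O′ (next j)) | edgeOf? O u (at O′ k)
      ... | no ¬p | _ = _ , next-edge , ¬p
      ... | yes _ | no ¬q = _ , prev-edge , ¬q
      ... | yes p | yes q with edge⇒∈ˡ O ub
      ... | i , i≡ with neighbour O i (proj₂ (previous i)) (subst (λ v → EdgeOf O v _) (sym i≡) ub)
                      | neighbour O i (proj₂ (previous i)) (subst (λ v → EdgeOf O v _) (sym i≡) p)
                      | neighbour O i (proj₂ (previous i)) (subst (λ v → EdgeOf O v _) (sym i≡) q)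
      ... | inj₁ x | inj₁ y | _ = contradiction (subst (EdgeOf O′ u) (trans y (sym x)) next-edge) ¬e
      ... | inj₁ x | inj₂ y | inj₁ z = contradiction (subst (EdgeOf O′ u) (trans z (sym x)) prev-edge) ¬e
      ... | inj₁ x | inj₂ y | inj₂ z = contradiction (trans y (sym z)) (next≢previous O′ (proj₂ (previous j)))
      ... | inj₂ x | inj₂ y | _ = contradiction (subst (EdgeOf O′ u) (trans y (sym x)) next-edge) ¬e
      ... | inj₂ x | inj₁ y | inj₂ z = contradiction (subst (EdgeOf O′ u) (trans z (sym x)) prev-edge) ¬e
      ... | inj₂ x | inj₁ y | inj₁ z = contradiction (trans y (sym z)) (next≢previous O′ (proj₂ (previous j)))
      cut : (∃ λ c → EdgeOf O′ u c × ¬ EdgeOf O u c) → ⊥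
      cut (c , uc , ¬uc) = tight (edge⇒adjacent O ub) (edge⇒adjacent O′ uc) (λ { refl → ¬uc ub })
        (bypass O ub (Cut-sym G) (λ e ne → edge⇒adjacent O e , ne , λ s → ¬uc (edge-transport O s e))
          (edge⇒∈ˡ O ub) (edge⇒∈ʳ O ub))
        (bypass O′ uc (Cut-sym G) (λ e ne → edge⇒adjacent O′ e , (λ s → ¬e (edge-transport O′ s e)) , ne)
          (edge⇒∈ˡ O′ uc) (edge⇒∈ʳ O′ uc))

    common-vertex⇒⊆ : ∀ (O O′ : Cycle G) {u} → u ∈ O → u ∈ O′ → ∀ {v} → v ∈ O → v ∈ O′
    common-vertex⇒⊆ O O′ (i , refl) u∈O′ (j , refl) with shift-surjective i j
    ... | k , _ , refl = go k
      where
      go : ∀ k → at O (shift i k) ∈ O′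
      go zero    = u∈O′
      go (suc k) = edge⇒∈ʳ O′ (common-edge O O′ (go k) (shift i k , inj₁ (refl , refl)))

    common-vertex⇒same : ∀ (O O′ : Cycle G) {u} → u ∈ O → u ∈ O′ → SameCycle O O′
    common-vertex⇒same O O′ p q x y = mk⇔
      (λ e → common-edge O O′ (common-vertex⇒⊆ O O′ p q (edge⇒∈ˡ O e)) e)
      (λ e → common-edge O′ O (common-vertex⇒⊆ O′ O q p (edge⇒∈ˡ O′ e)) e)

    -- If the two exits differ, the edge `a₁b₁` and a cycle edge at `a₁` can be deleted together:
    -- `a₁` still reaches `b₁` along `O` to `a₂`, over to `b₂` and back along the walk.
    no-detour : ∀ (O : Cycle G) {a₁ a₂ b₁ b₂} → a₁ ∈ O → a₂ ∈ O → ¬ (b₁ ∈ O) → ¬ (b₂ ∈ O) →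
      a₁ ~ b₁ → a₂ ~ b₂ → Star (λ x y → x ~ y × ¬ (x ∈ O) × ¬ (y ∈ O)) b₁ b₂ → a₁ ≡ a₂ × b₁ ≡ b₂
    no-detour O {a₁} {a₂} {b₁} {b₂} (i , refl) a₂∈O b₁∉O b₂∉O e₁ e₂ walk =
      decidable-stable ((a₁ Fin.≟ a₂) ×-dec (b₁ Fin.≟ b₂)) λ ne →
        tight e₁ (Cycle.adjacent O i) (λ { refl → b₁∉O c∈O })
          (along a₂∈O ◅◅ (e₂ , other ne , λ { (inj₁ (_ , refl)) → b₂∉O c∈O ; (inj₂ (_ , refl)) → b₂∉O (i , refl) })
            ◅ Star.reverse (Cut-sym G) (Star.map avoids-O walk))
          (along c∈O)
      where
      c∈O : at O (next i) ∈ O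
      c∈O = next i , refl
      other : ¬ (a₁ ≡ a₂ × b₁ ≡ b₂) → ¬ SameEdge a₂ b₂ a₁ b₁
      other ne (inj₁ (p , q)) = ne (sym p , sym q)
      other ne (inj₂ (refl , _)) = b₁∉O a₂∈O
      avoids-O : ∀ {x y} → x ~ y × ¬ (x ∈ O) × ¬ (y ∈ O) → Cut G a₁ b₁ (at O (next i)) x y
      avoids-O (e , x∉O , y∉O) = e
        , (λ { (inj₁ (refl , _)) → x∉O (i , refl) ; (inj₂ (_ , refl)) → y∉O (i , refl) })
        , (λ { (inj₁ (refl , _)) → x∉O (i , refl) ; (inj₂ (_ , refl)) → y∉O (i , refl) })
      along : ∀ {z} → z ∈ O → Star (Cut G a₁ b₁ (at O (next i))) a₁ z
      along = bypass O (i , inj₁ (refl , refl)) (Cut-sym G)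
        (λ e ne → edge⇒adjacent O e
          , (λ { (inj₁ (refl , refl)) → b₁∉O (edge⇒∈ʳ O e) ; (inj₂ (refl , refl)) → b₁∉O (edge⇒∈ˡ O e) })
          , ne) (i , refl)

-- Simple paths and the cycles they close

last : {A : Set} → A → List A → A
last x []       = x
last x (y ∷ ys) = last y ys

module _ {n : ℕ} {R : Rel (Fin n) 0ℓ} where

  record SimplePath (u v : Fin n) : Set where
    field
      rest   : List (Fin n)
      linked : Linked R (u ∷ rest)
      unique : AllPairs _≢_ (u ∷ rest)
      ends   : last u rest ≡ v

  private
    suffix : ∀ {u w v xs} → u ∈ˡ (w ∷ xs) → Linked R (w ∷ xs) → AllPairs _≢_ (w ∷ xs) → last w xs ≡ v → SimplePath u v
    suffix (here refl) l un e = record { linked = l ; unique = un ; ends = e }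
    suffix {xs = x ∷ xs} (there p) (_ ∷ l) (_ ∷ un) e = suffix p l un e

  simplePath : ∀ {u v} → Star R u v → SimplePath u v
  simplePath ε = record { rest = [] ; linked = [-] ; unique = [] ∷ [] ; ends = refl }
  simplePath {u} (_◅_ {j = w} r s) with simplePath s
  ... | record { rest = xs ; linked = l ; unique = un ; ends = e } with Any.any? (u Fin.≟_) (w ∷ xs)
  ... | yes p = suffix p l un e
  ... | no ¬p = record { rest = w ∷ xs ; linked = r ∷ l ; unique = All.¬Any⇒All¬ (w ∷ xs) ¬p ∷ un ; ends = e }

lookup-injective : ∀ {A : Set} {xs : List A} → AllPairs _≢_ xs → ∀ {i j} → lookup xs i ≡ lookup xs j → i ≡ j
lookup-injective (px ∷ _) {Fin.zero} {Fin.zero} _ = refl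
lookup-injective (px ∷ _) {Fin.zero} {Fin.suc j} e = contradiction e (All.lookup px (∈ˡ.∈-lookup j))
lookup-injective (px ∷ _) {Fin.suc i} {Fin.zero} e = contradiction (sym e) (All.lookup px (∈ˡ.∈-lookup i))
lookup-injective (_ ∷ pxs) {Fin.suc i} {Fin.suc j} e = cong Fin.suc (lookup-injective pxs e)

lookup-linked : ∀ {A : Set} {R : Rel A 0ℓ} {xs : List A} → Linked R xs → ∀ i j → toℕ j ≡ suc (toℕ i) →
  R (lookup xs i) (lookup xs j)
lookup-linked (r ∷ _) Fin.zero (Fin.suc Fin.zero) refl = r
lookup-linked (_ ∷ l) (Fin.suc i) (Fin.suc j) e = lookup-linked l i j (ℕ.suc-injective e)

lookup-last : ∀ {A : Set} (x : A) xs i → toℕ i ≡ length xs → lookup (x ∷ xs) i ≡ last x xs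
lookup-last x [] Fin.zero _ = refl
lookup-last x (y ∷ ys) (Fin.suc i) e = lookup-last y ys i (ℕ.suc-injective e)

module _ {n : ℕ} {G : Graph (Fin n)} where
  open Graph G

  -- The walk is shortened to a simple path, which `t` closes from outside `W`. Since `b₁` and `b₂`
  -- differ, the path has at least two vertices and the order is at least 3.
  cycle-through : ∀ (W : Fin n → Set) {t b₁ b₂} → ¬ W t → W b₁ → b₁ ≢ b₂ → t ~ b₁ → t ~ b₂ →
    Star (λ x y → x ~ y × W x × W y) b₁ b₂ → ∃ λ (O : Cycle G) → t ∈ O × (∀ {v} → v ∈ O → v ≡ t ⊎ W v)
  cycle-through W {t} {b₁} {b₂} ¬Wt Wb₁ b₁≢b₂ e₁ e₂ walk with simplePath walk
  ... | record { rest = [] ; ends = b₁≡b₂ } = contradiction b₁≡b₂ b₁≢b₂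
  ... | record { rest = x ∷ xs ; linked = l ; unique = un ; ends = ends } = O , (Fin.zero , refl) , λ { (i , refl) → inside-W i }
    where
    vertices : List (Fin n)
    vertices = b₁ ∷ x ∷ xs
    All-W : ∀ {y ys} → W y → Linked (λ x y → x ~ y × W x × W y) (y ∷ ys) → All W (y ∷ ys)
    All-W wy [-] = wy ∷ []
    All-W wy ((_ , _ , wz) ∷ l) = wy ∷ All-W wz l
    all-W : All W vertices
    all-W = All-W Wb₁ l
    inside-W : ∀ i → lookup (t ∷ vertices) i ≡ t ⊎ W (lookup (t ∷ vertices) i)
    inside-W Fin.zero = inj₁ refl
    inside-W (Fin.suc i) = inj₂ (All.lookup all-W (∈ˡ.∈-lookup i))
    linked-t : Linked _~_ (t ∷ vertices)
    linked-t = e₁ ∷ linked-map l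
      where
      linked-map : ∀ {ys} → Linked (λ x y → x ~ y × W x × W y) ys → Linked _~_ ys
      linked-map [] = []
      linked-map [-] = [-]
      linked-map ((e , _) ∷ l) = e ∷ linked-map l
    O : Cycle G
    O = record
      { order = length (t ∷ vertices)
      ; order≥3 = s≤s (s≤s (s≤s z≤n))
      ; at = lookup (t ∷ vertices)
      ; injective = lookup-injective (All.map (λ { wy refl → ¬Wt wy }) all-W ∷ un)
      ; adjacent = adj
      }
      where
      adj : ∀ i → lookup (t ∷ vertices) i ~ lookup (t ∷ vertices) (next i)
      adj i with ℕ.m<1+n⇒m<n∨m≡n (Fin.toℕ<n i)
      ... | inj₁ i< = lookup-linked linked-t i (next i) (next-< i i<)
      ... | inj₂ i≡ = subst₂ _~_ (sym (trans (lookup-last t vertices i i≡) ends))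
              (cong (lookup (t ∷ vertices)) (sym (Fin.toℕ-injective {j = Fin.zero} (next-last i i≡)))) (symm e₂)

-- Spanning forests and sets meeting all cycles

module _ {n : ℕ} where

  Edges : Set
  Edges = List (Fin n × Fin n)

  Joins : Edges → Rel (Fin n) 0ℓ
  Joins L u v = (u , v) ∈ˡ L ⊎ (v , u) ∈ˡ L

  Linked-by : Edges → Rel (Fin n) 0ℓ
  Linked-by L = Star (Joins L)

  linked-sym : ∀ {L} → Symmetric (Linked-by L)
  linked-sym = Star.reverse swap

  split-at-edge : ∀ {x y L a b} → Linked-by ((x , y) ∷ L) a b →
    Linked-by L a b ⊎ (Linked-by L a x × Linked-by L y b) ⊎ (Linked-by L a y × Linked-by L x b)
  split-at-edge ε = inj₁ ε
  split-at-edge {x} {y} {L} {b = b} (_◅_ {j = w} e s) = step e (split-at-edge s)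
    where
    step : ∀ {a} → Joins ((x , y) ∷ L) a w →
      Linked-by L w b ⊎ (Linked-by L w x × Linked-by L y b) ⊎ (Linked-by L w y × Linked-by L x b) →
      Linked-by L a b ⊎ (Linked-by L a x × Linked-by L y b) ⊎ (Linked-by L a y × Linked-by L x b)
    step (inj₁ (there e)) (inj₁ p) = inj₁ (inj₁ e ◅ p)
    step (inj₁ (there e)) (inj₂ (inj₁ (p , q))) = inj₂ (inj₁ (inj₁ e ◅ p , q))
    step (inj₁ (there e)) (inj₂ (inj₂ (p , q))) = inj₂ (inj₂ (inj₁ e ◅ p , q))
    step (inj₂ (there e)) (inj₁ p) = inj₁ (inj₂ e ◅ p)
    step (inj₂ (there e)) (inj₂ (inj₁ (p , q))) = inj₂ (inj₁ (inj₂ e ◅ p , q))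
    step (inj₂ (there e)) (inj₂ (inj₂ (p , q))) = inj₂ (inj₂ (inj₂ e ◅ p , q))
    step (inj₁ (here refl)) (inj₁ p) = inj₂ (inj₁ (ε , p))
    step (inj₁ (here refl)) (inj₂ (inj₁ (p , q))) = inj₂ (inj₁ (ε , q))
    step (inj₁ (here refl)) (inj₂ (inj₂ (p , q))) = inj₁ q
    step (inj₂ (here refl)) (inj₁ p) = inj₂ (inj₂ (ε , p))
    step (inj₂ (here refl)) (inj₂ (inj₁ (p , q))) = inj₁ q
    step (inj₂ (here refl)) (inj₂ (inj₂ (p , q))) = inj₂ (inj₂ (ε , q))

  -- Dropping an edge separates at most one of its ends from all representatives; adding that end to
  -- them trades the edge for one unit of `s`. Without edges every vertex is its own representative.
  components-≥ : ∀ L {s} (rep : Fin s → Fin n) → (∀ a → ∃ λ i → Linked-by L a (rep i)) → n ≤ s + length L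
  components-≥ [] {s} rep covers = subst (n ≤_) (sym (ℕ.+-identityʳ s))
    (Fin.injective⇒≤ {f = proj₁ ∘ covers} λ {a} {b} e →
      trans (trivial (proj₂ (covers a))) (trans (cong rep e) (sym (trivial (proj₂ (covers b))))))
    where
    trivial : ∀ {a b} → Linked-by [] a b → a ≡ b
    trivial ε = refl
    trivial (inj₁ () ◅ _)
    trivial (inj₂ () ◅ _)
  components-≥ ((x , y) ∷ L) {s} rep covers = subst (n ≤_) (sym (ℕ.+-suc s (length L))) (cases (proj₂ (covers x)))
    where
    cons : Fin n → Fin (suc s) → Fin n
    cons z Fin.zero    = z
    cons z (Fin.suc i) = rep i
    x-linked : ∀ i → Linked-by L x (rep i) → n ≤ suc s + length L
    x-linked i₀ x~ = components-≥ L (cons y) λ a → case split-at-edge (proj₂ (covers a)) of λ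
      { (inj₁ p) → Fin.suc (proj₁ (covers a)) , p
      ; (inj₂ (inj₁ (p , _))) → Fin.suc i₀ , p ◅◅ x~
      ; (inj₂ (inj₂ (p , _))) → Fin.zero , p }
    y-linked : ∀ i → Linked-by L y (rep i) → n ≤ suc s + length L
    y-linked i₀ y~ = components-≥ L (cons x) λ a → case split-at-edge (proj₂ (covers a)) of λ
      { (inj₁ p) → Fin.suc (proj₁ (covers a)) , p
      ; (inj₂ (inj₁ (p , _))) → Fin.zero , p
      ; (inj₂ (inj₂ (p , _))) → Fin.suc i₀ , p ◅◅ y~ }
    cases : ∀ {i} → Linked-by ((x , y) ∷ L) x (rep i) → n ≤ suc s + length L
    cases p with split-at-edge p
    ... | inj₁ q = x-linked _ q
    ... | inj₂ (inj₁ (_ , q)) = y-linked _ q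
    ... | inj₂ (inj₂ (_ , q)) = x-linked _ q

  module _ (G : Graph (Fin n)) where
    open Graph G

    -- Kruskal: an edge is kept in F unless its ends are already linked by F.
    spanning-forest : ∀ L → ¬ ¬ (∃ λ F → ∃ λ R → length F + length R ≡ length L
      × (∀ {u v} → Joins L u v → Linked-by F u v)
      × (∀ {e} → e ∈ˡ L → e ∈ˡ F ⊎ e ∈ˡ R)
      × (∀ (O : Cycle G) → ¬ (∀ {u v} → EdgeOf O u v → Joins F u v)))
    spanning-forest [] = pure ([] , [] , refl , (λ { (inj₁ ()) ; (inj₂ ()) }) , (λ ()) , no-cycle)
      where
      no-cycle : ∀ (O : Cycle G) → ¬ (∀ {u v} → EdgeOf O u v → Joins [] u v)
      no-cycle O h with h (Fin.fromℕ< (Cycle.order≥3 O) , inj₁ (refl , refl))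
      ... | inj₁ ()
      ... | inj₂ ()
    spanning-forest ((x , y) ∷ L) = do
      (F , R , count , linked , cover , acyclic) ← spanning-forest L
      no ¬xy ← em (Linked-by F x y)
        where yes xy → pure ( F , (x , y) ∷ R , trans (ℕ.+-suc (length F) (length R)) (cong suc count)
                            , (λ { (inj₁ (here refl)) → xy ; (inj₂ (here refl)) → linked-sym xy
                                 ; (inj₁ (there e)) → linked (inj₁ e) ; (inj₂ (there e)) → linked (inj₂ e) })
                            , (λ { (here refl) → inj₂ (here refl)
                                 ; (there e) → [ inj₁ , inj₂ ∘ there ]′ (cover e) })
                            , acyclic)
      let weaken : ∀ {u v} → Linked-by F u v → Linked-by ((x , y) ∷ F) u v
          weaken = Star.map [ inj₁ ∘ there , inj₂ ∘ there ]′
      pure ( (x , y) ∷ F , R , cong suc count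
           , (λ { (inj₁ (here refl)) → inj₁ (here refl) ◅ ε ; (inj₂ (here refl)) → inj₂ (here refl) ◅ ε
                ; (inj₁ (there e)) → weaken (linked (inj₁ e)) ; (inj₂ (there e)) → weaken (linked (inj₂ e)) })
           , (λ { (here refl) → inj₁ (here refl)
                ; (there e) → [ inj₁ ∘ there , inj₂ ]′ (cover e) })
           , extend F ¬xy acyclic)
      where
      extend : ∀ F → ¬ Linked-by F x y → (∀ (O : Cycle G) → ¬ (∀ {u v} → EdgeOf O u v → Joins F u v)) →
        ∀ (O : Cycle G) → ¬ (∀ {u v} → EdgeOf O u v → Joins ((x , y) ∷ F) u v)
      extend F ¬xy acyclic O h with edgeOf? O x y
      -- The rest of a cycle through the new edge would already link `x` and `y` in `F`.
      ... | yes xy = ¬xy (bypass O xy swap others (edge⇒∈ˡ O xy) (edge⇒∈ʳ O xy))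
        where
        others : ∀ {u v} → EdgeOf O u v → ¬ SameEdge u v x y → Joins F u v
        others e ne with h e
        ... | inj₁ (here refl) = contradiction (inj₁ (refl , refl)) ne
        ... | inj₂ (here refl) = contradiction (inj₂ (refl , refl)) ne
        ... | inj₁ (there p) = inj₁ p
        ... | inj₂ (there p) = inj₂ p
      ... | no ¬xy′ = acyclic O λ e → strengthen e (h e)
        where
        strengthen : ∀ {u v} → EdgeOf O u v → Joins ((x , y) ∷ F) u v → Joins F u v
        strengthen e (inj₁ (here refl)) = contradiction e ¬xy′
        strengthen e (inj₂ (here refl)) = contradiction (edge-sym O e) ¬xy′
        strengthen e (inj₁ (there p)) = inj₁ p
        strengthen e (inj₂ (there p)) = inj₂ p

    Hits : List (Fin n) → Cycle G → Set
    Hits X O = ¬ (∀ v → v ∈ O → v ∉ˡ X)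

    hitting-set : ∀ L → (∀ {u v} → u ~ v → Linked-by L u v) →
      ¬ ¬ (∃ λ X → n + length X ≤ length L + componentCount G
        × (∀ O → (∀ {u v} → EdgeOf O u v → Joins L u v) → Hits X O))
    hitting-set L connects = do
      (F , R , count , linked , cover , acyclic) ← spanning-forest L
      pure ( List.map proj₁ R
           , bound F R count (components-≥ F (Transversal.rep (components G))
               λ a → let i , s = Transversal.covers (components G) a
                     in i , Star.concat (Star.map linked (Star.concat (Star.map connects s))))
           , λ O h avoid → acyclic O λ e → avoiding F R cover O avoid e (h e))
      where
      bound : ∀ F R → length F + length R ≡ length L → n ≤ componentCount G + length F →
        n + length (List.map proj₁ R) ≤ length L + componentCount G
      bound F R count n≤ = begin
        n + length (List.map proj₁ R)              ≡⟨ cong (n +_) (List.length-map proj₁ R) ⟩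
        n + length R                               ≤⟨ ℕ.+-monoˡ-≤ (length R) n≤ ⟩
        componentCount G + length F + length R     ≡⟨ ℕ.+-assoc (componentCount G) (length F) (length R) ⟩
        componentCount G + (length F + length R)   ≡⟨ ℕ.+-comm (componentCount G) (length F + length R) ⟩
        length F + length R + componentCount G     ≡⟨ cong (_+ componentCount G) count ⟩
        length L + componentCount G                ∎
        where open ℕ.≤-Reasoning
      avoiding : ∀ F R → (∀ {e} → e ∈ˡ L → e ∈ˡ F ⊎ e ∈ˡ R) → ∀ (O : Cycle G) →
        (∀ v → v ∈ O → v ∉ˡ List.map proj₁ R) → ∀ {u v} → EdgeOf O u v → Joins L u v → Joins F u v
      avoiding F R cover O avoid e (inj₁ p) with cover p
      ... | inj₁ q = inj₁ q
      ... | inj₂ q = contradiction (∈ˡ.∈-map⁺ proj₁ q) (avoid _ (edge⇒∈ˡ O e))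
      avoiding F R cover O avoid e (inj₂ p) with cover p
      ... | inj₁ q = inj₂ q
      ... | inj₂ q = contradiction (∈ˡ.∈-map⁺ proj₁ q) (avoid _ (edge⇒∈ʳ O e))

    -- Spelled as in `edgeCount`, whose value is then `length edges` by definition.
    edges : Edges
    edges = filter (λ e → (proj₁ e Fin.<? proj₂ e) ×-dec (proj₁ e ~? proj₂ e))
                   (cartesianProduct (allFin n) (allFin n))

    adjacent⇒edge : ∀ {u v} → u ~ v → Joins edges u v
    adjacent⇒edge {u} {v} e with Fin.<-cmp u v
    ... | tri< u<v _ _ = inj₁ (∈ˡ.∈-filter⁺ _ (∈ˡ.∈-cartesianProduct⁺ (∈ˡ.∈-allFin u) (∈ˡ.∈-allFin v)) (u<v , e))
    ... | tri≈ _ refl _ = contradiction e irrefl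
    ... | tri> _ _ v<u = inj₂ (∈ˡ.∈-filter⁺ _ (∈ˡ.∈-cartesianProduct⁺ (∈ˡ.∈-allFin v) (∈ˡ.∈-allFin u)) (v<u , symm e))

    sameEdge? : ∀ (u v x y : Fin n) → Dec (SameEdge u v x y)
    sameEdge? u v x y = ((u Fin.≟ x) ×-dec (v Fin.≟ y)) ⊎-dec ((u Fin.≟ y) ×-dec (v Fin.≟ x))

    remove-edge : Fin n → Fin n → Edges → Edges
    remove-edge x y = filter (λ e → ¬? (sameEdge? (proj₁ e) (proj₂ e) x y))

    remove-edge-length : ∀ {x y L} → Joins L x y → length (remove-edge x y L) < length L
    remove-edge-length {x} {y} {L} j = List.filter-notAll _ L (witness j)
      where
      witness : Joins L x y → Any.Any (λ e → ¬ ¬ SameEdge (proj₁ e) (proj₂ e) x y) L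
      witness (inj₁ p) = Any.map (λ { refl ¬s → ¬s (inj₁ (refl , refl)) }) p
      witness (inj₂ p) = Any.map (λ { refl ¬s → ¬s (inj₂ (refl , refl)) }) p

    remove-edge-keeps : ∀ {x y u v L} → Joins L u v → ¬ SameEdge u v x y → Joins (remove-edge x y L) u v
    remove-edge-keeps (inj₁ p) ne = inj₁ (∈ˡ.∈-filter⁺ _ p ne)
    remove-edge-keeps (inj₂ p) ne = inj₂ (∈ˡ.∈-filter⁺ _ p (ne ∘ swap-edge))

    hitting-set-all : ¬ ¬ (∃ λ X → n + length X ≤ edgeCount G + componentCount G × (∀ O → Hits X O))
    hitting-set-all = do
      (X , bound , hits) ← hitting-set edges (λ e → adjacent⇒edge e ◅ ε)
      pure (X , bound , λ O → hits O (adjacent⇒edge ∘ edge⇒adjacent O))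

    hitting-set-loose : ∀ {u b c} → u ~ b → u ~ c → b ≢ c → Star (Cut G u b c) u b → Star (Cut G u b c) u c →
      ¬ ¬ (∃ λ X → n + suc (length X) ≤ edgeCount G + componentCount G × (∀ O → Hits X O))
    hitting-set-loose {u} {b} {c} ub uc b≢c sb sc = do
      (X , bound , hits) ← hitting-set L connects
      pure ( u ∷ X
           , ℕ.≤-trans (ℕ.≤-reflexive (trans (ℕ.+-suc n _) (cong suc (ℕ.+-suc n (length X)))))
               (ℕ.≤-trans (s≤s (s≤s bound)) (ℕ.+-monoˡ-≤ (componentCount G) short))
           -- A cycle avoiding `u` uses neither removed edge, so all its edges are still in `L`.
           , λ O avoid → hits O
               (λ e → keeps (edge⇒adjacent O e
                  , away O (λ p → avoid _ p (here refl)) e , away O (λ p → avoid _ p (here refl)) e))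
               (λ v p q → avoid v p (there q)))
      where
      L₁ L : Edges
      L₁ = remove-edge u b edges
      L = remove-edge u c L₁
      uc≢ub : ¬ SameEdge u c u b
      uc≢ub (inj₁ (_ , c≡b)) = b≢c (sym c≡b)
      uc≢ub (inj₂ (refl , _)) = irrefl ub
      short : 2 + length L ≤ length edges
      short = ℕ.≤-trans (s≤s (remove-edge-length (remove-edge-keeps (adjacent⇒edge uc) uc≢ub)))
        (remove-edge-length (adjacent⇒edge ub))
      keeps : ∀ {x y} → Cut G u b c x y → Joins L x y
      keeps (e , p , q) = remove-edge-keeps (remove-edge-keeps (adjacent⇒edge e) p) q
      connects : ∀ {x y} → x ~ y → Linked-by L x y
      connects {x} {y} e with sameEdge? x y u b | sameEdge? x y u c
      ... | no p | no q = keeps (e , p , q) ◅ ε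
      ... | yes (inj₁ (refl , refl)) | _ = Star.map keeps sb
      ... | yes (inj₂ (refl , refl)) | _ = linked-sym (Star.map keeps sb)
      ... | no _ | yes (inj₁ (refl , refl)) = Star.map keeps sc
      ... | no _ | yes (inj₂ (refl , refl)) = linked-sym (Star.map keeps sc)
      away : ∀ (O : Cycle G) → ¬ (u ∈ O) → ∀ {x y z} → EdgeOf O x y → ¬ SameEdge x y u z
      away O u∉O e (inj₁ (refl , _)) = u∉O (edge⇒∈ˡ O e)
      away O u∉O e (inj₂ (_ , refl)) = u∉O (edge⇒∈ʳ O e)

-- Leaves of contracted graphs

-- An undecidable property becomes a finite set, whose size can serve as a measure for induction.
comprehension : ∀ {n} (P : Fin n → Set) →
  ¬ ¬ (∃ λ (D : Subset n) → (∀ {x} → x ∈ˢ D → P x) × (∀ {x} → P x → x ∈ˢ D))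
comprehension {zero} P = pure ([] , (λ {x} ()) , λ { {()} })
comprehension {suc n} P = do
  (D , to , from) ← comprehension (P ∘ Fin.suc)
  no ¬p ← em (P Fin.zero)
    where yes p → pure ( inside ∷ D
            , (λ { Vec.here → p ; (Vec.there q) → to q })
            , λ { {Fin.zero} _ → Vec.here ; {Fin.suc x} q → Vec.there (from q) })
  pure (outside ∷ D , (λ { (Vec.there q) → to q })
       , λ { {Fin.zero} p → contradiction p ¬p ; {Fin.suc x} q → Vec.there (from q) })

module _ {n : ℕ} (G : Graph (Fin n)) (E : Rel (Fin n) 0ℓ) where
  open Graph G

  ConnectedClasses : Set
  ConnectedClasses = ∀ {u v} → E u v → Star (λ x y → x ~ y × E x u × E y u) u v

  NoDetour : Subset n → Set
  NoDetour S = ∀ {a₁ a₂ b₁ b₂} → a₁ ∈ˢ S → b₁ ∈ˢ S → E a₁ a₂ → ¬ E b₁ a₁ → ¬ E b₂ a₁ → a₁ ~ b₁ → a₂ ~ b₂ →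
    Star (λ x y → x ~ y × (x ∈ˢ S × ¬ E x a₁) × (y ∈ˢ S × ¬ E y a₁)) b₁ b₂ → a₁ ≡ a₂ × b₁ ≡ b₂

-- Contracting the classes of E, which are connected, turns G into a forest: no-detour says
-- that two edges leaving a class do not lead into the same component of its complement.
module Blocks {n : ℕ} (G : Graph (Fin n)) (S : Subset n) (E : Rel (Fin n) 0ℓ)
  (E-refl : ∀ {x} → E x x) (E-sym : Symmetric E) (E-trans : ∀ {x y z} → E x y → E y z → E x z)
  (connected : ConnectedClasses G E) (no-detour : NoDetour G E S)
  where
  open Graph G

  Saturated : Subset n → Set
  Saturated Z = ∀ {x y} → x ∈ˢ Z → E x y → y ∈ˢ Z

  record Leaf (Z : Subset n) (t : Fin n) : Set where
    constructor mkLeaf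
    field
      unique-exit : ∀ {a₁ a₂ b₁ b₂} → E a₁ t → E a₂ t → ¬ E b₁ t → ¬ E b₂ t → b₁ ∈ˢ Z → b₂ ∈ˢ Z →
        a₁ ~ b₁ → a₂ ~ b₂ → a₁ ≡ a₂ × b₁ ≡ b₂
  open Leaf public

  private
    -- If the class of t has two outgoing edges, its complement is disconnected, and the
    -- part not containing t₀ is, together with the class of t, a smaller instance.
    search : ∀ m Z → size Z < m → (∀ {x} → x ∈ˢ Z → x ∈ˢ S) → Saturated Z → ∀ {t₀ t} → t₀ ∈ˢ Z → t ∈ˢ Z → ¬ E t t₀ →
      ¬ ¬ (∃ λ t′ → t′ ∈ˢ Z × ¬ E t′ t₀ × Leaf Z t′)
    search (suc m) Z (s≤s Z≤m) Z⊆S sat {t₀} {t} t₀∈Z t∈Z t≁t₀ = do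
      yes (a₁ , a₂ , b₁ , b₂ , Ea₁ , Ea₂ , ¬Eb₁ , ¬Eb₂ , b₁∈Z , b₂∈Z , e₁ , e₂ , distinct) ← em (∃ λ a₁ → ∃ λ a₂ → ∃ λ b₁ → ∃ λ b₂ →
          E a₁ t × E a₂ t × ¬ E b₁ t × ¬ E b₂ t × b₁ ∈ˢ Z × b₂ ∈ˢ Z × a₁ ~ b₁ × a₂ ~ b₂ × ¬ (a₁ ≡ a₂ × b₁ ≡ b₂))
        where no none → pure (t , t∈Z , t≁t₀ , mkLeaf λ {a₁} {a₂} {b₁} {b₂} p₁ p₂ q₁ q₂ r₁ r₂ e₁ e₂ →
                decidable-stable ((a₁ Fin.≟ a₂) ×-dec (b₁ Fin.≟ b₂))
                  λ ne → none (a₁ , a₂ , b₁ , b₂ , p₁ , p₂ , q₁ , q₂ , r₁ , r₂ , e₁ , e₂ , ne))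
      let Step : Rel (Fin n) 0ℓ
          Step x y = x ~ y × (x ∈ˢ Z × ¬ E x t) × (y ∈ˢ Z × ¬ E y t)
          apart : ¬ Star Step b₁ b₂
          apart s = distinct (no-detour (Z⊆S (sat t∈Z (E-sym Ea₁))) (Z⊆S b₁∈Z) (E-trans Ea₁ (E-sym Ea₂))
            (λ p → ¬Eb₁ (E-trans p Ea₁)) (λ p → ¬Eb₂ (E-trans p Ea₁)) e₁ e₂
            (Star.map (λ (e , (x∈ , ¬x) , (y∈ , ¬y)) → e , (Z⊆S x∈ , λ p → ¬x (E-trans p Ea₁))
                                                          , (Z⊆S y∈ , λ p → ¬y (E-trans p Ea₁))) s))
          reach-sat : ∀ {x y} → x ∈ˢ Z → ¬ E x t → E x y → Star Step x y
          reach-sat x∈ ¬xt xy = Star.map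
            (λ (e , p , q) → e , (sat x∈ (E-sym p) , λ r → ¬xt (E-trans (E-sym p) r))
                               , (sat x∈ (E-sym q) , λ r → ¬xt (E-trans (E-sym q) r))) (connected xy)
          inside-Z : ∀ {x} → Star Step b₁ x → x ∈ˢ Z × ¬ E x t
          inside-Z s = end-of b₁∈Z ¬Eb₁ s
      -- `D` is the component of `b₁` once the class of `t` is removed from `Z`. In both cases below
      -- the recursive call excludes the class of `t`, the only class that may lose exits on passing
      -- to the smaller set; a leaf found elsewhere is a leaf of `Z`.
      (D , D⇒ , ⇒D) ← comprehension (λ x → Star Step b₁ x)
      no t₀∉D ← em (t₀ ∈ˢ D)
        where
        yes t₀∈D → do
          (Z₂ , Z₂⇒ , ⇒Z₂) ← comprehension (λ x → x ∈ˢ Z × ¬ (x ∈ˢ D))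
          (t′ , t′∈ , ¬t′t , leaf) ← search m Z₂
            (ℕ.<-≤-trans (Subset.p⊂q⇒∣p∣<∣q∣ ((λ p → proj₁ (Z₂⇒ p)) , b₁ , b₁∈Z , λ p → proj₂ (Z₂⇒ p) (⇒D ε))) Z≤m)
            (λ p → Z⊆S (proj₁ (Z₂⇒ p)))
            (λ p xy → ⇒Z₂ (sat (proj₁ (Z₂⇒ p)) xy , λ y∈D → proj₂ (Z₂⇒ p) (⇒D
              (D⇒ y∈D ◅◅ reach-sat (proj₁ (inside-Z (D⇒ y∈D))) (proj₂ (inside-Z (D⇒ y∈D))) (E-sym xy)))))
            {t} {b₂}
            (⇒Z₂ (t∈Z , λ t∈D → proj₂ (inside-Z (D⇒ t∈D)) E-refl))
            (⇒Z₂ (b₂∈Z , λ b₂∈D → apart (D⇒ b₂∈D))) ¬Eb₂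
          let t′∉D = proj₂ (Z₂⇒ t′∈)
              outside-D : ∀ {x} → x ∈ˢ D → ¬ E x t′
              outside-D x∈D p = t′∉D (⇒D (D⇒ x∈D ◅◅ reach-sat (proj₁ (inside-Z (D⇒ x∈D))) (proj₂ (inside-Z (D⇒ x∈D))) p))
              stay : ∀ {a b} → E a t′ → b ∈ˢ Z → a ~ b → b ∈ˢ Z₂
              stay p b∈Z e = ⇒Z₂ (b∈Z , λ b∈D → outside-D (⇒D (D⇒ b∈D ◅◅
                (symm e , inside-Z (D⇒ b∈D) , (sat (proj₁ (Z₂⇒ t′∈)) (E-sym p) , λ r → ¬t′t (E-trans (E-sym p) r))) ◅ ε)) p)
          pure (t′ , proj₁ (Z₂⇒ t′∈)
            , outside-D t₀∈D ∘ E-sym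
            , mkLeaf λ p₁ p₂ q₁ q₂ r₁ r₂ e₁ e₂ → unique-exit leaf p₁ p₂ q₁ q₂ (stay p₁ r₁ e₁) (stay p₂ r₂ e₂) e₁ e₂)
      (Z₁ , Z₁⇒ , ⇒Z₁) ← comprehension (λ x → x ∈ˢ D ⊎ E x t)
      let in-Z : ∀ {x} → x ∈ˢ D ⊎ E x t → x ∈ˢ Z
          in-Z = [ (λ p → proj₁ (inside-Z (D⇒ p))) , (λ p → sat t∈Z (E-sym p)) ]′
      (t′ , t′∈ , ¬t′t , leaf) ← search m Z₁
        (ℕ.<-≤-trans (Subset.p⊂q⇒∣p∣<∣q∣ ((λ p → in-Z (Z₁⇒ p)) , b₂ , b₂∈Z
          , λ p → [ (λ q → apart (D⇒ q)) , ¬Eb₂ ]′ (Z₁⇒ p))) Z≤m)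
        (λ p → Z⊆S (in-Z (Z₁⇒ p)))
        (λ p xy → ⇒Z₁ ([ (λ q → inj₁ (⇒D (D⇒ q ◅◅ reach-sat (proj₁ (inside-Z (D⇒ q))) (proj₂ (inside-Z (D⇒ q))) xy)))
                       , (λ q → inj₂ (E-trans (E-sym xy) q)) ]′ (Z₁⇒ p)))
        {t} {b₁}
        (⇒Z₁ (inj₂ E-refl)) (⇒Z₁ (inj₁ (⇒D ε))) ¬Eb₁
      let t′∈D : t′ ∈ˢ D
          t′∈D = [ id , (λ p → contradiction p ¬t′t) ]′ (Z₁⇒ t′∈)
          class : ∀ {x} → E x t′ → Star Step b₁ x
          class p = D⇒ t′∈D ◅◅ reach-sat (proj₁ (inside-Z (D⇒ t′∈D))) (proj₂ (inside-Z (D⇒ t′∈D))) (E-sym p)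
      stay ← pure {A = ∀ {a b} → E a t′ → b ∈ˢ Z → a ~ b → ¬ ¬ (b ∈ˢ Z₁)} (λ {a} {b} p b∈Z e → do
        no ¬bt ← em (E b t)
          where yes bt → pure (⇒Z₁ (inj₂ bt))
        pure (⇒Z₁ (inj₁ (⇒D (class p ◅◅ (e , inside-Z (class p) , b∈Z , ¬bt) ◅ ε)))))
      pure (t′ , in-Z (Z₁⇒ t′∈)
        , (λ p → t₀∉D (⇒D (class (E-sym p))))
        , mkLeaf λ {_} {_} {b₁} {b₂} p₁ p₂ q₁ q₂ r₁ r₂ e₁ e₂ → unique-exit leaf p₁ p₂ q₁ q₂
            (decidable-stable (b₁ Subset.∈? Z₁) (stay p₁ r₁ e₁)) (decidable-stable (b₂ Subset.∈? Z₁) (stay p₂ r₂ e₂)) e₁ e₂)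
      where
      end-of : ∀ {b x} → b ∈ˢ Z → ¬ E b t → Star (λ x y → x ~ y × (x ∈ˢ Z × ¬ E x t) × (y ∈ˢ Z × ¬ E y t)) b x → x ∈ˢ Z × ¬ E x t
      end-of p q ε = p , q
      end-of _ _ ((_ , _ , p , q) ◅ s) = end-of p q s

  leaf-apart-from : Saturated S → ∀ {t₀ t} → t₀ ∈ˢ S → t ∈ˢ S → ¬ E t t₀ → ¬ ¬ (∃ λ t′ → t′ ∈ˢ S × ¬ E t′ t₀ × Leaf S t′)
  leaf-apart-from = search (suc (size S)) S ℕ.≤-refl id

  leaf : Saturated S → ∀ {t₀} → t₀ ∈ˢ S → ¬ ¬ (∃ λ t′ → t′ ∈ˢ S × Leaf S t′)
  leaf sat {t₀} t₀∈S = do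
    yes (t , t∈S , ¬Ett₀) ← em (∃ λ t → t ∈ˢ S × ¬ E t t₀)
      where no none → pure (t₀ , t₀∈S , mkLeaf λ _ _ q₁ _ r₁ _ _ _ → contradiction (_ , r₁ , q₁) none)
    (t′ , t′∈S , _ , lf) ← leaf-apart-from sat t₀∈S t∈S ¬Ett₀
    pure (t′ , t′∈S , lf)

-- Ranks of weighted graphs

Within : ∀ {n} {G : Graph (Fin n)} → Cycle G → Subset n → Set
Within O S = ∀ {v} → v ∈ O → v ∈ˢ S

data LeafBlock {n : ℕ} (G : Graph (Fin n)) (S : Subset n) (𝒞 : Cycle G → Set) : Set where
  leaf-vertex : ∀ t → t ∈ˢ S → (∀ O → 𝒞 O → ¬ (t ∈ O)) →
    (∀ {y₁ y₂} → y₁ ∈ˢ S → y₂ ∈ˢ S → Graph._~_ G t y₁ → Graph._~_ G t y₂ → y₁ ≡ y₂) → LeafBlock G S 𝒞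
  leaf-cycle : ∀ O → 𝒞 O → Within O S →
    (∀ {a₁ a₂ b₁ b₂} → a₁ ∈ O → a₂ ∈ O → ¬ (b₁ ∈ O) → ¬ (b₂ ∈ O) → b₁ ∈ˢ S → b₂ ∈ˢ S →
      Graph._~_ G a₁ b₁ → Graph._~_ G a₂ b₂ → a₁ ≡ a₂ × b₁ ≡ b₂) → LeafBlock G S 𝒞

Bridging : ∀ {n} (G : Graph (Fin n)) → Cycle G → Set
Bridging G O = ∀ {a₁ a₂ b₁ b₂} → a₁ ∈ O → a₂ ∈ O → ¬ (b₁ ∈ O) → ¬ (b₂ ∈ O) →
  a₁ ~ b₁ → a₂ ~ b₂ → Star (λ x y → x ~ y × ¬ (x ∈ O) × ¬ (y ∈ O)) b₁ b₂ → a₁ ≡ a₂ × b₁ ≡ b₂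
  where open Graph G

-- Three choices of `𝒞` occur: no cycles, when `S` is acyclic; the cycles within `S`; and all
-- cycles, when `S` contains each cycle that it meets.
module CycleBlocks {n : ℕ} {G : Graph (Fin n)} (S : Subset n) (𝒞 : Cycle G → Set)
  (whole : ∀ {O} → 𝒞 O → ∀ {x y} → x ∈ O → x ∈ˢ S → y ∈ O → y ∈ˢ S)
  (complete : ∀ O → Within O S → 𝒞 O)
  (disjoint : ∀ {O O′} → 𝒞 O → 𝒞 O′ → ∀ {u v} → u ∈ O → u ∈ O′ → v ∈ O → v ∈ O′)
  (bridges : ∀ {O} → 𝒞 O → Bridging G O)
  where
  open Graph G

  SameBlock : Rel (Fin n) 0ℓ
  SameBlock x y = x ≡ y ⊎ ∃ λ O → 𝒞 O × x ∈ O × y ∈ O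

  private
    E-sym : Symmetric SameBlock
    E-sym (inj₁ e) = inj₁ (sym e)
    E-sym (inj₂ (O , c , p , q)) = inj₂ (O , c , q , p)

    E-trans : ∀ {x y z} → SameBlock x y → SameBlock y z → SameBlock x z
    E-trans (inj₁ refl) f = f
    E-trans e@(inj₂ _) (inj₁ refl) = e
    E-trans (inj₂ (O , c , p , q)) (inj₂ (O′ , c′ , p′ , q′)) = inj₂ (O , c , p , disjoint c′ c p′ q q′)

    connected : ∀ {u v} → SameBlock u v → Star (λ x y → x ~ y × SameBlock x u × SameBlock y u) u v
    connected (inj₁ refl) = ε
    connected {u} (inj₂ (O , c , u∈O@(i , refl) , j , refl)) with shift-surjective i j
    ... | k , _ , refl = go k
      where
      go : ∀ k → Star (λ x y → x ~ y × SameBlock x u × SameBlock y u) u (at O (shift i k))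
      go zero = ε
      go (suc k) = go k ◅◅ (Cycle.adjacent O (shift i k) , inj₂ (O , c , (_ , refl) , u∈O)
                                                         , inj₂ (O , c , (_ , refl) , u∈O)) ◅ ε

    -- If `a₁` lies on a cycle of `𝒞`, this is `bridges`. Otherwise its class is a single vertex,
    -- and two exits linked outside it would close a cycle within `S`, which `complete` puts into
    -- `𝒞`.
    no-detour′ : ∀ {a₁ a₂ b₁ b₂} → a₁ ∈ˢ S → b₁ ∈ˢ S → SameBlock a₁ a₂ → ¬ SameBlock b₁ a₁ → ¬ SameBlock b₂ a₁ →
      a₁ ~ b₁ → a₂ ~ b₂ →
      Star (λ x y → x ~ y × (x ∈ˢ S × ¬ SameBlock x a₁) × (y ∈ˢ S × ¬ SameBlock y a₁)) b₁ b₂ → a₁ ≡ a₂ × b₁ ≡ b₂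
    no-detour′ {a₁} {a₂} {b₁} {b₂} a₁∈S b₁∈S a₁a₂ ¬b₁ ¬b₂ e₁ e₂ walk =
      decidable-stable ((a₁ Fin.≟ a₂) ×-dec (b₁ Fin.≟ b₂)) do
        no off ← em (∃ λ O → 𝒞 O × a₁ ∈ O)
          where yes (O , c , a₁∈O) → pure (bridges c a₁∈O (member O c a₁∈O a₁a₂)
                  (λ p → ¬b₁ (inj₂ (O , c , p , a₁∈O))) (λ p → ¬b₂ (inj₂ (O , c , p , a₁∈O))) e₁ e₂
                  (Star.map (λ (e , (_ , p) , (_ , q)) → e , (λ x∈ → p (inj₂ (O , c , x∈ , a₁∈O)))
                                                           , (λ y∈ → q (inj₂ (O , c , y∈ , a₁∈O)))) walk))
        pure (off-cycle off a₁a₂)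
      where
      member : ∀ O → 𝒞 O → a₁ ∈ O → SameBlock a₁ a₂ → a₂ ∈ O
      member O c p (inj₁ refl) = p
      member O c p (inj₂ (O′ , c′ , p′ , q′)) = disjoint c′ c p′ p q′
      off-cycle : ¬ (∃ λ O → 𝒞 O × a₁ ∈ O) → SameBlock a₁ a₂ → a₁ ≡ a₂ × b₁ ≡ b₂
      off-cycle off (inj₂ (O , c , p , _)) = contradiction (O , c , p) off
      off-cycle off (inj₁ refl) with b₁ Fin.≟ b₂
      ... | yes e = refl , e
      ... | no b₁≢b₂ = contradiction on off
        where
        on : ∃ λ O → 𝒞 O × a₁ ∈ O
        on with cycle-through {G = G} (λ x → x ∈ˢ S × ¬ SameBlock x a₁) (λ (_ , p) → p (inj₁ refl)) (b₁∈S , ¬b₁) b₁≢b₂ e₁ e₂ walk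
        ... | O , a₁∈O , within = O , complete O (λ p → [ (λ { refl → a₁∈S }) , proj₁ ]′ (within p)) , a₁∈O

  open Blocks G S SameBlock (inj₁ refl) E-sym E-trans connected no-detour′ public

  saturated : Saturated S
  saturated p (inj₁ refl) = p
  saturated p (inj₂ (O , c , x∈ , y∈)) = whole c x∈ p y∈

  private
    different : ∀ {t y} → (∀ O → 𝒞 O → ¬ (t ∈ O)) → t ~ y → ¬ SameBlock y t
    different off e (inj₁ refl) = irrefl e
    different off e (inj₂ (O , c , _ , t∈)) = off O c t∈

  single-exit : ∀ {t y₁ y₂} → Leaf S t → (∀ O → 𝒞 O → ¬ (t ∈ O)) → y₁ ∈ˢ S → y₂ ∈ˢ S → t ~ y₁ → t ~ y₂ → y₁ ≡ y₂
  single-exit lf off y₁∈ y₂∈ e₁ e₂ = proj₂ (unique-exit lf (inj₁ refl) (inj₁ refl)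
    (different off e₁) (different off e₂) y₁∈ y₂∈ e₁ e₂)

  leaf-block : ∀ {t₀} → t₀ ∈ˢ S → ¬ ¬ LeafBlock G S 𝒞
  leaf-block t₀∈S = do
    (t , t∈S , lf) ← leaf saturated t₀∈S
    yes (O , c , t∈O) ← em (∃ λ O → 𝒞 O × t ∈ O)
      where no off → pure (leaf-vertex t t∈S (λ O c p → off (O , c , p)) (single-exit lf (λ O c p → off (O , c , p))))
    let in-block : ∀ {a} → a ∈ O → SameBlock a t
        in-block p = inj₂ (O , c , p , t∈O)
        from-block : ∀ {b} → SameBlock b t → b ∈ O
        from-block = λ { (inj₁ refl) → t∈O ; (inj₂ (O′ , c′ , p , q)) → disjoint c′ c q t∈O p }
    pure (leaf-cycle O c (whole c t∈O t∈S) λ p₁ p₂ q₁ q₂ → unique-exit lf (in-block p₁) (in-block p₂) (q₁ ∘ from-block) (q₂ ∘ from-block))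

open LinearAlgebra ℂ-commutativeRing ≈-stable ℂ-domain 1≉0

-- What elimination has to know of a matrix on a graph. Gain matrices and 0-1 matrices both qualify,
-- so an isolated or pendant vertex affects all their ranks alike.
record Weighting {I : Set} (G : Graph I) (M : Matrix I I) : Set where
  open Graph G
  field
    vanishes : ∀ {i j} → ¬ (i ~ j) → M i j ≈ 0#
    regular  : ∀ {i j} → i ~ j → ∀ b → b *ᶜ M i j ≈ 0# → b ≈ 0#

rank-empty : ∀ {n} {I : Set} {ι : I → Fin n} {M : Matrix I I} {S r} → (∀ {x} → ¬ (x ∈ˢ S)) → HasRank ι M S r → r ≡ 0
rank-empty {r = zero} _ _ = refl
rank-empty {r = suc _} empty (mkRank (f , mem , _) _) = contradiction (mem Fin.zero) empty

SinglyAttached : ∀ {n} {I : Set} → Graph I → (I → Fin n) → Subset n → I → Set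
SinglyAttached G ι S w = ∀ {y₁ y₂} → ι y₁ ∈ˢ S → ι y₂ ∈ˢ S → w ~ y₁ → w ~ y₂ → y₁ ≡ y₂
  where open Graph G

module _ {n : ℕ} {I : Set} {G : Graph I} {M : Matrix I I} (ι : I → Fin n) (W : Weighting G M) where
  open Graph G
  open Weighting W

  isolated-rank : ∀ {S w a b} → (∀ {i j} → ι j ∈ˢ S → ι i ≡ w → ¬ (i ~ j)) →
    HasRank ι M S a → HasRank ι M (S − w) b → a ≡ b
  isolated-rank none = rank-delete-isolated ι M λ
    _ j∈ e → vanishes (none j∈ e) , vanishes (none j∈ e ∘ symm)

  pendant-rank : (∀ {i j} → ι i ≡ ι j → i ≡ j) → ∀ {S w y a b} → ι w ∈ˢ S → ι y ∈ˢ S → w ~ y →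
    SinglyAttached G ι S w → HasRank ι M S a → HasRank ι M (S − ι y − ι w) b → a ≡ 2 + b
  pendant-rank ι-injective {w = w} {y} w∈ y∈ e single =
    rank-delete-pendant ι M ι-injective w y w∈ y∈ (λ { refl → irrefl e })
      (λ j∈ j≢y → vanishes (λ f → j≢y (single j∈ y∈ f e)) , vanishes (λ f → j≢y (single j∈ y∈ (symm f) e)))
      (regular e) (regular (symm e))

Rank : ∀ {n} → Matrix (Fin n) (Fin n) → Subset n → ℕ → Set
Rank = HasRank id

module _ {n : ℕ} {G : Graph (Fin n)} where
  open Graph G

  module _ {M : Matrix (Fin n) (Fin n)} (W : Weighting G M) where
    weighted-exists : ∀ S → ¬ ¬ ∃ (Rank M S)
    weighted-exists = rank-exists id M id

    weighted-delete : ∀ {S v a b} → Rank M S a → Rank M (S − v) b → a ≤ 2 + b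
    weighted-delete = rank-delete id M id

    weighted-isolated : ∀ {S w a b} → (∀ {y} → y ∈ˢ S → ¬ (w ~ y)) → Rank M S a → Rank M (S − w) b → a ≡ b
    weighted-isolated none = isolated-rank id W λ { y∈ refl → none y∈ }

    weighted-pendant : ∀ {S w y a b} → w ∈ˢ S → y ∈ˢ S → w ~ y → SinglyAttached G id S w →
      Rank M S a → Rank M (S − y − w) b → a ≡ 2 + b
    weighted-pendant = pendant-rank id W id

  size-− : ∀ {m} {S : Subset n} {v} → v ∈ˢ S → size S < suc m → size (S − v) < m
  size-− v∈ (s≤s p) = ℕ.<-≤-trans (Subset.x∈p⇒∣p-x∣<∣p∣ v∈) p

  size-−-≤ : ∀ {m} {S : Subset n} v → size S < m → size (S − v) < m
  size-−-≤ {S = S} v p = ℕ.≤-<-trans (Subset.p⊆q⇒∣p∣≤∣q∣ {p = S − v} {q = S} ∈−⇒∈) p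

  module _ {M M′ : Matrix (Fin n) (Fin n)} (W : Weighting G M) (W′ : Weighting G M′) where

    -- The effect of eliminating a leaf depends on the graph only, so both ranks follow the same
    -- recursion.
    forest-rank : ∀ {S a b} → (∀ O → ¬ Within {G = G} O S) → Rank M S a → Rank M′ S b → a ≡ b
    forest-rank {S} acyclic rM rM′ = go (suc (size S)) S ℕ.≤-refl acyclic rM rM′
      where
      go : ∀ m S {a b} → size S < m → (∀ O → ¬ Within {G = G} O S) → Rank M S a → Rank M′ S b → a ≡ b
      go (suc m) S {a} {b} S<m acyclic rM rM′ = ≡-stable do
        yes (t₀ , t₀∈S) ← em (∃ λ t → t ∈ˢ S)
          where no empty → pure (trans (rank-empty (λ p → empty (_ , p)) rM) (sym (rank-empty (λ p → empty (_ , p)) rM′)))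
        leaf-vertex w w∈S _ single ← leaf-block t₀∈S
        yes (y , y∈S , e) ← em (∃ λ y → y ∈ˢ S × w ~ y)
          where
          no none → do
            (c , rM₁) ← weighted-exists W (S − w)
            (d , rM₁′) ← weighted-exists W′ (S − w)
            let alone : ∀ {y} → y ∈ˢ S → ¬ (w ~ y)
                alone y∈ e = none (_ , y∈ , e)
            pure (trans (weighted-isolated W alone rM rM₁) (trans
              (go m (S − w) (size-− w∈S S<m) (λ O p → acyclic O (∈−⇒∈ ∘ p)) rM₁ rM₁′)
              (sym (weighted-isolated W′ alone rM′ rM₁′))))
        (c , rM₁) ← weighted-exists W (S − y − w)
        (d , rM₁′) ← weighted-exists W′ (S − y − w)
        pure (trans (weighted-pendant W w∈S y∈S e single rM rM₁) (trans
          (cong (2 +_) (go m (S − y − w) (size-−-≤ {S = S − y} w (size-− y∈S S<m)) (λ O p → acyclic O (∈−⇒∈ ∘ ∈−⇒∈ ∘ p)) rM₁ rM₁′))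
          (sym (weighted-pendant W′ w∈S y∈S e single rM′ rM₁′))))
        where
        open CycleBlocks {G = G} S (λ _ → ⊥) (λ ()) acyclic (λ ()) (λ ())

gain-weighting : ∀ {n} (Φ : GainGraph n) → Weighting (graph Φ) (gainMatrix Φ)
gain-weighting Φ = record { vanishes = vanishes ; regular = regular }
  where
  open GainGraph Φ using (_~_; _~?_; gain-unit)
  vanishes : ∀ {i j} → ¬ (i ~ j) → gainMatrix Φ i j ≈ 0#
  vanishes {i} {j} ne rewrite dec-false (i ~? j) ne = ℂᵣ.refl
  regular : ∀ {i j} → i ~ j → ∀ b → b *ᶜ gainMatrix Φ i j ≈ 0# → b ≈ 0#
  regular {i} {j} e b h rewrite dec-true (i ~? j) e = begin
    b                       ≈⟨ ℂᵣ.*-identityʳ b ⟨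
    b *ᶜ 1#                 ≈⟨ ℂᵣ.*-congˡ (unit*conj (gain-unit e)) ⟨
    b *ᶜ (g *ᶜ conj g)      ≈⟨ ℂᵣ.*-assoc b g (conj g) ⟨
    (b *ᶜ g) *ᶜ conj g      ≈⟨ ℂᵣ.*-congʳ h ⟩
    0# *ᶜ conj g            ≈⟨ ℂᵣ.zeroˡ (conj g) ⟩
    0#                      ∎
    where
    open import Relation.Binary.Reasoning.Setoid ℂᵣ.setoid
    g = gain Φ i j

adjacency-weighting : ∀ {I : Set} (G : Graph I) → Weighting G (adjacencyMatrix G)
adjacency-weighting G = record
  { vanishes = λ {i} {j} ne → ℂᵣ.reflexive (cong (if_then 1# else 0#) (dec-false (i ~? j) ne))
  ; regular  = λ {i} {j} e b h → ℂᵣ.trans (ℂᵣ.sym (ℂᵣ.*-identityʳ b))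
      (subst (λ t → b *ᶜ (if t then 1# else 0#) ≈ 0#) (dec-true (i ~? j) e) h)
  }
  where open Graph G

-- Extremal sets of vertices

-- The hypotheses line up as b + 2(d + 1) = a ≤ 2 + a′ ≤ 2 + b′ + 2d ≤ 2 + b + 2d. The ends agree,
-- so every step is an equality.
squeeze : ∀ {a b a′ b′} d → a ≡ b + 2 ℕ.* suc d → a ≤ 2 + a′ → a′ ≤ b′ + 2 ℕ.* d → b′ ≤ b →
  b ≡ b′ × a ≡ 2 + a′ × a′ ≡ b′ + 2 ℕ.* d
squeeze {a} {b} {a′} {b′} d refl a≤ a′≤ b′≤b = b≡b′ , ℕ.≤-antisym a≤ (ℕ.≤-trans (ℕ.+-monoʳ-≤ 2 a′≤) (tail b′≤b))
  , ℕ.≤-antisym a′≤ (ℕ.+-cancelˡ-≤ 2 _ _ (ℕ.≤-trans (tail b′≤b) a≤))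
  where
  move : ∀ x → 2 + (x + 2 ℕ.* d) ≡ x + 2 ℕ.* suc d
  move x = trans (sym (trans (ℕ.+-suc x (suc (d + (d + 0)))) (cong suc (ℕ.+-suc x (d + (d + 0))))))
    (cong (x +_) (cong suc (sym (ℕ.+-suc d (d + 0)))))
  tail : ∀ {x} → x ≤ b → 2 + (x + 2 ℕ.* d) ≤ b + 2 ℕ.* suc d
  tail {x} x≤b = ℕ.≤-trans (ℕ.≤-reflexive (move x)) (ℕ.+-monoˡ-≤ (2 ℕ.* suc d) x≤b)
  b≡b′ : b ≡ b′
  b≡b′ = ℕ.≤-antisym (ℕ.+-cancelʳ-≤ (2 ℕ.* suc d) b b′
    (ℕ.≤-trans a≤ (ℕ.≤-trans (ℕ.+-monoʳ-≤ 2 a′≤) (ℕ.≤-reflexive (move b′))))) b′≤b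

module Extremality {n : ℕ} (G : Graph (Fin n)) (A B : Matrix (Fin n) (Fin n))
  (WA : Weighting G A) (WB : Weighting G B) where
  open Graph G

  HitsAll : Subset n → List (Fin n) → Set
  HitsAll S X = ∀ O → Within {G = G} O S → Hits G X O

  hits-mono : ∀ {S S′ X} → (∀ {x} → x ∈ˢ S′ → x ∈ˢ S) → HitsAll S X → HitsAll S′ X
  hits-mono sub hits O within = hits O (sub ∘ within)

  rank-gap : ∀ X {S a b} → HitsAll S X → Rank A S a → Rank B S b → a ≤ b + 2 ℕ.* length X
  rank-gap [] {b = b} hits rA rB = ℕ.≤-reflexive (trans
    (forest-rank WA WB (λ O within → hits O within (λ _ _ ())) rA rB) (sym (ℕ.+-identityʳ b)))
  rank-gap (x ∷ X) {S} {a} {b} hits rA rB = ≤-stable do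
    (c , rA′) ← weighted-exists WA (S − x)
    (d , rB′) ← weighted-exists WB (S − x)
    pure (begin
      a                           ≤⟨ weighted-delete WA rA rA′ ⟩
      2 + c                       ≤⟨ ℕ.+-monoʳ-≤ 2 (rank-gap X hits′ rA′ rB′) ⟩
      2 + (d + 2 ℕ.* length X)    ≤⟨ ℕ.+-monoʳ-≤ 2 (ℕ.+-monoˡ-≤ (2 ℕ.* length X) (rank-mono id B ∈−⇒∈ rB rB′)) ⟩
      2 + (b + 2 ℕ.* length X)    ≡⟨ ℕ.+-comm 2 _ ⟩
      b + 2 ℕ.* length X + 2      ≡⟨ ℕ.+-assoc b _ 2 ⟩
      b + (2 ℕ.* length X + 2)    ≡⟨ cong (b +_) (trans (ℕ.+-comm _ 2) (sym (ℕ.*-suc 2 (length X)))) ⟩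
      b + 2 ℕ.* suc (length X)    ∎)
    where
    open ℕ.≤-Reasoning
    hits′ : HitsAll (S − x) X
    hits′ O within avoid = hits O (∈−⇒∈ ∘ within) λ
      { v v∈O (here refl) → ∈−⇒≢ (within v∈O) refl ; v v∈O (there p) → avoid v v∈O p }

  -- The rank gap attains its bound 2d for a set of d vertices meeting all cycles in S.
  record Extremal (S : Subset n) (d : ℕ) : Set where
    field
      {rankA rankB} : ℕ
      hasRankA : Rank A S rankA
      hasRankB : Rank B S rankB
      gap      : rankA ≡ rankB + 2 ℕ.* d
      hitting  : List (Fin n)
      few      : length hitting ≤ d
      hits     : HitsAll S hitting
  open Extremal

  rank-same : ∀ {M : Matrix (Fin n) (Fin n)} {S r r′} → Rank M S r → Rank M S r′ → r ≡ r′
  rank-same {M = M} = rank-unique id M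

  extremal-isolated : ∀ {S d w} → (∀ {y} → y ∈ˢ S → ¬ (w ~ y)) → Extremal S d → ¬ ¬ Extremal (S − w) d
  extremal-isolated {S} {d} {w} none E = do
    (a , rA) ← weighted-exists WA (S − w)
    (b , rB) ← weighted-exists WB (S − w)
    pure record
      { hasRankA = rA ; hasRankB = rB
      ; gap = trans (sym (weighted-isolated WA none (hasRankA E) rA))
          (trans (gap E) (cong (_+ 2 ℕ.* d) (weighted-isolated WB none (hasRankB E) rB)))
      ; hitting = hitting E ; few = few E ; hits = hits-mono ∈−⇒∈ (hits E) }

  extremal-pendant : ∀ {S d w y} → w ∈ˢ S → y ∈ˢ S → w ~ y → SinglyAttached G id S w →
    Extremal S d → ¬ ¬ Extremal (S − y − w) d
  extremal-pendant {S} {d} {w} {y} w∈ y∈ e single E = do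
    (a , rA) ← weighted-exists WA (S − y − w)
    (b , rB) ← weighted-exists WB (S − y − w)
    pure record
      { hasRankA = rA ; hasRankB = rB
      ; gap = ℕ.+-cancelˡ-≡ 2 _ _ (trans (sym (weighted-pendant WA w∈ y∈ e single (hasRankA E) rA))
          (trans (gap E) (cong (_+ 2 ℕ.* d) (weighted-pendant WB w∈ y∈ e single (hasRankB E) rB))))
      ; hitting = hitting E ; few = few E ; hits = hits-mono (∈−⇒∈ ∘ ∈−⇒∈) (hits E) }

  record CycleVertexDeleted (S : Subset n) (v : Fin n) (d : ℕ) : Set where
    field
      {d′}     : ℕ
      d≡       : d ≡ suc d′
      extremal : Extremal (S − v) d′
      drop-A   : ∀ {a a′} → Rank A S a → Rank A (S − v) a′ → a ≡ 2 + a′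
      keep-B   : ∀ {b b′} → Rank B S b → Rank B (S − v) b′ → b ≡ b′

  module _ (tight : Tight G) where

    -- The hitting vertices on `O` are discarded, at least one in number. The others still meet
    -- every cycle within `S − v`, because by tightness a cycle that shares a vertex with `O` also
    -- contains `v`. This bounds the gap of `S − v` by 2(d - 1), and `squeeze` applies.
    extremal-cycle-vertex : ∀ {S d} O {v} → Within O S → v ∈ O → Extremal S d → ¬ ¬ CycleVertexDeleted S v d
    extremal-cycle-vertex {S} {d} O {v} within v∈O E = do
      (a , rA) ← weighted-exists WA (S − v)
      (b , rB) ← weighted-exists WB (S − v)
      pure (build d (few E) (gap E) rA rB)
      where
      X′ : List (Fin n)
      X′ = filter (λ x → ¬? (x ∈? O)) (hitting E)
      some : Any (λ x → ¬ ¬ (x ∈ O)) (hitting E)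
      some with Any.any? (λ x → x ∈? O) (hitting E)
      ... | yes p = Any.map (λ q r → r q) p
      ... | no ∄ = contradiction (λ x x∈O x∈X → ∄ (Any.map (λ { refl → x∈O }) x∈X)) (hits E O within)
      shorter : length X′ < length (hitting E)
      shorter = List.filter-notAll (λ x → ¬? (x ∈? O)) (hitting E) some
      hits′ : HitsAll (S − v) X′
      hits′ O′ within′ avoid = hits E O′ (∈−⇒∈ ∘ within′) λ x x∈O′ x∈X →
        avoid x x∈O′ (∈ˡ.∈-filter⁺ (λ x → ¬? (x ∈? O)) x∈X λ x∈O →
          ∈−⇒≢ (within′ (common-vertex⇒⊆ tight O O′ x∈O x∈O′ v∈O)) refl)
      build : ∀ d → length (hitting E) ≤ d → rankA E ≡ rankB E + 2 ℕ.* d → ∀ {a b} → Rank A (S − v) a → Rank B (S − v) b →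
        CycleVertexDeleted S v d
      build zero len _ _ _ = contradiction (ℕ.<-≤-trans shorter len) λ ()
      build (suc d) len gapE {a} {b} rA rB = record
        { d≡ = refl
        ; extremal = record
          { hasRankA = rA ; hasRankB = rB ; gap = proj₂ (proj₂ eqs)
          ; hitting = X′ ; few = len′ ; hits = hits′ }
        ; drop-A = λ r r′ → trans (rank-same r (hasRankA E)) (trans (proj₁ (proj₂ eqs)) (cong (2 +_) (rank-same rA r′)))
        ; keep-B = λ r r′ → trans (rank-same r (hasRankB E)) (trans (proj₁ eqs) (rank-same rB r′)) }
        where
        len′ : length X′ ≤ d
        len′ = ℕ.≤-pred (ℕ.<-≤-trans shorter len)
        eqs : rankB E ≡ b × rankA E ≡ 2 + a × a ≡ b + 2 ℕ.* d
        eqs = squeeze d gapE (weighted-delete WA (hasRankA E) rA)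
          (ℕ.≤-trans (rank-gap X′ hits′ rA rB) (ℕ.+-monoʳ-≤ b (ℕ.*-monoʳ-≤ 2 len′)))
          (rank-mono id B ∈−⇒∈ (hasRankB E) rB)

    -- Deleting the pendant pair keeps the gap although one vertex fewer is needed to meet the cycles.
    pendant-off-cycle : ∀ {S d w y} O → Within O S → w ∈ˢ S → y ∈ˢ S → w ~ y → SinglyAttached G id S w →
      Extremal S d → ¬ (y ∈ O)
    pendant-off-cycle {S} {d} {w} {y} O within w∈ y∈ e single E y∈O = (do
      E₁ ← extremal-pendant w∈ y∈ e single E
      E₂ ← extremal-cycle-vertex O within y∈O E
      pure (impossible E₁ E₂)) id
      where
      impossible : Extremal (S − y − w) d → CycleVertexDeleted S y d → ⊥
      impossible E₁ record { d′ = d′ ; d≡ = refl ; extremal = E₂ } = ℕ.<-irrefl refl (begin-strict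
        rankB E₁ + 2 ℕ.* d′             <⟨ ℕ.+-monoʳ-< (rankB E₁) (ℕ.*-monoʳ-< 2 (ℕ.n<1+n d′)) ⟩
        rankB E₁ + 2 ℕ.* suc d′         ≡⟨ gap E₁ ⟨
        rankA E₁                        ≤⟨ rank-gap (hitting E₂) (hits-mono ∈−⇒∈ (hits E₂)) (hasRankA E₁) (hasRankB E₁) ⟩
        rankB E₁ + 2 ℕ.* length (hitting E₂) ≤⟨ ℕ.+-monoʳ-≤ (rankB E₁) (ℕ.*-monoʳ-≤ 2 (few E₂)) ⟩
        rankB E₁ + 2 ℕ.* d′             ∎)
        where open ℕ.≤-Reasoning

  module _ {rB rA t : ℕ} (RB : Rank B ⊤ rB) (RA : Rank A ⊤ rA)
    (t≡ : n + t ≡ edgeCount G + componentCount G) (gap⊤ : rA ≡ rB + 2 ℕ.* t) where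

    extremal⇒tight : Tight G
    extremal⇒tight ub uc b≢c sb sc = (do
      (X , bound , hits) ← hitting-set-loose G ub uc b≢c sb sc
      pure (ℕ.<-irrefl refl (ℕ.<-≤-trans
        (ℕ.*-monoʳ-< 2 (ℕ.+-cancelˡ-≤ n _ _ (ℕ.≤-trans bound (ℕ.≤-reflexive (sym t≡)))))
        (ℕ.+-cancelˡ-≤ rB _ _ (subst (_≤ rB + 2 ℕ.* length X) gap⊤ (rank-gap X (λ O _ → hits O) RA RB)))))) id

    extremal-⊤ : ¬ ¬ Extremal ⊤ t
    extremal-⊤ = do
      (X , bound , hits) ← hitting-set-all G
      pure record
        { hasRankA = RA ; hasRankB = RB ; gap = gap⊤ ; hitting = X
        ; few = ℕ.+-cancelˡ-≤ n _ _ (ℕ.≤-trans bound (ℕ.≤-reflexive (sym t≡)))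
        ; hits = λ O _ → hits O }

-- Eliminating a cycle

module _ {n : ℕ} {G : Graph (Fin n)} (O : Cycle G) (s : Fin (order O)) (S : Subset n) where
  open Graph G

  -- Numbering begins with the successor of `s`, so `s` itself goes last, as `shift s (order O)`.
  peel : ℕ → Subset n
  peel zero    = S
  peel (suc k) = peel k − at O (shift s (suc k))

  peel⊆ : ∀ k {x} → x ∈ˢ peel k → x ∈ˢ S
  peel⊆ zero    p = p
  peel⊆ (suc k) p = peel⊆ k (∈−⇒∈ p)

  peel∌ : ∀ k {x} → x ∈ˢ peel k → ∀ j → 0 < j → j ≤ k → x ≢ at O (shift s j)
  peel∌ zero p (suc j) _ ()
  peel∌ (suc k) p j 0<j j≤1+k with ℕ.m≤n⇒m<n∨m≡n j≤1+k
  ... | inj₁ (s≤s j≤k) = peel∌ k (∈−⇒∈ p) j 0<j j≤k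
  ... | inj₂ refl = ∈−⇒≢ p

  ∈-peel : ∀ k {x} → x ∈ˢ S → (∀ j → 0 < j → j ≤ k → x ≢ at O (shift s j)) → x ∈ˢ peel k
  ∈-peel zero    p h = p
  ∈-peel (suc k) p h = ∈− (∈-peel k p (λ j 0<j j≤k → h j 0<j (ℕ.m≤n⇒m≤1+n j≤k))) (h (suc k) (s≤s z≤n) ℕ.≤-refl)

  peel-distinct : ∀ {j k} → 0 < j → j ≤ order O → 0 < k → k ≤ order O → at O (shift s j) ≡ at O (shift s k) → j ≡ k
  peel-distinct {suc j} {suc k} _ j< _ k< e = cong suc (shift-injective s j< k< (next-injective (Cycle.injective O e)))

  peel-all : ∀ {x} → x ∈ˢ peel (order O) → ¬ (x ∈ O)
  peel-all p (i , refl) with shift-surjective s i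
  ... | zero , k<p , refl = peel∌ (order O) p (order O) k<p ℕ.≤-refl (cong (at O) (sym (shift-period s)))
  ... | suc k , k<p , refl = peel∌ (order O) p (suc k) (s≤s z≤n) (ℕ.<⇒≤ k<p) refl

  module _ (tight : Tight G) (within : Within O S)
    (no-exit : ∀ j → 1 < j → j < order O → ∀ {y} → y ∈ˢ S → ¬ (y ∈ O) → ¬ (at O (shift s j) ~ y))
    {M : Matrix (Fin n) (Fin n)} (W : Weighting G M) where

    -- The vertices 2, …, p of the cycle form a path whose interior has no other neighbours.
    peel-pair : ∀ j {a b} → 0 < j → 2 + j ≤ order O → Rank M (peel j) a → Rank M (peel (2 + j)) b → a ≡ 2 + b
    peel-pair j 0<j 2+j≤p rj rj+2 = weighted-pendant W (kept (suc j) (ℕ.n<1+n j) (ℕ.<⇒≤ 2+j≤p))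
      (kept (2 + j) (ℕ.m≤n⇒m≤1+n (ℕ.n<1+n j)) 2+j≤p)
      (Cycle.adjacent O (shift s (suc j))) (λ p q e f → trans (only p e) (sym (only q f)))
      -- Pendant deletion removes the neighbour before the pendant vertex, `peel` after it.
      rj (subst (λ T → Rank M T _) (Subset.p─x─y≡p─y─x (peel j) (at O (shift s (suc j))) (at O (shift s (2 + j)))) rj+2)
      where
      kept : ∀ k → j < k → k ≤ order O → at O (shift s k) ∈ˢ peel j
      kept k j<k k≤p = ∈-peel j (within (_ , refl)) λ i 0<i i≤j e →
        ℕ.<-irrefl (sym (peel-distinct (ℕ.<-≤-trans 0<i (ℕ.≤-trans i≤j (ℕ.<⇒≤ j<k))) k≤p 0<i
          (ℕ.≤-trans i≤j (ℕ.≤-trans (ℕ.<⇒≤ j<k) k≤p)) e)) (ℕ.≤-<-trans i≤j j<k)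
      only : ∀ {z} → z ∈ˢ peel j → at O (shift s (suc j)) ~ z → z ≡ at O (shift s (2 + j))
      only {z} z∈ e with z ∈? O
      ... | no z∉O = contradiction e (no-exit (suc j) (s≤s 0<j) 2+j≤p (peel⊆ j z∈) z∉O)
      ... | yes z∈O with neighbour O (shift s (suc j)) {shift s j} refl (no-chord tight O (_ , refl) z∈O e)
      ... | inj₁ p = p
      ... | inj₂ p = contradiction p (peel∌ j z∈ j 0<j ℕ.≤-refl)

    -- With vertex 1 gone, the path is consumed in pairs, each worth rank 2. In the form `k ℕ.* 2`
    -- the step to `suc k` reduces by computation.
    path-rank : ∀ k {a b} → 1 + k ℕ.* 2 ≤ order O → Rank M (peel 1) a → Rank M (peel (1 + k ℕ.* 2)) b → a ≡ k ℕ.* 2 + b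
    path-rank zero _ ra rb = rank-unique id M ra rb
    path-rank (suc k) {a} {b} le ra rb = ≡-stable do
      (c , rc) ← weighted-exists W (peel (1 + k ℕ.* 2))
      pure (trans (path-rank k (ℕ.≤-trans (ℕ.m≤n+m _ 2) le) ra rc)
        (trans (cong (k ℕ.* 2 +_) (peel-pair (1 + k ℕ.* 2) (s≤s z≤n) le rc rb))
          (trans (ℕ.+-suc (k ℕ.* 2) (suc b)) (cong suc (ℕ.+-suc (k ℕ.* 2) b)))))

parity : ∀ p → ∃ λ k → p ≡ k ℕ.* 2 ⊎ p ≡ 1 + k ℕ.* 2
parity zero = 0 , inj₁ refl
parity (suc p) with parity p
... | k , inj₁ refl = k , inj₂ refl
... | k , inj₂ refl = suc k , inj₁ refl

-- The alternating vector and products around a cycle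

module ℂ-Reasoning = Relation.Binary.Reasoning.Setoid ℂᵣ.setoid
open Algebra.Properties.Ring ℂᵣ.ring using (-‿distribˡ-*; -‿distribʳ-*; -‿involutive)

-- These are the values cos(kπ/2). Entries two apart are opposite, as the adjacency equations of a
-- cycle demand.
alternating : ℕ → ℂ
alternating zero          = 1#
alternating (suc zero)    = 0#
alternating (suc (suc k)) = -ᶜ alternating k

alternating-periodic : ∀ m q → alternating (m + q ℕ.* 4) ≈ alternating m
alternating-periodic m zero    = ℂᵣ.reflexive (cong alternating (ℕ.+-identityʳ m))
alternating-periodic m (suc q) = ℂᵣ.trans (ℂᵣ.reflexive (cong alternating shuffle))
  (ℂᵣ.trans (-‿involutive _) (alternating-periodic m q))
  where
  shuffle : m + (4 + q ℕ.* 4) ≡ 4 + (m + q ℕ.* 4)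
  shuffle = trans (sym (ℕ.+-assoc m 4 (q ℕ.* 4))) (trans (cong (_+ q ℕ.* 4) (ℕ.+-comm m 4)) (ℕ.+-assoc 4 m (q ℕ.* 4)))

-- Reduction modulo the order subtracts a multiple of 4, so the pattern survives where the cycle
-- closes.
alternating-shift : ∀ {p} q → p ≡ q ℕ.* 4 → (i : Fin p) → alternating (toℕ (shift i 2)) ≈ -ᶜ alternating (toℕ i)
alternating-shift {suc p} q p≡ i = begin
  alternating (toℕ (shift i 2))        ≡⟨ cong alternating (toℕ-shift i 2) ⟩
  alternating r                        ≈⟨ alternating-periodic r (m / suc p ℕ.* q) ⟨
  alternating (r + m / suc p ℕ.* q ℕ.* 4) ≡⟨ cong (λ x → alternating (r + x)) (trans (ℕ.*-assoc (m / suc p) q 4) (cong (m / suc p ℕ.*_) (sym p≡))) ⟩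
  alternating (r + m / suc p ℕ.* suc p) ≡⟨ cong alternating (m≡m%n+[m/n]*n m (suc p)) ⟨
  alternating m                        ≡⟨ cong alternating (ℕ.+-comm (toℕ i) 2) ⟩
  -ᶜ alternating (toℕ i)               ∎
  where
  open ℂ-Reasoning
  m r : ℕ
  m = toℕ i + 2
  r = m % suc p

productℕ : (ℕ → ℂ) → ℕ → ℂ
productℕ g zero    = 1#
productℕ g (suc m) = g 0 *ᶜ productℕ (g ∘ suc) m

product-toℕ : ∀ {p} (f : Fin p → ℂ) g → (∀ i → f i ≡ g (toℕ i)) → Πᶜ f ≡ productℕ g p
product-toℕ {zero} f g e = refl
product-toℕ {suc p} f g e = cong₂ _*ᶜ_ (e Fin.zero) (product-toℕ (f ∘ Fin.suc) (g ∘ suc) (e ∘ Fin.suc))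

sign : ℕ → ℂ
sign q = (-ᶜ 1#) ^ᶜ q

neg≈ : ∀ z → (-ᶜ 1#) *ᶜ z ≈ -ᶜ z
neg≈ z = ℂᵣ.trans (ℂᵣ.sym (-‿distribˡ-* 1# z)) (ℂᵣ.-‿cong (ℂᵣ.*-identityˡ z))

sign² : ∀ q → sign q *ᶜ sign q ≈ 1#
sign² zero    = ℂᵣ.*-identityˡ 1#
sign² (suc q) = begin
  ((-ᶜ 1#) *ᶜ sign q) *ᶜ ((-ᶜ 1#) *ᶜ sign q)  ≈⟨ ℂᵣ.*-cong (neg≈ (sign q)) (neg≈ (sign q)) ⟩
  (-ᶜ sign q) *ᶜ (-ᶜ sign q)                  ≈⟨ -‿distribˡ-* (sign q) (-ᶜ sign q) ⟨
  -ᶜ (sign q *ᶜ (-ᶜ sign q))                  ≈⟨ ℂᵣ.-‿cong (-‿distribʳ-* (sign q) (sign q)) ⟨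
  -ᶜ (-ᶜ (sign q *ᶜ sign q))                  ≈⟨ -‿involutive _ ⟩
  sign q *ᶜ sign q                            ≈⟨ sign² q ⟩
  1#                                          ∎
  where open ℂ-Reasoning

two-step-product : ∀ (φ g : ℕ → ℂ) → (∀ k → φ (2 + k) ≈ -ᶜ (φ k *ᶜ (g k *ᶜ g (suc k)))) →
  ∀ q → φ (q ℕ.* 2) ≈ sign q *ᶜ (φ 0 *ᶜ productℕ g (q ℕ.* 2))
two-step-product φ g rec zero = ℂᵣ.sym (ℂᵣ.trans (ℂᵣ.*-identityˡ _) (ℂᵣ.*-identityʳ _))
two-step-product φ g rec (suc q) = begin
  φ (2 + q ℕ.* 2)                                       ≈⟨ two-step-product (φ ∘ (2 +_)) (g ∘ (2 +_)) (rec ∘ (2 +_)) q ⟩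
  sign q *ᶜ (φ 2 *ᶜ P)                                  ≈⟨ ℂᵣ.*-congˡ (ℂᵣ.*-congʳ (rec 0)) ⟩
  sign q *ᶜ ((-ᶜ (φ 0 *ᶜ (g 0 *ᶜ g 1))) *ᶜ P)           ≈⟨ ℂᵣ.*-congˡ (-‿distribˡ-* (φ 0 *ᶜ (g 0 *ᶜ g 1)) P) ⟨
  sign q *ᶜ (-ᶜ ((φ 0 *ᶜ (g 0 *ᶜ g 1)) *ᶜ P))           ≈⟨ -‿distribʳ-* (sign q) _ ⟨
  -ᶜ (sign q *ᶜ ((φ 0 *ᶜ (g 0 *ᶜ g 1)) *ᶜ P))           ≈⟨ neg≈ _ ⟨
  (-ᶜ 1#) *ᶜ (sign q *ᶜ ((φ 0 *ᶜ (g 0 *ᶜ g 1)) *ᶜ P))   ≈⟨ ℂᵣ.*-assoc (-ᶜ 1#) (sign q) _ ⟨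
  sign (suc q) *ᶜ ((φ 0 *ᶜ (g 0 *ᶜ g 1)) *ᶜ P)          ≈⟨ ℂᵣ.*-congˡ (ℂᵣ.trans (ℂᵣ.*-assoc (φ 0) _ P) (ℂᵣ.*-congˡ (ℂᵣ.*-assoc (g 0) (g 1) P))) ⟩
  sign (suc q) *ᶜ (φ 0 *ᶜ (g 0 *ᶜ (g 1 *ᶜ P)))          ∎
  where
  open ℂ-Reasoning
  P : ℂ
  P = productℕ (g ∘ (2 +_)) (q ℕ.* 2)

-- One turn multiplies φ 0 by the sign times the product. Periodicity makes this factor 1, φ 0 being
-- cancelled by `ℂ-domain`, and a sign is its own inverse.
closed-product : ∀ (φ g : ℕ → ℂ) q → (∀ k → φ (2 + k) ≈ -ᶜ (φ k *ᶜ (g k *ᶜ g (suc k)))) →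
  φ (q ℕ.* 2) ≈ φ 0 → ¬ (φ 0 ≈ 0#) → productℕ g (q ℕ.* 2) ≈ sign q
closed-product φ g q rec period φ≉0 = begin
  P                          ≈⟨ ℂᵣ.*-identityˡ P ⟨
  1# *ᶜ P                    ≈⟨ ℂᵣ.*-congʳ (sign² q) ⟨
  (sign q *ᶜ sign q) *ᶜ P    ≈⟨ ℂᵣ.*-assoc (sign q) (sign q) P ⟩
  sign q *ᶜ (sign q *ᶜ P)    ≈⟨ ℂᵣ.*-congˡ one ⟩
  sign q *ᶜ 1#               ≈⟨ ℂᵣ.*-identityʳ (sign q) ⟩
  sign q                     ∎
  where
  open ℂ-Reasoning
  P : ℂ
  P = productℕ g (q ℕ.* 2)
  swapped : φ 0 *ᶜ (sign q *ᶜ P) ≈ φ 0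
  swapped = begin
    φ 0 *ᶜ (sign q *ᶜ P)   ≈⟨ ℂᵣ.*-assoc (φ 0) (sign q) P ⟨
    (φ 0 *ᶜ sign q) *ᶜ P   ≈⟨ ℂᵣ.*-congʳ (ℂᵣ.*-comm (φ 0) (sign q)) ⟩
    (sign q *ᶜ φ 0) *ᶜ P   ≈⟨ ℂᵣ.*-assoc (sign q) (φ 0) P ⟩
    sign q *ᶜ (φ 0 *ᶜ P)   ≈⟨ two-step-product φ g rec q ⟨
    φ (q ℕ.* 2)            ≈⟨ period ⟩
    φ 0                    ∎
  difference : (sign q *ᶜ P) +ᶜ (-ᶜ 1#) ≈ 0#
  difference = ℂ-domain (φ 0) _ (begin
    φ 0 *ᶜ ((sign q *ᶜ P) +ᶜ (-ᶜ 1#))             ≈⟨ ℂᵣ.distribˡ (φ 0) _ _ ⟩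
    (φ 0 *ᶜ (sign q *ᶜ P)) +ᶜ (φ 0 *ᶜ (-ᶜ 1#))    ≈⟨ ℂᵣ.+-cong swapped (ℂᵣ.trans (ℂᵣ.*-comm (φ 0) (-ᶜ 1#)) (neg≈ (φ 0))) ⟩
    φ 0 +ᶜ (-ᶜ φ 0)                               ≈⟨ ℂᵣ.-‿inverseʳ (φ 0) ⟩
    0#                                            ∎) φ≉0
  one : sign q *ᶜ P ≈ 1#
  one = begin
    sign q *ᶜ P                            ≈⟨ ℂᵣ.+-identityʳ _ ⟨
    (sign q *ᶜ P) +ᶜ 0#                    ≈⟨ ℂᵣ.+-congˡ (ℂᵣ.-‿inverseˡ 1#) ⟨
    (sign q *ᶜ P) +ᶜ ((-ᶜ 1#) +ᶜ 1#)       ≈⟨ ℂᵣ.+-assoc _ _ _ ⟨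
    ((sign q *ᶜ P) +ᶜ (-ᶜ 1#)) +ᶜ 1#       ≈⟨ ℂᵣ.+-congʳ difference ⟩
    0# +ᶜ 1#                               ≈⟨ ℂᵣ.+-identityˡ 1# ⟩
    1#                                     ∎

-- The type of a cycle

start : ∀ {n} {G : Graph (Fin n)} (O : Cycle G) → Fin (order O)
start O = Fin.fromℕ< (ℕ.<-trans (s≤s z≤n) (ℕ.<-trans (s≤s (s≤s z≤n)) (Cycle.order≥3 O)))

start≡0 : ∀ {n} {G : Graph (Fin n)} (O : Cycle G) → toℕ (start O) ≡ 0
start≡0 O = Fin.toℕ-fromℕ< _

shift-from-0 : ∀ {p} (s i : Fin p) → toℕ s ≡ 0 → shift s (toℕ i) ≡ i
shift-from-0 {suc p} s i s≡0 = Fin.toℕ-injective (trans (toℕ-shift s (toℕ i))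
  (trans (cong (λ k → (k + toℕ i) % suc p) s≡0) (m<n⇒m%n≡m (Fin.toℕ<n i))))

rank≤order : ∀ {n} {G : Graph (Fin n)} {M : Matrix (Fin n) (Fin n)} {S r} (O : Cycle G) →
  (∀ {x} → x ∈ˢ S → x ∈ O) → Rank M S r → r ≤ order O
rank≤order {M = M} {S} O only (mkRank (f , rows@(mem , _)) _) = Fin.injective⇒≤ {f = λ k → proj₁ (only (mem k))} λ {k} {l} e →
  rows-injective id M {S = S} rows k l
    (trans (sym (proj₂ (only (mem k)))) (trans (cong (at O) e) (proj₂ (only (mem l)))))

module _ {n : ℕ} (Φ : GainGraph n) where
  open GainGraph Φ using (_~_; _~?_; symm; irrefl; gain-unit; gain-conj)
  private
    G : Graph (Fin n)
    G = graph Φ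
    A B : Matrix (Fin n) (Fin n)
    A = adjacencyMatrix G
    B = gainMatrix Φ
    WA : Weighting G A
    WA = adjacency-weighting G
    WB : Weighting G B
    WB = gain-weighting Φ
  open Extremality G A B WA WB
  open Extremal

  adjacency-1 : ∀ {u v} → u ~ v → A u v ≡ 1#
  adjacency-1 {u} {v} e = cong (if_then 1# else 0#) (dec-true (u ~? v) e)

  gain-entry : ∀ {u v} → u ~ v → B u v ≡ gain Φ u v
  gain-entry {u} {v} e = cong (if_then gain Φ u v else 0#) (dec-true (u ~? v) e)

  module _ (tight : Tight G) where

    private
      adjacent-on-cycle : ∀ (O : Cycle G) i {x} → x ∈ O → x ~ at O (next i) → x ≢ at O i → x ≢ at O (next (next i)) → ⊥
      adjacent-on-cycle O i x∈O e ne ne′ with neighbour O (next i) {i} refl (no-chord tight O (_ , refl) x∈O (symm e))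
      ... | inj₁ p = ne′ p
      ... | inj₂ p = ne p

      two-apart : ∀ (O : Cycle G) i → at O i ≢ at O (next (next i))
      two-apart O i e = next≢previous O {next i} {i} refl (sym e)

    module IsolatedCycle (O : Cycle G) {S : Subset n} (within : Within O S) (only : ∀ {x} → x ∈ˢ S → x ∈ O)
      {d : ℕ} (E : Extremal S d) where
      private
        s : Fin (order O)
        s = start O

        no-exit : ∀ j → 1 < j → j < order O → ∀ {y} → y ∈ˢ S → ¬ (y ∈ O) → ¬ (at O (shift s j) ~ y)
        no-exit _ _ _ y∈S y∉O _ = y∉O (only y∈S)

        empty : ∀ {x} → ¬ (x ∈ˢ peel O s S (order O))
        empty p = peel-all O s S p (only (peel⊆ O s S (order O) p))

      -- Deleting one vertex lowers the rank by 2 and leaves a path on 2k vertices, which pairs off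
      -- completely and has rank 2k. The total 2k + 2 exceeds the number of rows.
      odd-impossible : ∀ k → order O ≢ 1 + k ℕ.* 2
      odd-impossible k p≡ = (do
        C ← extremal-cycle-vertex tight O within (shift s 1 , refl) E
        (a , ra) ← weighted-exists WA (peel O s S 1)
        (b , rb) ← weighted-exists WA (peel O s S (1 + k ℕ.* 2))
        let b≡0 = rank-empty (subst (λ p → ∀ {x} → ¬ (x ∈ˢ peel O s S p)) p≡ empty) rb
            a≡ = path-rank O s S tight within no-exit WA k (ℕ.≤-reflexive (sym p≡)) ra rb
            r≡ = CycleVertexDeleted.drop-A C (hasRankA E) ra
        pure (ℕ.1+n≰n (subst (_≤ order O)
          (trans r≡ (trans (cong (2 +_) (trans a≡ (trans (cong (k ℕ.* 2 +_) b≡0) (ℕ.+-identityʳ _)))) (cong suc (sym p≡))))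
          (rank≤order O only (hasRankA E))))) id

      -- The path left by one deletion has 2k + 1 vertices, that is, k pairs and an isolated vertex.
      -- Its rank 2k and the drop of 2 add up to the order.
      even-rank : ∀ k → order O ≡ suc k ℕ.* 2 → Rank A S (order O)
      even-rank k p≡ = subst (Rank A S) (≡-stable do
        C ← extremal-cycle-vertex tight O within (shift s 1 , refl) E
        (a , ra) ← weighted-exists WA (peel O s S 1)
        (b , rb) ← weighted-exists WA (peel O s S (1 + k ℕ.* 2))
        (c , rc) ← weighted-exists WA (peel O s S (2 + k ℕ.* 2))
        let c≡0 = rank-empty (subst (λ p → ∀ {x} → ¬ (x ∈ˢ peel O s S p)) p≡ empty) rc
            b≡c = weighted-isolated WA (lonely p≡) rb rc
            a≡ = path-rank O s S tight within no-exit WA k (ℕ.≤-trans (ℕ.n≤1+n _) (ℕ.≤-reflexive (sym p≡))) ra rb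
            r≡ = CycleVertexDeleted.drop-A C (hasRankA E) ra
        pure (trans r≡ (trans (cong (2 +_) (trans a≡ (trans (cong (k ℕ.* 2 +_) (trans b≡c c≡0)) (ℕ.+-identityʳ _)))) (sym p≡))))
        (hasRankA E)
        where
        lonely : order O ≡ suc k ℕ.* 2 → ∀ {y} → y ∈ˢ peel O s S (1 + k ℕ.* 2) → ¬ (at O (shift s (2 + k ℕ.* 2)) ~ y)
        lonely p≡ {y} y∈ e with y Fin.≟ at O (shift s (2 + k ℕ.* 2))
        ... | yes refl = irrefl e
        ... | no ne = subst (λ p → ∀ {x} → ¬ (x ∈ˢ peel O s S p)) p≡ empty (∈− y∈ ne)

      -- The rows would be independent by `even-rank`, yet `alternating` is a dependency between
      -- them, with coefficient 1 at the start.
      not-0-mod-4 : ∀ q → order O ≢ suc q ℕ.* 4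
      not-0-mod-4 q p≡ = 1≉0 (subst (λ k → alternating k ≈ 0#) (start≡0 O)
        (full-rank⇒independent id A (at O) (λ p → only p) (even-rank (1 + q ℕ.* 2) (trans p≡ (cong (4 +_) (sym (ℕ.*-assoc q 2 2)))))
          (alternating ∘ toℕ) dependency s))
        where
        dependency : ∀ j → j ∈ˢ S → combination (alternating ∘ toℕ) (A ∘ at O) j ≈ 0#
        dependency j j∈S with only j∈S
        ... | i′ , refl with previous i′
        ... | i , refl = begin
          combination (alternating ∘ toℕ) (A ∘ at O) (at O (next i))
            ≈⟨ sum-pair (λ k → alternating (toℕ k) *ᶜ A (at O k) (at O (next i))) i (next (next i))
                 (two-apart O i ∘ cong (at O)) others ⟩
          (alternating (toℕ i) *ᶜ A (at O i) (at O (next i)))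
            +ᶜ (alternating (toℕ (shift i 2)) *ᶜ A (at O (shift i 2)) (at O (next i)))
            ≡⟨ cong₂ _+ᶜ_ (cong (alternating (toℕ i) *ᶜ_) (adjacency-1 (Cycle.adjacent O i)))
                          (cong (alternating (toℕ (shift i 2)) *ᶜ_) (adjacency-1 (symm (Cycle.adjacent O (next i))))) ⟩
          (alternating (toℕ i) *ᶜ 1#) +ᶜ (alternating (toℕ (shift i 2)) *ᶜ 1#)
            ≈⟨ ℂᵣ.+-cong (ℂᵣ.*-identityʳ _) (ℂᵣ.trans (ℂᵣ.*-identityʳ _) (alternating-shift (suc q) p≡ i)) ⟩
          alternating (toℕ i) +ᶜ (-ᶜ alternating (toℕ i))
            ≈⟨ ℂᵣ.-‿inverseʳ _ ⟩
          0# ∎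
          where
          open ℂ-Reasoning
          others : ∀ k → k ≢ i → k ≢ next (next i) → alternating (toℕ k) *ᶜ A (at O k) (at O (next i)) ≈ 0#
          others k k≢ k≢′ = ℂᵣ.trans (ℂᵣ.*-congˡ (Weighting.vanishes WA
            λ e → adjacent-on-cycle O i (k , refl) e (k≢ ∘ Cycle.injective O) (k≢′ ∘ Cycle.injective O))) (ℂᵣ.zeroʳ _)

      cycle-gain : ∀ q → order O ≡ q ℕ.* 2 → cycleGain Φ O ≈ sign q
      cycle-gain q p≡ = ≈-stable do
        C ← extremal-cycle-vertex tight O within (s , refl) E
        (b , rb) ← weighted-exists WB (S − at O s)
        -- The deleted vertex is the one of index 0, where `closed-product` needs a nonzero value.
        (φ , φ≉0 , null) ← rank-drop-0⇒null-vector id B (at O s) (within (s , refl)) (hasRankB E)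
          (subst (Rank B (S − at O s)) (sym (CycleVertexDeleted.keep-B C (hasRankB E) rb)) rb)
        pure (ℂᵣ.trans (ℂᵣ.reflexive (trans (product-toℕ _ g gains) (cong (productℕ g) p≡)))
          (closed-product (φ ∘ u) g q (λ k → recursion φ k (null (u (1 + k)) (u k) (u (2 + k))
              (within (_ , refl)) (two-apart O (shift s k)) (λ i i∈S ne ne′ → Weighting.vanishes WB
                λ e → adjacent-on-cycle O (shift s k) (only i∈S) e ne ne′) id id))
            (ℂᵣ.reflexive (cong (φ ∘ at O) (trans (cong (shift s) (sym p≡)) (shift-period s))))
            φ≉0))
        where
        u : ℕ → Fin n
        u k = at O (shift s k)
        g : ℕ → ℂ
        g k = gain Φ (u k) (u (suc k))
        gains : ∀ i → gain Φ (at O i) (at O (next i)) ≡ g (toℕ i)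
        gains i = cong (λ j → gain Φ (at O j) (at O (next j))) (sym (shift-from-0 s i (start≡0 O)))
        -- The hypothesis is the column of the middle vertex; multiplying by `g₁` cancels the
        -- conjugate gain in its second term.
        recursion : ∀ φ k → (φ (u k) *ᶜ B (u k) (u (1 + k))) +ᶜ (φ (u (2 + k)) *ᶜ B (u (2 + k)) (u (1 + k))) ≈ 0# →
          φ (u (2 + k)) ≈ -ᶜ (φ (u k) *ᶜ (g k *ᶜ g (1 + k)))
        recursion φ k h = begin
          φ₂                                      ≈⟨ ℂᵣ.*-identityʳ φ₂ ⟨
          φ₂ *ᶜ 1#                                ≈⟨ ℂᵣ.*-congˡ (ℂᵣ.trans (ℂᵣ.*-comm _ _) (unit*conj (gain-unit e₁))) ⟨
          φ₂ *ᶜ (conj g₁ *ᶜ g₁)                   ≈⟨ ℂᵣ.*-assoc φ₂ (conj g₁) g₁ ⟨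
          (φ₂ *ᶜ conj g₁) *ᶜ g₁                   ≈⟨ ℂᵣ.*-congʳ second ⟩
          (-ᶜ (φ₀ *ᶜ g₀)) *ᶜ g₁                   ≈⟨ -‿distribˡ-* (φ₀ *ᶜ g₀) g₁ ⟨
          -ᶜ ((φ₀ *ᶜ g₀) *ᶜ g₁)                   ≈⟨ ℂᵣ.-‿cong (ℂᵣ.*-assoc φ₀ g₀ g₁) ⟩
          -ᶜ (φ₀ *ᶜ (g₀ *ᶜ g₁))                   ∎
          where
          open ℂ-Reasoning
          φ₀ φ₂ g₀ g₁ : ℂ
          φ₀ = φ (u k)
          φ₂ = φ (u (2 + k))
          g₀ = g k
          g₁ = g (1 + k)
          e₀ : u k ~ u (1 + k)
          e₀ = Cycle.adjacent O (shift s k)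
          e₁ : u (1 + k) ~ u (2 + k)
          e₁ = Cycle.adjacent O (shift s (1 + k))
          second : φ₂ *ᶜ conj g₁ ≈ -ᶜ (φ₀ *ᶜ g₀)
          second = begin
            φ₂ *ᶜ conj g₁
              ≈⟨ ℂᵣ.*-congˡ (gain-conj e₁) ⟨
            φ₂ *ᶜ gain Φ (u (2 + k)) (u (1 + k))
              ≡⟨ cong (φ₂ *ᶜ_) (gain-entry (symm e₁)) ⟨
            φ₂ *ᶜ B (u (2 + k)) (u (1 + k))
              ≈⟨ ℂᵣ.+-identityˡ _ ⟨
            0# +ᶜ (φ₂ *ᶜ B (u (2 + k)) (u (1 + k)))
              ≈⟨ ℂᵣ.+-congʳ (ℂᵣ.-‿inverseˡ (φ₀ *ᶜ g₀)) ⟨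
            ((-ᶜ (φ₀ *ᶜ g₀)) +ᶜ (φ₀ *ᶜ g₀)) +ᶜ (φ₂ *ᶜ B (u (2 + k)) (u (1 + k)))
              ≈⟨ ℂᵣ.+-assoc _ _ _ ⟩
            (-ᶜ (φ₀ *ᶜ g₀)) +ᶜ ((φ₀ *ᶜ g₀) +ᶜ (φ₂ *ᶜ B (u (2 + k)) (u (1 + k))))
              ≡⟨ cong (λ b → (-ᶜ (φ₀ *ᶜ g₀)) +ᶜ ((φ₀ *ᶜ b) +ᶜ (φ₂ *ᶜ B (u (2 + k)) (u (1 + k))))) (gain-entry e₀) ⟨
            (-ᶜ (φ₀ *ᶜ g₀)) +ᶜ ((φ₀ *ᶜ B (u k) (u (1 + k))) +ᶜ (φ₂ *ᶜ B (u (2 + k)) (u (1 + k))))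
              ≈⟨ ℂᵣ.+-congˡ h ⟩
            (-ᶜ (φ₀ *ᶜ g₀)) +ᶜ 0#
              ≈⟨ ℂᵣ.+-identityʳ _ ⟩
            -ᶜ (φ₀ *ᶜ g₀) ∎

      type-A : IsTypeA Φ O × order O % 4 ≡ 2
      type-A with parity (order O)
      ... | k , inj₂ p≡ = contradiction p≡ (odd-impossible k)
      ... | q , inj₁ p≡ = (divides q p≡ , subst (λ h → cycleGain Φ O ≈ sign h)
              (sym (trans (cong (_/ 2) p≡) (m*n/n≡m q 2))) (cycle-gain q p≡))
            , mod-4 (parity q)
        where
        mod-4 : (∃ λ k → q ≡ k ℕ.* 2 ⊎ q ≡ 1 + k ℕ.* 2) → order O % 4 ≡ 2
        mod-4 (zero , inj₁ refl) = contradiction (subst (3 ≤_) p≡ (Cycle.order≥3 O)) λ ()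
        mod-4 (suc k , inj₁ refl) = contradiction (trans p≡ (ℕ.*-assoc (suc k) 2 2)) (not-0-mod-4 k)
        mod-4 (k , inj₂ refl) = trans (cong (_% 4) (trans p≡ (cong (2 +_) (ℕ.*-assoc k 2 2)))) ([m+kn]%n≡m%n 2 k 4)

    cycle-type : ∀ (O : Cycle G) {S d} → Within O S → Extremal S d → ¬ ¬ (IsTypeA Φ O × order O % 4 ≡ 2)
    cycle-type O {S} within E = go (suc (size S)) S ℕ.≤-refl within E
      where
      go : ∀ m S {d} → size S < m → Within O S → Extremal S d → ¬ ¬ (IsTypeA Φ O × order O % 4 ≡ 2)
      go (suc m) S S<m within E = do
        -- A cycle that leaves `O` is broken at one of its vertices outside `O`. Once there is none,
        -- every block apart from `O` is a single vertex.
        no others ← em (∃ λ (O′ : Cycle G) → Within O′ S × ∃ λ x → x ∈ O′ × ¬ (x ∈ O))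
          where
          yes (O′ , within′ , x , x∈O′ , x∉O) → do
            C ← extremal-cycle-vertex tight O′ within′ x∈O′ E
            go m (S − x) (size-− {G = G} (within′ x∈O′) S<m)
              (λ p → ∈− (within p) λ { refl → x∉O p }) (CycleVertexDeleted.extremal C)
        yes (t , t∈S , t∉O) ← em (∃ λ t → t ∈ˢ S × ¬ (t ∈ O))
          where
          no none → pure (IsolatedCycle.type-A O within
            (λ {x} x∈S → decidable-stable (x ∈? O) λ x∉O → none (x , x∈S , x∉O)) E)
        let contained : ∀ O′ → Within O′ S → ∀ {x} → x ∈ O′ → x ∈ O
            contained O′ within′ {x} x∈O′ = decidable-stable (x ∈? O) λ x∉O → others (O′ , within′ , x , x∈O′ , x∉O)
            module Bl = CycleBlocks {G = G} S (λ O′ → Within O′ S)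
              (λ within′ _ _ y∈ → within′ y∈) (λ _ p → p)
              (λ {O₁} {O₂} _ _ p q r → common-vertex⇒⊆ tight O₁ O₂ p q r) (λ {O′} _ → no-detour tight O′)
            o∈O : at O (start O) ∈ O
            o∈O = start O , refl
        -- A leaf outside `O` is needed so that its elimination spares `O`.
        (w , w∈S , w≁o , lf) ← Bl.leaf-apart-from Bl.saturated (within o∈O) t∈S
          λ { (inj₁ refl) → t∉O o∈O ; (inj₂ (O′ , within′ , p , _)) → t∉O (contained O′ within′ p) }
        let w∉O : ¬ (w ∈ O)
            w∉O p = w≁o (inj₂ (O , within , p , o∈O))
            single : SinglyAttached G id S w
            single = Bl.single-exit lf (λ O′ within′ p → w∉O (contained O′ within′ p))
        yes (y , y∈S , e) ← em (∃ λ y → y ∈ˢ S × w ~ y)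
          where
          no none → do
            E′ ← extremal-isolated (λ y∈ e → none (_ , y∈ , e)) E
            go m (S − w) (size-− {G = G} w∈S S<m) (λ p → ∈− (within p) λ { refl → w∉O p }) E′
        let y∉O = pendant-off-cycle tight O within w∈S y∈S e single E
        E′ ← extremal-pendant w∈S y∈S e single E
        go m (S − y − w) (size-−-≤ {G = G} {S = S − y} w (size-− {G = G} y∈S S<m))
          (λ p → ∈− (∈− (within p) λ { refl → y∉O p }) λ { refl → w∉O p }) E′

-- The contraction

open Algebra.Definitions.RawMonoid ℕ.+-0-rawMonoid using () renaming (sum to Σℕ)

Σℕ-cong : ∀ {m} {f g : Fin m → ℕ} → (∀ k → f k ≡ g k) → Σℕ f ≡ Σℕ g
Σℕ-cong {zero}  e = refl
Σℕ-cong {suc m} e = cong₂ _+_ (e Fin.zero) (Σℕ-cong (e ∘ Fin.suc))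

Σℕ-zero : ∀ {m} {f : Fin m → ℕ} → (∀ k → f k ≡ 0) → Σℕ f ≡ 0
Σℕ-zero {zero}  e = refl
Σℕ-zero {suc m} e = cong₂ _+_ (e Fin.zero) (Σℕ-zero (e ∘ Fin.suc))

Σℕ-drop : ∀ {m} {f g : Fin m → ℕ} k₀ → (∀ k → k ≢ k₀ → f k ≡ g k) → g k₀ ≡ 0 → Σℕ f ≡ f k₀ + Σℕ g
Σℕ-drop {suc m} {f} {g} Fin.zero e z = cong (f Fin.zero +_)
  (trans (Σℕ-cong (λ k → e (Fin.suc k) λ ())) (cong (_+ Σℕ (g ∘ Fin.suc)) (sym z)))
Σℕ-drop {suc m} {f} {g} (Fin.suc k₀) e z = begin
  f Fin.zero + Σℕ (f ∘ Fin.suc)                          ≡⟨ cong₂ _+_ (e Fin.zero λ ()) (Σℕ-drop k₀ (λ k ne → e (Fin.suc k) (ne ∘ Fin.suc-injective)) z) ⟩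
  g Fin.zero + (f (Fin.suc k₀) + Σℕ (g ∘ Fin.suc))       ≡⟨ ℕ.+-assoc (g Fin.zero) _ _ ⟨
  g Fin.zero + f (Fin.suc k₀) + Σℕ (g ∘ Fin.suc)         ≡⟨ cong (_+ Σℕ (g ∘ Fin.suc)) (ℕ.+-comm (g Fin.zero) _) ⟩
  f (Fin.suc k₀) + g Fin.zero + Σℕ (g ∘ Fin.suc)         ≡⟨ ℕ.+-assoc (f (Fin.suc k₀)) _ _ ⟩
  f (Fin.suc k₀) + (g Fin.zero + Σℕ (g ∘ Fin.suc))       ∎
  where open ≡-Reasoning

-- Ranks around an even cycle with at most one exit

module LeafCycle {n : ℕ} {G : Graph (Fin n)} (tight : Tight G) (O : Cycle G) (S : Subset n)
  (within : Within O S) (k : ℕ) (p≡ : order O ≡ suc k ℕ.* 2) where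
  open Graph G

  K : Subset n
  K = peel O (start O) S (order O)

  K⇒ : ∀ {x} → x ∈ˢ K → x ∈ˢ S × ¬ (x ∈ O)
  K⇒ p = peel⊆ O (start O) S (order O) p , peel-all O (start O) S p

  private
    ∈-peel-all : ∀ s {x} → x ∈ˢ S → ¬ (x ∈ O) → ∀ m → x ∈ˢ peel O s S m
    ∈-peel-all s x∈S x∉O m = ∈-peel O s S m x∈S (λ j _ _ e → x∉O (shift s j , sym e))

    last-vertex : ∀ s {y} → y ∈ˢ peel O s S (1 + k ℕ.* 2) → y ∈ O → y ≡ at O (shift s (2 + k ℕ.* 2))
    last-vertex s {y} y∈ y∈O with y Fin.≟ at O (shift s (2 + k ℕ.* 2))
    ... | yes e = e
    ... | no ne = contradiction y∈O (subst (λ p → ∀ {x} → x ∈ˢ peel O s S p → ¬ (x ∈ O)) p≡ (peel-all O s S) (∈− y∈ ne))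

  ⇒K : ∀ {x} → x ∈ˢ S → ¬ (x ∈ O) → x ∈ˢ K
  ⇒K p q = ∈-peel-all (start O) p q (order O)

  module _ {M : Matrix (Fin n) (Fin n)} (W : Weighting G M) (s : Fin (order O)) where

    -- Only vertex 1 may have exits, and it is gone. Of the other 2k + 1 vertices, k pairs are
    -- eliminated and the last one is isolated.
    detached-rank : (∀ j → 1 < j → j ≤ order O → ∀ {y} → y ∈ˢ S → ¬ (y ∈ O) → ¬ (at O (shift s j) ~ y)) →
      ∀ {a b} → Rank M (peel O s S 1) a → Rank M K b → a ≡ k ℕ.* 2 + b
    detached-rank no-exit {a} {b} ra rb = ≡-stable do
      (c , rc) ← weighted-exists W (peel O s S (1 + k ℕ.* 2))
      pure (trans (path-rank O s S tight within (λ j 1<j j<p → no-exit j 1<j (ℕ.<⇒≤ j<p)) W k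
          (ℕ.≤-trans (ℕ.n≤1+n _) (ℕ.≤-reflexive (sym p≡))) ra rc)
        (cong (k ℕ.* 2 +_) (weighted-isolated W alone rc
          (rank-resp id M
            (λ p → ∈-peel-all s (proj₁ (K⇒ p)) (proj₂ (K⇒ p)) (2 + k ℕ.* 2))
            (λ p → ⇒K (peel⊆ O s S (2 + k ℕ.* 2) p) (subst (λ m → ∀ {x} → x ∈ˢ peel O s S m → ¬ (x ∈ O)) p≡ (peel-all O s S) p))
            rb))))
      where
      alone : ∀ {y} → y ∈ˢ peel O s S (1 + k ℕ.* 2) → ¬ (at O (shift s (2 + k ℕ.* 2)) ~ y)
      alone {y} y∈ e with y ∈? O
      ... | yes y∈O = irrefl (subst (_ ~_) (last-vertex s y∈ y∈O) e)
      ... | no y∉O = no-exit (2 + k ℕ.* 2) (s≤s (s≤s z≤n)) (ℕ.≤-reflexive (sym p≡)) (peel⊆ O s S (1 + k ℕ.* 2) y∈) y∉O e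

    -- The exit is now at `s`, the far end of the path. The k pairs leave `s` pendant at `z`, and
    -- this last pair contributes the extra 2.
    attached-rank : (∀ j → 1 < j → j < order O → ∀ {y} → y ∈ˢ S → ¬ (y ∈ O) → ¬ (at O (shift s j) ~ y)) →
      ∀ {z} → z ∈ˢ S → ¬ (z ∈ O) → at O s ~ z → (∀ {y} → y ∈ˢ S → ¬ (y ∈ O) → at O s ~ y → y ≡ z) →
      ∀ {a b} → Rank M (peel O s S 1) a → Rank M (K − z) b → a ≡ k ℕ.* 2 + (2 + b)
    attached-rank no-exit {z} z∈S z∉O e single {a} {b} ra rb = ≡-stable do
      (c , rc) ← weighted-exists W (peel O s S (1 + k ℕ.* 2))
      pure (trans (path-rank O s S tight within no-exit W k (ℕ.≤-trans (ℕ.n≤1+n _) (ℕ.≤-reflexive (sym p≡))) ra rc)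
        (cong (k ℕ.* 2 +_) (weighted-pendant W w∈ (∈-peel-all s z∈S z∉O (1 + k ℕ.* 2)) (subst (_~ z) (sym w≡) e)
          (λ p q f g → trans (only p f) (sym (only q g))) rc
          (rank-resp id M
            (λ p → ∈− (∈− (∈-peel-all s (proj₁ (K⇒ (∈−⇒∈ p))) (proj₂ (K⇒ (∈−⇒∈ p))) (1 + k ℕ.* 2)) (∈−⇒≢ p))
              λ { refl → proj₂ (K⇒ (∈−⇒∈ p)) (_ , refl) })
            (λ p → ∈− (⇒K (peel⊆ O s S (1 + k ℕ.* 2) (∈−⇒∈ (∈−⇒∈ p))) λ x∈O → ∈−⇒≢ p (last-vertex s (∈−⇒∈ (∈−⇒∈ p)) x∈O))
              (∈−⇒≢ (∈−⇒∈ p)))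
            rb))))
      where
      w≡ : at O (shift s (2 + k ℕ.* 2)) ≡ at O s
      w≡ = cong (at O) (trans (cong (shift s) (sym p≡)) (shift-period s))
      w∈ : at O (shift s (2 + k ℕ.* 2)) ∈ˢ peel O s S (1 + k ℕ.* 2)
      w∈ = ∈-peel O s S (1 + k ℕ.* 2) (within (_ , refl)) λ j 0<j j≤ eq →
        ℕ.<-irrefl (sym (peel-distinct O s S (s≤s z≤n) (ℕ.≤-reflexive (sym p≡)) 0<j
          (ℕ.≤-trans j≤ (ℕ.≤-trans (ℕ.n≤1+n _) (ℕ.≤-reflexive (sym p≡)))) eq)) (s≤s j≤)
      only : ∀ {y} → y ∈ˢ peel O s S (1 + k ℕ.* 2) → at O (shift s (2 + k ℕ.* 2)) ~ y → y ≡ z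
      only {y} y∈ f with y ∈? O
      ... | yes y∈O = contradiction (subst (_ ~_) (last-vertex s y∈ y∈O) f) irrefl
      ... | no y∉O = single (peel⊆ O s S (1 + k ℕ.* 2) y∈) y∉O (subst (_~ y) w≡ f)

-- Part (c) relative to a set of vertices

module ContractionRank {n : ℕ} (Φ : GainGraph n) (tight : Tight (graph Φ)) where
  open GainGraph Φ using (_~_)

  private
    G : Graph (Fin n)
    G = graph Φ
    A B : Matrix (Fin n) (Fin n)
    A = adjacencyMatrix G
    B = gainMatrix Φ
    WA : Weighting G A
    WA = adjacency-weighting G
    WB : Weighting G B
    WB = gain-weighting Φ
  open Extremality G A B WA WB
  open Extremal
  open CycleVertexDeleted

  private
    Tᴳ : Graph (AcyclicVertex G ⊎ Fin (cycleCount G))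
    Tᴳ = contraction G
    Γᴳ : Graph (AcyclicVertex G)
    Γᴳ = acyclicPart G

  base : Fin (cycleCount G) → Fin n
  base k = at (cycle G k) (start (cycle G k))

  base∈ : ∀ k → base k ∈ cycle G k
  base∈ k = start (cycle G k) , refl

  -- A contracted cycle is labelled by a vertex of its own. Labels are distinct since the cycles are
  -- disjoint, and a set of vertices of `G` thereby selects a submatrix for T_G.
  representative : AcyclicVertex G ⊎ Fin (cycleCount G) → Fin n
  representative (inj₁ u) = vertex u
  representative (inj₂ k) = base k

  vertex-injective : ∀ {u v : AcyclicVertex G} → vertex u ≡ vertex v → u ≡ v
  vertex-injective {⟨ _ ⟩ _} {⟨ _ ⟩ _} refl = refl

  off-cycle : ∀ {u : AcyclicVertex G} (O : Cycle G) → ¬ (vertex u ∈ O)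
  off-cycle {⟨ _ ⟩ off} O p = ⊥-elim-irr (off O p)

  cycle-index : ∀ O → ∃ λ k → (∀ {x} → x ∈ O → x ∈ cycle G k) × (∀ {x} → x ∈ cycle G k → x ∈ O)
  cycle-index O with Transversal.covers (cycles G) O
  ... | k , same = k , common-vertex⇒⊆ tight O (cycle G k) (start O , refl) shared
                     , common-vertex⇒⊆ tight (cycle G k) O shared (start O , refl)
    where
    shared : at O (start O) ∈ cycle G k
    shared = edge⇒∈ˡ (cycle G k) (Equivalence.to (same _ _) (start O , inj₁ (refl , refl)))

  same-index : ∀ {k l x} → x ∈ cycle G k → x ∈ cycle G l → k ≡ l
  same-index {k} {l} p q = Transversal.distinct (cycles G) (common-vertex⇒same tight (cycle G k) (cycle G l) p q)

  representative-injective : ∀ {i j} → representative i ≡ representative j → i ≡ j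
  representative-injective {inj₁ u} {inj₁ v} e = cong inj₁ (vertex-injective e)
  representative-injective {inj₁ u} {inj₂ l} e = contradiction (subst (_∈ cycle G l) (sym e) (base∈ l)) (off-cycle {u} (cycle G l))
  representative-injective {inj₂ k} {inj₁ v} e = contradiction (subst (_∈ cycle G k) e (base∈ k)) (off-cycle {v} (cycle G k))
  representative-injective {inj₂ k} {inj₂ l} e = cong inj₂ (same-index (base∈ k) (subst (_∈ cycle G l) (sym e) (base∈ l)))

  RankT RankΓ : Subset n → ℕ → Set
  RankT = HasRank representative (adjacencyMatrix Tᴳ)
  RankΓ = HasRank vertex (adjacencyMatrix Γᴳ)

  rankT-exists : ∀ S → ¬ ¬ ∃ (RankT S)
  rankT-exists = rank-exists representative (adjacencyMatrix Tᴳ) representative-injective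

  rankΓ-exists : ∀ S → ¬ ¬ ∃ (RankΓ S)
  rankΓ-exists = rank-exists vertex (adjacencyMatrix Γᴳ) vertex-injective

  CyclesWhole : Subset n → Set
  CyclesWhole S = ∀ (O : Cycle G) {x y} → x ∈ O → y ∈ O → x ∈ˢ S → y ∈ˢ S

  weight : Subset n → Fin (cycleCount G) → ℕ
  weight S k = if does (base k Subset.∈? S) then order (cycle G k) else 0

  totalOrder : Subset n → ℕ
  totalOrder S = Σℕ (weight S)

  weight-in : ∀ {S k} → base k ∈ˢ S → weight S k ≡ order (cycle G k)
  weight-in {S} {k} p = cong (if_then order (cycle G k) else 0) (dec-true (base k Subset.∈? S) p)

  weight-out : ∀ {S k} → ¬ (base k ∈ˢ S) → weight S k ≡ 0
  weight-out {S} {k} p = cong (if_then order (cycle G k) else 0) (dec-false (base k Subset.∈? S) p)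

  weight-same : ∀ {S S′ k} → (base k ∈ˢ S → base k ∈ˢ S′) → (base k ∈ˢ S′ → base k ∈ˢ S) → weight S k ≡ weight S′ k
  weight-same {S} {S′} {k} to from with base k Subset.∈? S
  ... | yes p = sym (weight-in (to p))
  ... | no ¬p = sym (weight-out (¬p ∘ from))

  record Claim (S : Subset n) : Set where
    constructor mkClaim
    field
      equations : ∀ {a t γ} → Rank A S a → RankT S t → RankΓ S γ → a ≡ t + totalOrder S × t ≡ γ
  open Claim public

  private
    shift-claim : ∀ {a a′ t t′ γ γ′ σ σ′} r → a ≡ r + a′ → t ≡ r + t′ → γ ≡ r + γ′ → σ ≡ σ′ → a′ ≡ t′ + σ′ × t′ ≡ γ′ → a ≡ t + σ × t ≡ γ
    shift-claim {t′ = t′} {σ = σ} r refl refl refl refl (refl , refl) = sym (ℕ.+-assoc r t′ σ) , refl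

  claim-empty : ∀ {S} → (∀ {x} → ¬ (x ∈ˢ S)) → Claim S
  claim-empty {S} empty = mkClaim λ rA rT rΓ →
      trans (rank-empty empty rA) (sym (cong₂ _+_ (rank-empty empty rT) (Σℕ-zero λ k → weight-out {S} {k} empty)))
    , trans (rank-empty empty rT) (sym (rank-empty empty rΓ))

  claim-isolated : ∀ {S w} → CyclesWhole S → (∀ O → ¬ (w ∈ O)) → (∀ {y} → y ∈ˢ S → ¬ (w ~ y)) → Claim (S − w) → ¬ ¬ Claim S
  claim-isolated {S} {w} whole off alone claim = do
    (a′ , rA′) ← weighted-exists WA (S − w)
    (t′ , rT′) ← rankT-exists (S − w)
    (γ′ , rΓ′) ← rankΓ-exists (S − w)
    pure (mkClaim λ rA rT rΓ → shift-claim 0 (weighted-isolated WA alone rA rA′)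
      (isolated-rank representative (adjacency-weighting Tᴳ) (λ {i} {j} → aloneT {i} {j}) rT rT′)
      (isolated-rank vertex (adjacency-weighting Γᴳ) (λ { v∈ refl e → alone v∈ e }) rΓ rΓ′)
      (Σℕ-cong λ k → weight-same {S} {S − w} {k} (λ p → ∈− p λ { refl → off (cycle G k) (base∈ k) }) ∈−⇒∈)
      (equations claim rA′ rT′ rΓ′))
    where
    aloneT : ∀ {i j} → representative j ∈ˢ S → representative i ≡ w → ¬ (Graph._~_ Tᴳ i j)
    aloneT {inj₁ u} {inj₁ v} v∈ refl e = alone v∈ e
    aloneT {inj₁ u} {inj₂ l} l∈ refl (i , e) = alone (whole (cycle G l) (base∈ l) (i , refl) l∈) e
    aloneT {inj₂ k} _ refl _ = off (cycle G k) (base∈ k)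

  -- With both vertices off all cycles, the pair is pendant in `G`, T_G and Γ_G alike, and all three
  -- ranks drop by 2.
  claim-pendant : ∀ {S w y} → CyclesWhole S → (∀ O → ¬ (w ∈ O)) → (∀ O → ¬ (y ∈ O)) → w ∈ˢ S → y ∈ˢ S → w ~ y →
    SinglyAttached G id S w → Claim (S − y − w) → ¬ ¬ Claim S
  claim-pendant {S} {w} {y} whole w-off y-off w∈ y∈ e single claim = do
    (a′ , rA′) ← weighted-exists WA (S − y − w)
    (t′ , rT′) ← rankT-exists (S − y − w)
    (γ′ , rΓ′) ← rankΓ-exists (S − y − w)
    pure (mkClaim λ rA rT rΓ → shift-claim 2 (weighted-pendant WA w∈ y∈ e single rA rA′)
      (pendant-rank representative (adjacency-weighting Tᴳ) representative-injective {w = inj₁ w′} {y = inj₁ y′} w∈ y∈ e singleT rT rT′)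
      (pendant-rank vertex (adjacency-weighting Γᴳ) vertex-injective {w = w′} {y = y′} w∈ y∈ e
        (λ {u} {v} p q f g → vertex-injective (single p q f g)) rΓ rΓ′)
      (Σℕ-cong λ k → weight-same {S} {S − y − w} {k}
        (λ p → ∈− (∈− p λ { refl → y-off (cycle G k) (base∈ k) }) λ { refl → w-off (cycle G k) (base∈ k) }) (∈−⇒∈ ∘ ∈−⇒∈))
      (equations claim rA′ rT′ rΓ′))
    where
    w′ y′ : AcyclicVertex G
    w′ = ⟨ w ⟩ w-off
    y′ = ⟨ y ⟩ y-off
    toward-y : ∀ {j} → representative j ∈ˢ S → Graph._~_ Tᴳ (inj₁ w′) j → j ≡ inj₁ y′
    toward-y {inj₁ v} p f = cong inj₁ (vertex-injective (single p y∈ f e))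
    toward-y {inj₂ l} p (i , f) = contradiction
      (subst (_∈ cycle G l) (single (whole (cycle G l) (base∈ l) (i , refl) p) y∈ f e) (i , refl)) (y-off (cycle G l))
    singleT : SinglyAttached Tᴳ representative S (inj₁ w′)
    singleT p q f g = trans (toward-y p f) (sym (toward-y q g))

even-order : ∀ {V : Set} {G : Graph V} (O : Cycle G) → 2 ∣ order O → ∃ λ k → order O ≡ suc k ℕ.* 2
even-order O (divides zero p≡) = contradiction (subst (3 ≤_) p≡ (Cycle.order≥3 O)) λ ()
even-order O (divides (suc k) p≡) = k , p≡

-- Eliminating a leaf cycle of the contraction

module LeafCycleClaim {n : ℕ} (Φ : GainGraph n) (tight : Tight (graph Φ)) where
  open GainGraph Φ using (_~_; symm)
  open ContractionRank Φ tight

  private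
    G : Graph (Fin n)
    G = graph Φ
    A B : Matrix (Fin n) (Fin n)
    A = adjacencyMatrix G
    B = gainMatrix Φ
    WA : Weighting G A
    WA = adjacency-weighting G
    WB : Weighting G B
    WB = gain-weighting Φ
  open Extremality G A B WA WB
  open Extremal
  open CycleVertexDeleted

  module _ {S : Subset n} {d : ℕ} (E : Extremal S d) (whole : CyclesWhole S)
    (κ : Fin (cycleCount G)) (O : Cycle G) (O≡ : cycle G κ ≡ O) where
    private
      base∈O : base κ ∈ O
      base∈O = subst (base κ ∈_) O≡ (base∈ κ)

      index-κ : ∀ {l x} → x ∈ cycle G l → x ∈ O → l ≡ κ
      index-κ p q = same-index p (subst (_ ∈_) (sym O≡) q)

    module _ (within : Within O S) (k : ℕ) (p≡ : order O ≡ suc k ℕ.* 2) where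
      open LeafCycle tight O S within k p≡

      record Detached : Set where
        field
          {d′}      : ℕ
          extremalK : Extremal K d′
          A-drop    : rankA E ≡ order O + rankA extremalK
          B-drop    : rankB E ≡ k ℕ.* 2 + rankB extremalK
      open Detached

      -- Vertex 1 costs the rank of `G` 2 and that of Φ nothing; the path costs both 2k, and 2k + 2
      -- is the order. The hitting set obtained after deleting vertex 1 serves for the smaller set
      -- `K`.
      detach : ∀ s → (∀ j → 1 < j → j ≤ order O → ∀ {y} → y ∈ˢ S → ¬ (y ∈ O) → ¬ (at O (shift s j) ~ y)) → ¬ ¬ Detached
      detach s no-exit = do
        C ← extremal-cycle-vertex tight O within (shift s 1 , refl) E
        (a , ra) ← weighted-exists WA K
        (b , rb) ← weighted-exists WB K
        let E₁ = extremal C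
            A₁ = detached-rank WA s no-exit (hasRankA E₁) ra
            B₁ = detached-rank WB s no-exit (hasRankB E₁) rb
        pure record
          { extremalK = record
            { hasRankA = ra ; hasRankB = rb
            ; gap = ℕ.+-cancelˡ-≡ (k ℕ.* 2) _ _ (trans (sym A₁) (trans (gap E₁)
                (trans (cong (_+ 2 ℕ.* CycleVertexDeleted.d′ C) B₁) (ℕ.+-assoc (k ℕ.* 2) b _))))
            ; hitting = hitting E₁ ; few = few E₁
            ; hits = hits-mono (λ p → ∈− (proj₁ (K⇒ p)) λ { refl → proj₂ (K⇒ p) (_ , refl) }) (hits E₁) }
          ; A-drop = trans (drop-A C (hasRankA E) (hasRankA E₁)) (trans (cong (2 +_) A₁) (cong (_+ a) (sym p≡)))
          ; B-drop = trans (keep-B C (hasRankB E) (hasRankB E₁)) B₁ }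

      record Attached (z : Fin n) (D : Detached) : Set where
        field
          {a b} : ℕ
          ranka : Rank A (K − z) a
          rankb : Rank B (K − z) b
          a≡    : rankA (extremalK D) ≡ 2 + a
          b≡    : rankB (extremalK D) ≡ 2 + b
      open Attached

      -- Both eliminations of `O` start from the same ranks for `S`, so what they leave behind
      -- differs by the 2 of the pendant pair.
      attach : ∀ s → (∀ j → 1 < j → j < order O → ∀ {y} → y ∈ˢ S → ¬ (y ∈ O) → ¬ (at O (shift s j) ~ y)) →
        ∀ {z} → z ∈ˢ S → ¬ (z ∈ O) → at O s ~ z → (∀ {y} → y ∈ˢ S → ¬ (y ∈ O) → at O s ~ y → y ≡ z) →
        ∀ D → ¬ ¬ Attached z D
      attach s no-exit {z} z∈S z∉O e single D = do
        C ← extremal-cycle-vertex tight O within (shift s 1 , refl) E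
        (a , ra) ← weighted-exists WA (K − z)
        (b , rb) ← weighted-exists WB (K − z)
        let E₁ = extremal C
            A₁ = attached-rank WA s no-exit z∈S z∉O e single (hasRankA E₁) ra
            B₁ = attached-rank WB s no-exit z∈S z∉O e single (hasRankB E₁) rb
        pure record
          { ranka = ra ; rankb = rb
          ; a≡ = ℕ.+-cancelˡ-≡ (order O) _ _ (trans (sym (A-drop D))
              (trans (drop-A C (hasRankA E) (hasRankA E₁)) (trans (cong (2 +_) A₁) (cong (_+ (2 + a)) (sym p≡)))))
          ; b≡ = ℕ.+-cancelˡ-≡ (k ℕ.* 2) _ _ (trans (sym (B-drop D)) (trans (keep-B C (hasRankB E) (hasRankB E₁)) B₁)) }

      K-smaller : size K < size S
      K-smaller = Subset.p⊂q⇒∣p∣<∣q∣ ((λ p → proj₁ (K⇒ p)) , base κ , within base∈O , λ p → proj₂ (K⇒ p) base∈O)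

      K-whole : CyclesWhole K
      K-whole O′ x∈ y∈ x∈K = ⇒K (whole O′ x∈ y∈ (proj₁ (K⇒ x∈K)))
        λ y∈O → proj₂ (K⇒ x∈K) (common-vertex⇒⊆ tight O′ O y∈ y∈O x∈)

      -- `base κ` is the only label on `O`, so for T_G its deletion amounts to that of all of `O`.
      S−base⇒K : ∀ {i} → representative i ∈ˢ (S − base κ) → representative i ∈ˢ K
      S−base⇒K {inj₁ u} p = ⇒K (∈−⇒∈ p) (off-cycle {u} O)
      S−base⇒K {inj₂ l} p = ⇒K (∈−⇒∈ p) λ q → ∈−⇒≢ p (cong base (index-κ (base∈ l) q))

      K⇒S−base : ∀ {x} → x ∈ˢ K → x ∈ˢ (S − base κ)
      K⇒S−base p = ∈− (proj₁ (K⇒ p)) λ { refl → proj₂ (K⇒ p) base∈O }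

      totalOrder-K : totalOrder S ≡ order O + totalOrder K
      totalOrder-K = trans (Σℕ-drop κ
          (λ l l≢κ → weight-same {S} {K} {l} (λ p → ⇒K p λ q → l≢κ (index-κ (base∈ l) q)) (λ p → proj₁ (K⇒ p)))
          (weight-out {K} {κ} λ p → proj₂ (K⇒ p) base∈O))
        (cong (_+ totalOrder K) (trans (weight-in {S} {κ} (within base∈O)) (cong order O≡)))

      rankΓ-K : ∀ {γ} → RankΓ S γ → RankΓ K γ
      rankΓ-K = rank-resp vertex (adjacencyMatrix (acyclicPart G)) (λ {u} p → ⇒K p (off-cycle {u} O)) (λ p → proj₁ (K⇒ p))

      rank-through-K : ∀ {a t t′} → Rank A S a → (D : Detached) → t ≡ t′ → rankA (extremalK D) ≡ t′ + totalOrder K → a ≡ t + totalOrder S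
      rank-through-K {a} {t} {t′} rA D t≡ aK≡ = begin
        a                                   ≡⟨ rank-same rA (hasRankA E) ⟩
        rankA E                             ≡⟨ A-drop D ⟩
        order O + rankA (extremalK D)       ≡⟨ cong (order O +_) aK≡ ⟩
        order O + (t′ + totalOrder K)       ≡⟨ ℕ.+-assoc (order O) t′ _ ⟨
        order O + t′ + totalOrder K         ≡⟨ cong (_+ totalOrder K) (ℕ.+-comm (order O) t′) ⟩
        t′ + order O + totalOrder K         ≡⟨ ℕ.+-assoc t′ (order O) _ ⟩
        t′ + (order O + totalOrder K)       ≡⟨ cong₂ _+_ (sym t≡) (sym totalOrder-K) ⟩
        t + totalOrder S                    ∎
        where open ≡-Reasoning

      exits : ∀ {j} → representative j ∈ˢ S → Graph._~_ (contraction G) (inj₂ κ) j →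
        ∃ λ x → ∃ λ z → x ∈ O × z ∈ˢ S × ¬ (z ∈ O) × x ~ z × (∀ {u} → j ≡ inj₁ u → vertex u ≡ z) × (∀ {l} → j ≡ inj₂ l → z ∈ cycle G l)
      exits {inj₁ u} u∈ (i , e) = _ , vertex u , subst (_ ∈_) O≡ (i , refl) , u∈ , off-cycle {u} O , symm e
        , (λ { refl → refl }) , λ ()
      exits {inj₂ l} l∈ (κ≢l , i , j , e) = _ , _ , subst (_ ∈_) O≡ (i , refl) , whole (cycle G l) (base∈ l) (j , refl) l∈
        , (λ p → κ≢l (sym (index-κ (j , refl) p))) , e , (λ ()) , λ { refl → j , refl }

      claim-detached : Detached → (∀ {x z} → x ∈ O → z ∈ˢ S → ¬ (z ∈ O) → ¬ (x ~ z)) → Claim K → ¬ ¬ Claim S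
      claim-detached D none claim = do
        (t′ , rT′) ← rankT-exists K
        (γ′ , rΓ′) ← rankΓ-exists K
        pure (mkClaim λ rA rT rΓ →
          let aK≡ , t′≡ = equations claim (hasRankA (extremalK D)) rT′ (rankΓ-K rΓ)
              t≡ = isolated-rank representative (adjacency-weighting (contraction G)) (λ {i} {j} → aloneT {i} {j}) rT
                     (rank-resp representative (adjacencyMatrix (contraction G)) K⇒S−base (λ {i} → S−base⇒K {i}) rT′)
          in rank-through-K rA D t≡ aK≡ , trans t≡ t′≡)
        where
        aloneT : ∀ {i j} → representative j ∈ˢ S → representative i ≡ base κ → ¬ (Graph._~_ (contraction G) i j)
        aloneT {i} {j} j∈ i≡ e with representative-injective {i} {inj₂ κ} i≡
        ... | refl with exits {j} j∈ e
        ... | _ , _ , x∈ , z∈ , z∉ , f , _ = none x∈ z∈ z∉ f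

      module _ {i : Fin (order O)} {z : Fin n} (z∈S : z ∈ˢ S) (z∉O : ¬ (z ∈ O)) (e : at O i ~ z)
        (only : ∀ {x y} → x ∈ O → ¬ (y ∈ O) → y ∈ˢ S → x ~ y → x ≡ at O i × y ≡ z) where

        detach-exit : ¬ ¬ Detached
        detach-exit with previous i
        ... | s , refl = detach s λ j 1<j j≤p y∈ y∉ f → ℕ.<-irrefl
          (sym (peel-distinct O s S (ℕ.<⇒≤ 1<j) j≤p (s≤s z≤n) (ℕ.<-trans (s≤s z≤n) (Cycle.order≥3 O))
            (proj₁ (only (_ , refl) y∉ y∈ f)))) 1<j

        attach-exit : ∀ D → ¬ ¬ Attached z D
        attach-exit = attach i
          (λ j 1<j j<p y∈ y∉ f → ℕ.<-irrefl (peel-distinct O i S (ℕ.<⇒≤ 1<j) (ℕ.<⇒≤ j<p)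
            (ℕ.<-trans (s≤s z≤n) (Cycle.order≥3 O)) ℕ.≤-refl
            (trans (proj₁ (only (_ , refl) y∉ y∈ f)) (cong (at O) (sym (shift-period i))))) j<p)
          z∈S z∉O e (λ y∈ y∉ f → proj₂ (only (_ , refl) y∉ y∈ f))

        -- Were z on a cycle, deleting it would not change the rank of the gain graph on K.
        exit-off-cycle : ∀ D → Attached z D → ∀ O′ → ¬ (z ∈ O′)
        exit-off-cycle D At O′ z∈O′ = (do
          C ← extremal-cycle-vertex tight O′ withinK z∈O′ (extremalK D)
          pure (ℕ.m≢1+n+m (b At) {1} (trans (sym (keep-B C (hasRankB (extremalK D)) (rankb At))) (b≡ At)))) id
          where
          withinK : Within O′ K
          withinK x∈O′ = ⇒K (whole O′ z∈O′ x∈O′ z∈S) λ x∈O → z∉O (common-vertex⇒⊆ tight O′ O x∈O′ x∈O z∈O′)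

        extremal-K−z : ∀ D → Attached z D → Extremal (K − z) (d′ D)
        extremal-K−z D At = record
          { hasRankA = ranka At ; hasRankB = rankb At
          ; gap = ℕ.+-cancelˡ-≡ 2 _ _ (trans (sym (a≡ At)) (trans (gap (extremalK D)) (cong (_+ 2 ℕ.* d′ D) (b≡ At))))
          ; hitting = hitting (extremalK D) ; few = few (extremalK D)
          ; hits = hits-mono ∈−⇒∈ (hits (extremalK D)) }

        K−z-whole : (∀ O′ → ¬ (z ∈ O′)) → CyclesWhole (K − z)
        K−z-whole off O′ x∈ y∈ x∈K = ∈− (K-whole O′ x∈ y∈ (∈−⇒∈ x∈K)) λ { refl → off O′ y∈ }

        -- In T_G the cycle is pendant at `z`, so the rank for `S` is 2 more than for `K − z`. The
        -- claims for `K` and `K − z`, which have the same cycles, carry r(K) = r(K - z) + 2 over to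
        -- T_G; hence `S` and `K` give the same rank there.
        claim-attached : ∀ D → Attached z D → (∀ (O′ : Cycle G) → ¬ (z ∈ O′)) → Claim K → Claim (K − z) → ¬ ¬ Claim S
        claim-attached D At off claimK claimK−z = do
          (tK , rTK) ← rankT-exists K
          (t″ , rT″) ← rankT-exists (K − z)
          (γ″ , rΓ″) ← rankΓ-exists (K − z)
          pure (mkClaim λ {a} {t} {γ} rA rT rΓ →
            let aK≡ , tK≡ = equations claimK (hasRankA (extremalK D)) rTK (rankΓ-K rΓ)
                a″≡ , _ = equations claimK−z (ranka At) rT″ rΓ″
                t≡ = pendant-rank representative (adjacency-weighting (contraction G)) representative-injective
                       {w = inj₂ κ} {y = inj₁ z′} (within base∈O) z∈S edgeT singleT rT
                       (rank-resp representative (adjacencyMatrix (contraction G))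
                         (λ p → ∈− (∈− (proj₁ (K⇒ (∈−⇒∈ p))) (∈−⇒≢ p)) (∈−⇒≢ (K⇒S−base (∈−⇒∈ p))))
                         (λ {j} p → ∈− (S−base⇒K {j} (∈− (∈−⇒∈ (∈−⇒∈ p)) (∈−⇒≢ p))) (∈−⇒≢ (∈−⇒∈ p)))
                         rT″)
                tK≡2+t″ = ℕ.+-cancelʳ-≡ (totalOrder K) tK (2 + t″)
                  (trans (sym aK≡) (trans (a≡ At) (cong (2 +_) (trans a″≡ (cong (t″ +_) (sym totalOrder-K−z))))))
                t≡tK = trans t≡ (sym tK≡2+t″)
            in rank-through-K rA D t≡tK aK≡ , trans t≡tK tK≡)
          where
          z′ : AcyclicVertex G
          z′ = ⟨ z ⟩ off
          totalOrder-K−z : totalOrder K ≡ totalOrder (K − z)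
          totalOrder-K−z = Σℕ-cong λ l → weight-same {K} {K − z} {l} (λ p → ∈− p λ { refl → off (cycle G l) (base∈ l) }) ∈−⇒∈
          edgeT : Graph._~_ (contraction G) (inj₂ κ) (inj₁ z′)
          edgeT with subst (at O i ∈_) (sym O≡) (i , refl)
          ... | i′ , i′≡ = i′ , subst (z ~_) (sym i′≡) (symm e)
          toward-z : ∀ {j} → representative j ∈ˢ S → Graph._~_ (contraction G) (inj₂ κ) j → j ≡ inj₁ z′
          toward-z {j} j∈ f with exits {j} j∈ f
          toward-z {inj₁ u} j∈ f | _ , _ , x∈ , y∈ , y∉ , g , u≡ , _ =
            cong inj₁ (vertex-injective (trans (u≡ refl) (proj₂ (only x∈ y∉ y∈ g))))
          toward-z {inj₂ l} j∈ f | _ , _ , x∈ , y∈ , y∉ , g , _ , on =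
            contradiction (subst (_∈ cycle G l) (proj₂ (only x∈ y∉ y∈ g)) (on refl)) (off (cycle G l))
          singleT : SinglyAttached (contraction G) representative S (inj₂ κ)
          singleT {y₁} {y₂} p q f g = trans (toward-z {y₁} p f) (sym (toward-z {y₂} q g))

-- Induction over leaves of the contraction

module _ {n : ℕ} (Φ : GainGraph n) where
  open GainGraph Φ using (_~_)

  private
    G : Graph (Fin n)
    G = graph Φ
    A B : Matrix (Fin n) (Fin n)
    A = adjacencyMatrix G
    B = gainMatrix Φ
    WA : Weighting G A
    WA = adjacency-weighting G
    WB : Weighting G B
    WB = gain-weighting Φ
  open Extremality G A B WA WB

  contraction-claim : ∀ (tight : Tight G) m {S d} → size S < m → ContractionRank.CyclesWhole Φ tight S → Extremal S d →
    ¬ ¬ ContractionRank.Claim Φ tight S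
  contraction-claim tight (suc m) {S} S<m whole E = do
    yes (t₀ , t₀∈S) ← em (∃ λ t → t ∈ˢ S)
      where no none → pure (claim-empty λ p → none (_ , p))
    leaf ← Bl.leaf-block t₀∈S
    by-leaf leaf
    where
    open ContractionRank Φ tight
    module Bl = CycleBlocks {G = G} S (λ _ → Unit)
      (λ {O} _ x∈O x∈S y∈O → whole O x∈O y∈O x∈S) (λ _ _ → tt)
      (λ {O} {O′} _ _ p q r → common-vertex⇒⊆ tight O O′ p q r) (λ {O} _ → no-detour tight O)
    by-leaf : LeafBlock G S (λ _ → Unit) → ¬ ¬ Claim S
    by-leaf (leaf-vertex w w∈S off single) = do
      yes (y , y∈S , e) ← em (∃ λ y → y ∈ˢ S × w ~ y)
        where
        no none → do
          E′ ← extremal-isolated (λ y∈ e → none (_ , y∈ , e)) E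
          claim ← contraction-claim tight m (size-− {G = G} w∈S S<m)
            (λ O x∈ y∈ p → ∈− (whole O x∈ y∈ (∈−⇒∈ p)) λ { refl → off O tt y∈ }) E′
          claim-isolated whole (λ O → off O tt) (λ y∈ e → none (_ , y∈ , e)) claim
      let y-off : ∀ O → ¬ (y ∈ O)
          y-off O y∈O = pendant-off-cycle tight O (λ x∈O → whole O y∈O x∈O y∈S) w∈S y∈S e single E y∈O
      E′ ← extremal-pendant w∈S y∈S e single E
      claim ← contraction-claim tight m (size-−-≤ {G = G} {S = S − y} w (size-− {G = G} y∈S S<m))
        (λ O x∈ v∈ p → ∈− (∈− (whole O x∈ v∈ (∈−⇒∈ (∈−⇒∈ p))) λ { refl → y-off O v∈ }) λ { refl → off O tt v∈ }) E′
      claim-pendant whole (λ O → off O tt) y-off w∈S y∈S e single claim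
    -- T_G has one vertex per enumerated cycle, so `O′` is replaced by its representative, which has
    -- the same vertices.
    by-leaf (leaf-cycle O′ _ within′ exit) with cycle-index O′
    ... | κ , to , from = by-cycle (cycle G κ) refl (within′ ∘ from)
            λ p₁ p₂ q₁ q₂ → exit (from p₁) (from p₂) (q₁ ∘ to) (q₂ ∘ to)
      where
      open LeafCycleClaim Φ tight
      by-cycle : ∀ O → cycle G κ ≡ O → Within O S →
        (∀ {a₁ a₂ b₁ b₂} → a₁ ∈ O → a₂ ∈ O → ¬ (b₁ ∈ O) → ¬ (b₂ ∈ O) → b₁ ∈ˢ S → b₂ ∈ˢ S →
          a₁ ~ b₁ → a₂ ~ b₂ → a₁ ≡ a₂ × b₁ ≡ b₂) → ¬ ¬ Claim S
      by-cycle O O≡ within exit = do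
        (typeA , _) ← cycle-type Φ tight O within E
        let k , p≡ = even-order O (proj₁ typeA)
            K<m = ℕ.<-≤-trans (K-smaller E whole κ O O≡ within k p≡) (ℕ.≤-pred S<m)
            K-whole′ = K-whole E whole κ O O≡ within k p≡
        yes (i , z , z∈S , z∉O , e) ← em (∃ λ i → ∃ λ z → z ∈ˢ S × ¬ (z ∈ O) × at O i ~ z)
          where
          no none → do
            D ← detach E whole κ O O≡ within k p≡ (start O) (λ j _ _ y∈ y∉ f → none (_ , _ , y∈ , y∉ , f))
            claim ← contraction-claim tight m K<m K-whole′ (Detached.extremalK D)
            claim-detached E whole κ O O≡ within k p≡ D (λ { (_ , refl) z∈ z∉ f → none (_ , _ , z∈ , z∉ , f) }) claim
        let only : ∀ {x y} → x ∈ O → ¬ (y ∈ O) → y ∈ˢ S → x ~ y → x ≡ at O i × y ≡ z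
            only x∈ y∉ y∈ f = exit x∈ (i , refl) y∉ z∉O y∈ z∈S f e
        D ← detach-exit E whole κ O O≡ within k p≡ z∈S z∉O e only
        At ← attach-exit E whole κ O O≡ within k p≡ z∈S z∉O e only D
        let off = exit-off-cycle E whole κ O O≡ within k p≡ z∈S z∉O e only D At
        claimK ← contraction-claim tight m K<m K-whole′ (Detached.extremalK D)
        claimK−z ← contraction-claim tight m (size-−-≤ {G = G} {S = LeafCycle.K tight O S within k p≡} z K<m)
          (K−z-whole E whole κ O O≡ within k p≡ z∈S z∉O e only off)
          (extremal-K−z E whole κ O O≡ within k p≡ z∈S z∉O e only D At)
        claim-attached E whole κ O O≡ within k p≡ z∈S z∉O e only D At off claimK claimK−z

-- From the integer hypothesis to extremality of the whole vertex set

open import Data.Integer.Base using (+_)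

isRank⇒hasRank : ∀ {n} {I : Set} (ι : I → Fin n) {M : Matrix I I} {r} → IsRank M r → HasRank ι M ⊤ r
isRank⇒hasRank ι ((f , ind) , max) = mkRank (f , (λ _ → Subset.∈⊤) , λ c h → ind c (λ j → h j Subset.∈⊤))
  λ g (_ , ind′) → max g (λ c h → ind′ c (λ j _ → h j))

θ≡ : ∀ {n t} (G : Graph (Fin n)) → n + t ≡ edgeCount G + componentCount G → θ G ≡ + t
θ≡ {n} {t} G e = begin
  + m ℤ.- + n ℤ.+ + ω      ≡⟨ solve 3 (λ m n w → m :- n :+ w := m :+ w :- n) refl (+ m) (+ n) (+ ω) ⟩
  + (m + ω) ℤ.- + n        ≡⟨ cong (λ x → + x ℤ.- + n) (sym e) ⟩
  + n ℤ.+ + t ℤ.- + n      ≡⟨ solve 2 (λ n t → n :+ t :- n := t) refl (+ n) (+ t) ⟩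
  + t                      ∎
  where
  open ℤ-Solver
  open ≡-Reasoning
  m ω : ℕ
  m = edgeCount G
  ω = componentCount G

rank-gap-ℕ : ∀ {a b t} → + b ≡ + a ℤ.- + 2 ℤ.* + t → a ≡ b + 2 ℕ.* t
rank-gap-ℕ {a} {b} {t} e = ℤ.+-injective (begin
  + a                                        ≡⟨ solve 2 (λ a t → a := a :- t :+ t) refl (+ a) (+ 2 ℤ.* + t) ⟩
  + a ℤ.- + 2 ℤ.* + t ℤ.+ + 2 ℤ.* + t        ≡⟨ cong₂ ℤ._+_ (sym e) (sym (ℤ.pos-* 2 t)) ⟩
  + b ℤ.+ + (2 ℕ.* t)                        ∎)
  where
  open ℤ-Solver
  open ≡-Reasoning

theorem4p6 : ∀ {n : ℕ} (Φ : GainGraph n) (rΦ rG : ℕ) →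
    IsRank (gainMatrix Φ) rΦ →
    IsRank (adjacencyMatrix (graph Φ)) rG →
    + rΦ ≡ + rG ℤ.- + 2 ℤ.* θ (graph Φ) →
    (∀ (O O′ : Cycle (graph Φ)) → ¬ SameCycle O O′ → Disjoint O O′)
    × (∀ (O : Cycle (graph Φ)) → IsTypeA Φ O × order O % 4 ≡ 2)
    × (∀ (rT rΓ : ℕ) →
    IsRank (adjacencyMatrix (contraction (graph Φ))) rT →
    IsRank (adjacencyMatrix (acyclicPart (graph Φ))) rΓ →
    rG ≡ rT + sumOfCycleOrders (graph Φ) × rT ≡ rΓ)
theorem4p6 {n} Φ rΦ rG isRankΦ isRankG extremal = disjoint , typeA , contracted
  where
  G : Graph (Fin n)
  G = graph Φ
  open Extremality G (adjacencyMatrix G) (gainMatrix Φ) (adjacency-weighting G) (gain-weighting Φ)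
  t : ℕ
  -- Truncation loses nothing: `hitting-set-all` shows that `n` is at most the sum it is subtracted
  -- from.
  t = edgeCount G + componentCount G ℕ.∸ n
  t≡ : n + t ≡ edgeCount G + componentCount G
  t≡ = ℕ.m+[n∸m]≡n (≤-stable do
    (X , bound , _) ← hitting-set-all G
    pure (ℕ.≤-trans (ℕ.m≤m+n n (length X)) bound))
  RA : Rank (adjacencyMatrix G) ⊤ rG
  RA = isRank⇒hasRank id isRankG
  RB : Rank (gainMatrix Φ) ⊤ rΦ
  RB = isRank⇒hasRank id isRankΦ
  gap⊤ : rG ≡ rΦ + 2 ℕ.* t
  gap⊤ = rank-gap-ℕ {rG} {rΦ} {t} (subst (λ x → + rΦ ≡ + rG ℤ.- + 2 ℤ.* x) (θ≡ G t≡) extremal)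
  tight : Tight G
  tight = extremal⇒tight RB RA t≡ gap⊤
  E⊤ : ¬ ¬ Extremal ⊤ t
  E⊤ = extremal-⊤ RB RA t≡ gap⊤
  open ContractionRank Φ tight
  disjoint : ∀ (O O′ : Cycle G) → ¬ SameCycle O O′ → Disjoint O O′
  disjoint O O′ different v (p , q) = different (common-vertex⇒same tight O O′ p q)
  typeA : ∀ (O : Cycle G) → IsTypeA Φ O × order O % 4 ≡ 2
  typeA O = (decidable-stable (2 ∣? order O) (¬¬type >>= λ p → pure (proj₁ (proj₁ p)))
            , ≈-stable (¬¬type >>= λ p → pure (proj₂ (proj₁ p))))
          , ≡-stable (¬¬type >>= λ p → pure (proj₂ p))
    where
    ¬¬type : ¬ ¬ (IsTypeA Φ O × order O % 4 ≡ 2)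
    ¬¬type = do
      E ← E⊤
      cycle-type Φ tight O (λ _ → Subset.∈⊤) E
  contracted : ∀ rT rΓ → IsRank (adjacencyMatrix (contraction G)) rT → IsRank (adjacencyMatrix (acyclicPart G)) rΓ →
    rG ≡ rT + sumOfCycleOrders G × rT ≡ rΓ
  contracted rT rΓ isRankT isRankΓ = ≡-stable (¬¬both >>= λ p → pure (proj₁ p)) , ≡-stable (¬¬both >>= λ p → pure (proj₂ p))
    where
    ¬¬both : ¬ ¬ (rG ≡ rT + sumOfCycleOrders G × rT ≡ rΓ)
    ¬¬both = do
      E ← E⊤
      claim ← contraction-claim Φ tight (suc (size {n} ⊤)) ℕ.≤-refl (λ _ _ _ _ → Subset.∈⊤) E
      let rG≡ , rT≡ = equations claim RA (isRank⇒hasRank representative isRankT) (isRank⇒hasRank vertex isRankΓ)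
      pure (trans rG≡ (cong (λ s → rT + s) (Σℕ-cong λ k → weight-in {⊤} {k} Subset.∈⊤)) , rT≡)
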